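{- For every integer $n \ge 12$, with $P_{n,H}(k) := P(|S-S| = k)$ where $S$ is a uniformly random subset of $[n]=\{0,1,\dots,n-1\}$, we have \[ P_{n,H}(3) > P_{n,H}(5) < P_{n,H}(7),\qquad P_{n,H}(7) > P_{n,H}(9) < P_{n,H}(11),\qquad P_{n,H}(13) > P_{n,H}(15) < P_{n,H}(17). \]
   Context: For a positive integer $n$, $[n] := \{0,1,\dots,n-1\}$, and $S$ is chosen uniformly at random among all $2^n$ subsets of $[n]$ (equivalently, each element is included independently with probability $1/2$). The difference set is $S-S := \{x-y : x,y \in S\}$, and $|A|$ denotes the cardinality of a set $A$. -}

module Defs where

open import Data.Bool using (Bool; true; false)
open import Data.Nat using (ℕ; zero; suc; _∸_)
open import Data.Integer as ℤ using (ℤ; +_; -_)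
import Data.Integer.Properties as ℤP
open import Data.List using (List; []; _∷_; upTo; filter; length; map; _++_)
open import Data.Fin using (Fin; toℕ)
open import Data.Fin.Subset using (Subset; _∈_)
open import Data.Fin.Subset.Properties using (_∈?_)
open import Data.Fin.Properties using (any?)
open import Relation.Nullary.Decidable using (Dec; _×-dec_)
open import Data.Product using (∃₂; _×_)
open import Relation.Binary.PropositionalEquality using (_≡_)
open import Data.Vec using (Vec; []; _∷_)

-- All 2^n subsets of [n] = {0,…,n-1}, as characteristic vectors
-- (Data.Fin.Subset: Subset n = Vec Bool n).  Each subset occurs exactly once,
-- so a list-count over allSubsets n is 2^n times the uniform probability.
allSubsets : (n : ℕ) → List (Subset n)
allSubsets zero    = [] ∷ []
allSubsets (suc n) = map (true ∷_) (allSubsets n) ++ map (false ∷_) (allSubsets n)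

_∈Diff_ : {n : ℕ} → ℤ → Subset n → Set
z ∈Diff S = ∃₂ λ x y → x ∈ S × y ∈ S × z ≡ (+ toℕ x) ℤ.- (+ toℕ y)

_∈Diff?_ : {n : ℕ} → (z : ℤ) → (S : Subset n) → Dec (z ∈Diff S)
z ∈Diff? S = any? λ x → any? λ y →
  (x ∈? S) ×-dec ((y ∈? S) ×-dec (z ℤP.≟ ((+ toℕ x) ℤ.- (+ toℕ y))))

-- The integers in the window {-(n-1), …, n-1}, each listed once;
-- S - S ⊆ this window for S ⊆ [n].
window : ℕ → List ℤ
window n = map (λ i → (+ i) ℤ.- (+ (n ∸ 1))) (upTo (2 * n ∸ 1))
  where open Data.Nat using (_*_)

diffSetSize : {n : ℕ} → Subset n → ℕ
diffSetSize {n} S = length (filter (λ z → z ∈Diff? S) (window n))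

countDiff : ℕ → ℕ → ℕ
countDiff n k = length (filter (λ S → diffSetSize S Data.Nat.≟ k) (allSubsets n))

open import Data.Rational.Unnormalised using (ℚᵘ; mkℚᵘ)
P : (n k : ℕ) → ℚᵘ
P n k = mkℚᵘ (+ countDiff n k) (2 Data.Nat.^ n ∸ 1)

{-# OPTIONS --safe #-}
module Submission where

-- Let m be the number of positive differences of S, so that |S − S| = 2 m + 1. Splitting the
-- subsets of [n] by their minimum and maximum reduces every comparison to subsets of [0, d] that
-- contain 0 and d, once it is known for n = 12 (by enumeration). For those, the decisive
-- comparison is that of m = 7 with m = 6 and m = 8:
--
-- * If u ∈ S then u and d − u are both differences. Hence a set with m = 7 meets at most three
--   orbits of size two of z ↦ d − z, and the coincidences forced among the differences of its
--   points put it into one of boundedly many one-parameter families: at most 14 d + 98 sets.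
-- * {0, a, b, d} has m = 6 and {0, x, d − x, y, d} has m = 8 unless one of a few linear relations
--   holds, which leaves quadratically many sets.
--
-- The linear bound falls below the quadratic ones for d ≥ 50; for smaller d the members of the
-- families are enumerated. The cases m = 2 and m = 4 are similar and easier. The many case
-- distinctions in linear integer arithmetic are decided by a verified Fourier–Motzkin procedure.

open import Defs
open import Data.Bool using (Bool; T; T?; _∧_; false; if_then_else_; true)
open import Data.Empty using (⊥; ⊥-elim)
open import Data.Fin using (#_; Fin; suc; toℕ; zero)
open import Data.Fin.Subset as Subset using (Subset)
import Data.Integer.Properties as ℤP
open import Data.List using (List; []; _++_; _∷_; cartesianProduct; concatMap; filter; length; map; upTo)
open import Data.List.Membership.Propositional using (_∈_; find; lose)
import Data.List.Membership.Propositional.Properties as ∈P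
import Data.List.Properties as ListP
open import Data.List.Relation.Unary.All as All using (All; []; _∷_)
import Data.List.Relation.Unary.All.Properties as AllP
open import Data.List.Relation.Unary.AllPairs using ([]; _∷_)
open import Data.List.Relation.Unary.Any as Any using (here; there)
open import Data.List.Relation.Unary.Unique.Propositional using (Unique)
import Data.List.Relation.Unary.Unique.Propositional.Properties as UniqueP
import Data.Nat.DivMod as DivMod
import Data.Nat.Properties as ℕP
open import Data.Product using (_,_; _×_; proj₁; proj₂; ∃; ∃₂)
open import Data.Sum using (_⊎_; inj₁; inj₂)
import Data.Sum.Properties as SumP
open import Data.Unit using (tt)
open import Data.Vec as Vec using (Vec; []; _∷_; _∷ʳ_; here; lookup; there; zipWith)
open import Function using (_∘_)
open import Level using (0ℓ)
open import Relation.Binary.Definitions using (tri<; tri>; tri≈)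
open import Relation.Binary.PropositionalEquality
open import Relation.Nullary using (Dec; does; no; yes; ¬_)
open import Relation.Nullary.Decidable using (_×-dec_; _→-dec_; _⊎-dec_; decidable-stable; ¬?)
open import Relation.Unary using (Decidable; Pred)
open import Data.List.Membership.DecPropositional ℤP._≟_ using (_∈?_)

-- For the sets that contain 0 and d only weak inequalities are needed: by `total-suc` and
-- `leading-suc` every later count is an earlier one plus such terms, so the strictness found at n =
-- 12 persists. The easier cases rest on comparing slopes. For m = 3 there are the sets {0, x, d},
-- for m = 5 the sets {0, x, 2x, d} and their mirror images, about d in either case; for m = 4
-- essentially {0, t, d - t, d} with t < d/2 is left, about d/2 sets; for m = 2 only the midpoint
-- can be added to 0 and d. For m = 7 the obstacle is that the relations forced among the points
-- also have sporadic solutions inside (d/7)ℤ and (d/8)ℤ; these are listed separately, at constant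
-- cost. The upper bounds need only lists that contain every set in question. Such a list may repeat
-- a set or contain sets with another m, which keeps the case distinctions short; for small d it is
-- filtered by the actual m before it is counted. The lower bounds, in contrast, need families
-- without repetitions, and there every relation that could merge two differences is excluded from
-- the parameters.

module LinearArithmetic where

  -- Elimination of variables from systems of affine equations and inequalities

  open import Data.Integer using (ℤ; +_; -[1+_]; _+_; _*_; -_; _-_; _≤_; _<_; -1ℤ; 0ℤ; 1ℤ)
  open import Data.Integer.Tactic.RingSolver using (solve-∀)
  open import Data.Nat using (ℕ; zero; suc)

  -- An affine form in n variables: the coefficients, then the constant term.
  Affine : ℕ → Set
  Affine n = Vec ℤ (suc n)

  eval : ∀ {n} → Affine n → Vec ℤ n → ℤ
  eval (c ∷ []) [] = c
  eval (c ∷ cs@(_ ∷ _)) (x ∷ ρ) = c * x + eval cs ρ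

  combine : ∀ {n} → ℤ → Affine n → ℤ → Affine n → Affine n
  combine a p b q = zipWith (λ x y → a * x + b * y) p q

  eval-combine : ∀ {n} a (p : Affine n) b q ρ →
    eval (combine a p b q) ρ ≡ a * eval p ρ + b * eval q ρ
  eval-combine a (x ∷ []) b (y ∷ []) [] = refl
  eval-combine a (x ∷ p@(_ ∷ _)) b (y ∷ q@(_ ∷ _)) (r ∷ ρ) =
    trans (cong (_+_ ((a * x + b * y) * r)) (eval-combine a p b q ρ)) (lemma a x b y r (eval p ρ) (eval q ρ))
    where
    lemma : ∀ a x b y r u v → (a * x + b * y) * r + (a * u + b * v) ≡ a * (x * r + u) + b * (y * r + v)
    lemma = solve-∀

  Zero NonNeg : ∀ {n} → Vec ℤ n → Affine n → Set
  Zero ρ e = eval e ρ ≡ 0ℤ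
  NonNeg ρ e = 0ℤ ≤ eval e ρ

  nonneg-combine : ∀ {m n u v} → 0ℤ ≤ u → 0ℤ ≤ v → 0ℤ ≤ + m * u + + n * v
  nonneg-combine {m} {n} {u} {v} p q = ℤP.+-mono-≤ {0ℤ} {+ m * u} {0ℤ} {+ n * v} (aux m p) (aux n q)
    where
    aux : ∀ k {w} → 0ℤ ≤ w → 0ℤ ≤ + k * w
    aux k {w} h = subst (_≤ + k * w) (ℤP.*-zeroʳ (+ k)) (ℤP.*-monoˡ-≤-nonNeg (+ k) h)

  -- Eliminates the first variable by the equation with leading coefficient `suc m` and rest `p`.
  -- Nothing is divided: the form is scaled by `suc m`, whose positivity preserves the direction of
  -- an inequality.
  substitute : ∀ {n} → ℕ → Affine n → Affine (suc n) → Affine n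
  substitute m p (a ∷ q) = combine (+ suc m) q (- a) p

  eval-substitute : ∀ {n} m (p : Affine n) q x ρ → eval (+ suc m ∷ p) (x ∷ ρ) ≡ 0ℤ →
    eval (substitute m p q) ρ ≡ + suc m * eval q (x ∷ ρ)
  eval-substitute m p@(_ ∷ _) (a ∷ q@(_ ∷ _)) x ρ h =
    trans (eval-combine (+ suc m) q (- a) p ρ)
      (trans (lemma (+ suc m) a x (eval p ρ) (eval q ρ))
        (trans (cong (λ z → + suc m * (a * x + eval q ρ) - a * z) h) (lemma′ (+ suc m) a (a * x + eval q ρ))))
    where
    lemma : ∀ k a x u v → k * v + (- a) * u ≡ k * (a * x + v) - a * (k * x + u)
    lemma = solve-∀
    lemma′ : ∀ k a w → k * w - a * 0ℤ ≡ k * w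
    lemma′ = solve-∀

  record Pivot (n : ℕ) : Set where
    constructor pivot
    field
      scale : ℕ
      rest  : Affine n
      flat  : List (Affine n)
      todo  : List (Affine (suc n))

  data Search (n : ℕ) : Set where
    noPivot  : List (Affine n) → Search n
    onPivot : Pivot n → Search n

  -- A pivot with negative leading coefficient is negated, so that `substitute` always scales by a
  -- positive number.
  search : ∀ {n} → List (Affine (suc n)) → Search n
  search [] = noPivot []
  search ((+ zero ∷ e) ∷ es) with search es
  ... | noPivot fs = noPivot (e ∷ fs)
  ... | onPivot (pivot m p fs ts) = onPivot (pivot m p (e ∷ fs) ts)
  search ((+ suc m ∷ e) ∷ es) = onPivot (pivot m e [] es)
  search ((-[1+ m ] ∷ e) ∷ es) = onPivot (pivot m (Vec.map -_ e) [] es)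

  eval-neg : ∀ {n} (e : Affine n) ρ → eval (Vec.map -_ e) ρ ≡ - eval e ρ
  eval-neg (c ∷ []) [] = refl
  eval-neg (c ∷ e@(_ ∷ _)) (x ∷ ρ) = trans (cong (_+_ ((- c) * x)) (eval-neg e ρ)) (lemma c x (eval e ρ))
    where
    lemma : ∀ c x u → (- c) * x + - u ≡ - (c * x + u)
    lemma = solve-∀

  eval-flat : ∀ {n} (e : Affine n) x ρ → eval (0ℤ ∷ e) (x ∷ ρ) ≡ eval e ρ
  eval-flat (_ ∷ _) x ρ = ℤP.+-identityˡ _

  SearchOK : ∀ {n} → ℤ → Vec ℤ n → Search n → Set
  SearchOK x ρ (noPivot fs) = All (Zero ρ) fs
  SearchOK x ρ (onPivot (pivot m p fs ts)) =
    Zero (x ∷ ρ) (+ suc m ∷ p) × All (Zero ρ) fs × All (Zero (x ∷ ρ)) ts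

  search-sound : ∀ {n} x (ρ : Vec ℤ n) es → All (Zero (x ∷ ρ)) es → SearchOK x ρ (search es)
  search-sound x ρ [] [] = []
  search-sound x ρ ((+ zero ∷ e) ∷ es) (h ∷ hs) with search es | search-sound x ρ es hs
  ... | noPivot fs | r = trans (sym (eval-flat e x ρ)) h ∷ r
  ... | onPivot (pivot m p fs ts) | a , b , c = a , trans (sym (eval-flat e x ρ)) h ∷ b , c
  search-sound x ρ ((+ suc m ∷ e) ∷ es) (h ∷ hs) = h , [] , hs
  search-sound x ρ ((-[1+ m ] ∷ e) ∷ es) (h ∷ hs) = trans (eval-neg (-[1+ m ] ∷ e) (x ∷ ρ)) (cong -_ h) , [] , hs

  record Split (n : ℕ) : Set where
    constructor split
    field
      lower : List (ℕ × Affine n)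
      upper : List (ℕ × Affine n)
      level : List (Affine n)

  classify : ∀ {n} → List (Affine (suc n)) → Split n
  classify [] = split [] [] []
  classify ((+ zero ∷ e) ∷ es) with classify es
  ... | split l u z = split l u (e ∷ z)
  classify ((+ suc m ∷ e) ∷ es) with classify es
  ... | split l u z = split ((m , e) ∷ l) u z
  classify ((-[1+ m ] ∷ e) ∷ es) with classify es
  ... | split l u z = split l ((m , e) ∷ u) z

  LowerOK UpperOK : ∀ {n} → ℤ → Vec ℤ n → ℕ × Affine n → Set
  LowerOK x ρ (m , e) = NonNeg (x ∷ ρ) (+ suc m ∷ e)
  UpperOK x ρ (m , e) = NonNeg (x ∷ ρ) (-[1+ m ] ∷ e)

  classify-sound : ∀ {n} x (ρ : Vec ℤ n) es → All (NonNeg (x ∷ ρ)) es →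
    All (LowerOK x ρ) (Split.lower (classify es)) ×
    All (UpperOK x ρ) (Split.upper (classify es)) ×
    All (NonNeg ρ) (Split.level (classify es))
  classify-sound x ρ [] [] = [] , [] , []
  classify-sound x ρ ((+ zero ∷ e) ∷ es) (h ∷ hs) with classify-sound x ρ es hs
  ... | a , b , c = a , b , subst (0ℤ ≤_) (eval-flat e x ρ) h ∷ c
  classify-sound x ρ ((+ suc m ∷ e) ∷ es) (h ∷ hs) with classify-sound x ρ es hs
  ... | a , b , c = h ∷ a , b , c
  classify-sound x ρ ((-[1+ m ] ∷ e) ∷ es) (h ∷ hs) with classify-sound x ρ es hs
  ... | a , b , c = a , h ∷ b , c

  -- Each bound is scaled by the absolute value of the other's leading coefficient, so the first
  -- variable cancels; both factors are positive.
  resolve : ∀ {n} → ℕ × Affine n → ℕ × Affine n → Affine n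
  resolve (m , p) (k , q) = combine (+ suc k) p (+ suc m) q

  resolve-sound : ∀ {n} x (ρ : Vec ℤ n) l u → LowerOK x ρ l → UpperOK x ρ u → NonNeg ρ (resolve l u)
  resolve-sound x ρ (m , p@(_ ∷ _)) (k , q@(_ ∷ _)) h h′ =
    subst (0ℤ ≤_)
      (trans (lemma (+ suc m) (+ suc k) x (eval p ρ) (eval q ρ)) (sym (eval-combine (+ suc k) p (+ suc m) q ρ)))
      (nonneg-combine {suc k} {suc m} h h′)
    where
    lemma : ∀ a b x u v → b * (a * x + u) + a * ((- b) * x + v) ≡ b * u + a * v
    lemma = solve-∀

  resolvents : ∀ {n} → List (ℕ × Affine n) → List (ℕ × Affine n) → List (Affine n)
  resolvents ls us = concatMap (λ l → map (resolve l) us) ls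

  resolvents-sound : ∀ {n} x (ρ : Vec ℤ n) ls us → All (LowerOK x ρ) ls → All (UpperOK x ρ) us →
    All (NonNeg ρ) (resolvents ls us)
  resolvents-sound x ρ [] us [] hs = []
  resolvents-sound x ρ (l ∷ ls) us (h ∷ hl) hs =
    AllP.++⁺ (AllP.map⁺ (All.map (λ {u} → resolve-sound x ρ l u h) hs))
      (resolvents-sound x ρ ls us hl hs)

  negative? nonzero? : Affine 0 → Bool
  negative? (+ _ ∷ []) = false
  negative? (-[1+ _ ] ∷ []) = true
  nonzero? (+ zero ∷ []) = false
  nonzero? (+ suc _ ∷ []) = true
  nonzero? (-[1+ _ ] ∷ []) = true

  some : ∀ {A : Set} → (A → Bool) → List A → Bool
  some p [] = false
  some p (x ∷ xs) = if p x then true else some p xs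

  -- Gaussian elimination on the equations, then Fourier–Motzkin elimination on the inequalities.
  infeasible : ∀ n → List (Affine n) → List (Affine n) → Bool
  infeasible zero es is = if some nonzero? es then true else some negative? is
  infeasible (suc n) es is with search es
  ... | onPivot (pivot m p fs ts) =
    infeasible n (map (substitute m p) ts ++ fs) (map (substitute m p) is)
  ... | noPivot fs with classify is
  ...   | split l u z = infeasible n fs (resolvents l u ++ z)

  some-sound : ∀ {A : Set} {P : A → Set} (p : A → Bool) → (∀ x → P x → p x ≡ true → ⊥) →
    ∀ xs → All P xs → some p xs ≡ true → ⊥
  some-sound p h (x ∷ xs) (a ∷ as) e with p x in eq
  ... | true = h x a eq
  ... | false = some-sound p h xs as e

  -- Each round turns a solution into a solution of the reduced system by forgetting its first
  -- coordinate. When no variable is left, a violated constant constraint is the contradiction.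
  infeasible-sound : ∀ n es is (ρ : Vec ℤ n) → infeasible n es is ≡ true →
    All (Zero ρ) es → All (NonNeg ρ) is → ⊥
  infeasible-sound zero es is [] e hs hs′ with some nonzero? es in eq
  ... | true = some-sound {P = Zero []} _ (λ { (.0ℤ ∷ []) refl () }) es hs eq
  ... | false = some-sound {P = NonNeg []} _ (λ { (+ _ ∷ []) _ () ; (-[1+ _ ] ∷ []) () _ }) is hs′ e
  infeasible-sound (suc n) es is (x ∷ ρ) e hs hs′ with search es | search-sound x ρ es hs
  ... | onPivot (pivot m p fs ts) | a , b , c =
    infeasible-sound n _ _ ρ e
      (AllP.++⁺ (AllP.map⁺ (All.map (λ {q} → eqn q) c)) b)
      (AllP.map⁺ (All.map (λ {q} → ineq q) hs′))
    where
    eqn : ∀ q → Zero (x ∷ ρ) q → Zero ρ (substitute m p q)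
    eqn q h = trans (eval-substitute m p q x ρ a) (trans (cong (_*_ (+ suc m)) h) (ℤP.*-zeroʳ (+ suc m)))
    ineq : ∀ q → NonNeg (x ∷ ρ) q → NonNeg ρ (substitute m p q)
    ineq q h = subst₂ _≤_ (ℤP.*-zeroʳ (+ suc m)) (sym (eval-substitute m p q x ρ a)) (ℤP.*-monoˡ-≤-nonNeg (+ suc m) h)
  ... | noPivot fs | b with classify is | classify-sound x ρ is hs′
  ...   | split l u z | r , s , t = infeasible-sound n _ _ ρ e b (AllP.++⁺ (resolvents-sound x ρ l u r s) t)

  -- Formulas of linear arithmetic and their refutation

  infixl 7 _⊕_ _⊖_
  infix 6 _≤′_ _<′_ _≡′_
  infixr 5 _∧′_
  infix 7 ¬′_
  infixr 4 _∨′_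
  infixr 3 _⇒′_

  data Expr (n : ℕ) : Set where
    var : Fin n → Expr n
    con : ℤ → Expr n
    _⊕_ _⊖_ : Expr n → Expr n → Expr n

  ⟦_⟧ₑ : ∀ {n} → Expr n → Vec ℤ n → ℤ
  ⟦ var i ⟧ₑ ρ = lookup ρ i
  ⟦ con c ⟧ₑ ρ = c
  ⟦ a ⊕ b ⟧ₑ ρ = ⟦ a ⟧ₑ ρ + ⟦ b ⟧ₑ ρ
  ⟦ a ⊖ b ⟧ₑ ρ = ⟦ a ⟧ₑ ρ - ⟦ b ⟧ₑ ρ

  constant : ∀ {n} → ℤ → Affine n
  constant {zero} c = c ∷ []
  constant {suc n} c = 0ℤ ∷ constant c

  unit : ∀ {n} → Fin n → Affine n
  unit {suc n} zero = 1ℤ ∷ constant 0ℤ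
  unit (suc i) = 0ℤ ∷ unit i

  affine : ∀ {n} → Expr n → Affine n
  affine (var i) = unit i
  affine (con c) = constant c
  affine (a ⊕ b) = zipWith _+_ (affine a) (affine b)
  affine (a ⊖ b) = zipWith _-_ (affine a) (affine b)

  eval-constant : ∀ {n} c (ρ : Vec ℤ n) → eval (constant c) ρ ≡ c
  eval-constant c [] = refl
  eval-constant c (x ∷ ρ) = trans (eval-flat (constant c) x ρ) (eval-constant c ρ)

  eval-unit : ∀ {n} i (ρ : Vec ℤ n) → eval (unit i) ρ ≡ lookup ρ i
  eval-unit {suc zero} zero (x ∷ []) = lemma x
    where
    lemma : ∀ x → 1ℤ * x + 0ℤ ≡ x
    lemma = solve-∀
  eval-unit {suc (suc n)} zero (x ∷ ρ) =
    trans (cong (_+_ (1ℤ * x)) (eval-constant 0ℤ ρ)) (lemma x)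
    where
    lemma : ∀ x → 1ℤ * x + 0ℤ ≡ x
    lemma = solve-∀
  eval-unit (suc i) (x ∷ ρ) = trans (eval-flat (unit i) x ρ) (eval-unit i ρ)

  eval-+ : ∀ {n} (p q : Affine n) ρ → eval (zipWith _+_ p q) ρ ≡ eval p ρ + eval q ρ
  eval-+ (_ ∷ []) (_ ∷ []) [] = refl
  eval-+ (x ∷ p@(_ ∷ _)) (y ∷ q@(_ ∷ _)) (r ∷ ρ) =
    trans (cong (_+_ ((x + y) * r)) (eval-+ p q ρ)) (lemma x y r (eval p ρ) (eval q ρ))
    where
    lemma : ∀ x y r u v → (x + y) * r + (u + v) ≡ x * r + u + (y * r + v)
    lemma = solve-∀

  eval-- : ∀ {n} (p q : Affine n) ρ → eval (zipWith _-_ p q) ρ ≡ eval p ρ - eval q ρ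
  eval-- (_ ∷ []) (_ ∷ []) [] = refl
  eval-- (x ∷ p@(_ ∷ _)) (y ∷ q@(_ ∷ _)) (r ∷ ρ) =
    trans (cong (_+_ ((x - y) * r)) (eval-- p q ρ)) (lemma x y r (eval p ρ) (eval q ρ))
    where
    lemma : ∀ x y r u v → (x - y) * r + (u - v) ≡ x * r + u - (y * r + v)
    lemma = solve-∀

  eval-affine : ∀ {n} (e : Expr n) ρ → eval (affine e) ρ ≡ ⟦ e ⟧ₑ ρ
  eval-affine (var i) ρ = eval-unit i ρ
  eval-affine (con c) ρ = eval-constant c ρ
  eval-affine (a ⊕ b) ρ = trans (eval-+ (affine a) (affine b) ρ) (cong₂ _+_ (eval-affine a ρ) (eval-affine b ρ))
  eval-affine (a ⊖ b) ρ = trans (eval-- (affine a) (affine b) ρ) (cong₂ _-_ (eval-affine a ρ) (eval-affine b ρ))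

  data Formula (n : ℕ) : Set where
    _≤′_ _≡′_ : Expr n → Expr n → Formula n
    ⊥′ : Formula n
    ¬′_ : Formula n → Formula n
    _∧′_ _∨′_ _⇒′_ : Formula n → Formula n → Formula n

  -- Strictness as a gap of 1: this is how integrality enters, as the elimination itself is valid
  -- over the rationals.
  _<′_ : ∀ {n} → Expr n → Expr n → Formula n
  a <′ b = con 1ℤ ⊕ a ≤′ b

  ⟦_⟧ : ∀ {n} → Formula n → Vec ℤ n → Set
  ⟦ a ≤′ b ⟧ ρ = ⟦ a ⟧ₑ ρ ≤ ⟦ b ⟧ₑ ρ
  ⟦ a ≡′ b ⟧ ρ = ⟦ a ⟧ₑ ρ ≡ ⟦ b ⟧ₑ ρ
  ⟦ ⊥′ ⟧ ρ = ⊥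
  ⟦ ¬′ φ ⟧ ρ = ¬ ⟦ φ ⟧ ρ
  ⟦ φ ∧′ ψ ⟧ ρ = ⟦ φ ⟧ ρ × ⟦ ψ ⟧ ρ
  ⟦ φ ∨′ ψ ⟧ ρ = ⟦ φ ⟧ ρ ⊎ ⟦ ψ ⟧ ρ
  ⟦ φ ⇒′ ψ ⟧ ρ = ⟦ φ ⟧ ρ → ⟦ ψ ⟧ ρ

  record State (n : ℕ) : Set where
    constructor state
    field
      zeros nonzeros nonnegs : List (Affine n)

  Holds : ∀ {n} → Vec ℤ n → State n → Set
  Holds ρ (state es ds is) = All (Zero ρ) es × All (λ e → ¬ Zero ρ e) ds × All (NonNeg ρ) is

  -- Nonnegativity of this form means e ≥ 1, that of the next one e ≤ -1: the two ways for an
  -- integer to be nonzero.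
  positive : ∀ {n} → Affine n → Affine n
  positive e = zipWith _-_ e (constant 1ℤ)

  negated : ∀ {n} → Affine n → Affine n
  negated e = zipWith _-_ (constant -1ℤ) e

  branch : Bool → Bool → Bool
  branch true b = b
  branch false _ = false

  contradictory : ∀ {n} → State n → Bool
  contradictory {n} (state es ds is) =
    if infeasible n es is then true else some (λ e → branch (infeasible n es (positive e ∷ is)) (infeasible n es (negated e ∷ is))) ds

  -- Splitting every disequality would double the number of branches each time, so a branch is
  -- closed only by the equations and inequalities together with a single disequality.
  assume deny : ∀ {n} → Formula n → (State n → Bool) → State n → Bool
  assume (a ≤′ b) k (state es ds is) = k (state es ds (affine (b ⊖ a) ∷ is))
  assume (a ≡′ b) k (state es ds is) = k (state (affine (b ⊖ a) ∷ es) ds is)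
  assume ⊥′ k s = true
  assume (¬′ φ) k s = deny φ k s
  assume (φ ∧′ ψ) k s = assume φ (assume ψ k) s
  assume (φ ∨′ ψ) k s = if contradictory s then true else branch (assume φ k s) (assume ψ k s)
  assume (φ ⇒′ ψ) k s = if contradictory s then true else branch (deny φ k s) (assume ψ k s)
  deny (a ≤′ b) k (state es ds is) = k (state es ds (affine (a ⊖ b ⊖ con 1ℤ) ∷ is))
  deny (a ≡′ b) k (state es ds is) = k (state es (affine (b ⊖ a) ∷ ds) is)
  deny ⊥′ k s = k s
  deny (¬′ φ) k s = assume φ k s
  deny (φ ∧′ ψ) k s = if contradictory s then true else branch (deny φ k s) (deny ψ k s)
  deny (φ ∨′ ψ) k s = deny φ (deny ψ k) s
  deny (φ ⇒′ ψ) k s = assume φ (deny ψ k) s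

  -- The negated goal is entered into the empty state, and the continuation `contradictory` has to
  -- close every branch opened by the propositional structure.
  valid : ∀ {n} → Formula n → Bool
  valid φ = deny φ contradictory (state [] [] [])

  both : ∀ a {b} → branch a b ≡ true → a ≡ true × b ≡ true
  both true e = refl , e

  affine-diff : ∀ {n} (a b : Expr n) ρ → eval (affine (b ⊖ a)) ρ ≡ ⟦ b ⟧ₑ ρ - ⟦ a ⟧ₑ ρ
  affine-diff a b ρ = eval-affine (b ⊖ a) ρ

  contradictory-sound : ∀ {n} (s : State n) ρ → contradictory s ≡ true → Holds ρ s → ⊥
  contradictory-sound {n} (state es ds is) ρ e (he , hd , hi) with infeasible n es is in eq
  ... | true = infeasible-sound n es is ρ eq he hi
  ... | false = some-sound {P = λ d → ¬ Zero ρ d} _ refute ds hd e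
    where
    refute : ∀ d → ¬ Zero ρ d → branch (infeasible n es (positive d ∷ is)) (infeasible n es (negated d ∷ is)) ≡ true → ⊥
    refute d nz e with both (infeasible n es (positive d ∷ is)) e
    ... | p , q with ℤP.<-cmp 0ℤ (eval d ρ)
    ...   | tri≈ _ z _ = nz (sym z)
    ...   | tri< lt _ _ = infeasible-sound n es _ ρ p he (subst (0ℤ ≤_) (sym (trans (eval-- d (constant 1ℤ) ρ) (cong (_-_ (eval d ρ)) (eval-constant 1ℤ ρ)))) (ℤP.i≤j⇒0≤j-i (ℤP.i<j⇒suc[i]≤j lt)) ∷ hi)
    ...   | tri> _ _ gt = infeasible-sound n es _ ρ q he (subst (0ℤ ≤_) (sym (trans (eval-- (constant -1ℤ) d ρ) (cong (_- eval d ρ) (eval-constant -1ℤ ρ)))) (ℤP.i≤j⇒0≤j-i (ℤP.i<j⇒i≤pred[j] gt)) ∷ hi)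

  Sound : ∀ {n} → Vec ℤ n → (State n → Bool) → Set
  Sound ρ k = ∀ s → k s ≡ true → Holds ρ s → ⊥

  -- Before a case split the state is tested for a contradiction, which prunes the search; here the
  -- two outcomes of the test are treated.
  unless : ∀ {n} (s : State n) ρ {b} → Holds ρ s → (if contradictory s then true else b) ≡ true → (b ≡ true → ⊥) → ⊥
  unless s ρ h e f with contradictory s in eq
  ... | true = contradictory-sound s ρ eq h
  ... | false = f e

  assume-sound : ∀ {n} ρ (φ : Formula n) k → Sound ρ k → ∀ s → assume φ k s ≡ true → Holds ρ s → ¬ ⟦ φ ⟧ ρ
  -- Refuting the denial yields only a double negation; `linear` removes it, since at given integers
  -- every formula is decidable.
  deny-sound : ∀ {n} ρ (φ : Formula n) k → Sound ρ k → ∀ s → deny φ k s ≡ true → Holds ρ s → ¬ ¬ ⟦ φ ⟧ ρ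
  assume-sound ρ (a ≤′ b) k ok s e (he , hd , hi) h =
    ok _ e (he , hd , subst (0ℤ ≤_) (sym (affine-diff a b ρ)) (ℤP.i≤j⇒0≤j-i h) ∷ hi)
  assume-sound ρ (a ≡′ b) k ok s e (he , hd , hi) h =
    ok _ e (trans (affine-diff a b ρ) (ℤP.i≡j⇒i-j≡0 (sym h)) ∷ he , hd , hi)
  assume-sound ρ (¬′ φ) k ok s e h p = deny-sound ρ φ k ok s e h p
  assume-sound ρ (φ ∧′ ψ) k ok s e h (p , q) =
    assume-sound ρ φ (assume ψ k) (λ s e h → assume-sound ρ ψ k ok s e h q) s e h p
  assume-sound ρ (φ ∨′ ψ) k ok s e h p = unless s ρ h e λ e → case p (both (assume φ k s) e)
    where
    case : ⟦ φ ⟧ ρ ⊎ ⟦ ψ ⟧ ρ → assume φ k s ≡ true × assume ψ k s ≡ true → ⊥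
    case (inj₁ p) (e , _) = assume-sound ρ φ k ok s e h p
    case (inj₂ p) (_ , e) = assume-sound ρ ψ k ok s e h p
  assume-sound ρ (φ ⇒′ ψ) k ok s e h p = unless s ρ h e λ e → case (both (deny φ k s) e)
    where
    case : deny φ k s ≡ true × assume ψ k s ≡ true → ⊥
    case (e , e′) = deny-sound ρ φ k ok s e h λ a → assume-sound ρ ψ k ok s e′ h (p a)
  deny-sound ρ (a ≤′ b) k ok s e (he , hd , hi) h =
    ok _ e (he , hd , subst (0ℤ ≤_) (sym (eval-affine (a ⊖ b ⊖ con 1ℤ) ρ)) (lemma (ℤP.≰⇒> h)) ∷ hi)
    where
    shift : ∀ x y → x - (1ℤ + y) ≡ x - y - 1ℤ
    shift = solve-∀
    lemma : ∀ {x y} → y < x → 0ℤ ≤ x - y - 1ℤ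
    lemma {x} {y} l = subst (0ℤ ≤_) (shift x y) (ℤP.i≤j⇒0≤j-i (ℤP.i<j⇒suc[i]≤j l))
  deny-sound ρ (a ≡′ b) k ok s e (he , hd , hi) h =
    ok _ e (he , (λ z → h (sym (ℤP.i-j≡0⇒i≡j _ _ (trans (sym (affine-diff a b ρ)) z)))) ∷ hd , hi)
  deny-sound ρ ⊥′ k ok s e h n = ok s e h
  deny-sound ρ (¬′ φ) k ok s e h n = n (assume-sound ρ φ k ok s e h)
  deny-sound ρ (φ ∧′ ψ) k ok s e h n = unless s ρ h e λ e → case (both (deny φ k s) e)
    where
    case : deny φ k s ≡ true × deny ψ k s ≡ true → ⊥
    case (e , e′) = deny-sound ρ φ k ok s e h λ a → deny-sound ρ ψ k ok s e′ h λ b → n (a , b)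
  deny-sound ρ (φ ∨′ ψ) k ok s e h n =
    deny-sound ρ φ (deny ψ k) (λ s e h → deny-sound ρ ψ k ok s e h λ b → n (inj₂ b)) s e h λ a → n (inj₁ a)
  deny-sound ρ (φ ⇒′ ψ) k ok s e h n =
    n λ a → ⊥-elim (assume-sound ρ φ (deny ψ k) (λ s e h → deny-sound ρ ψ k ok s e h λ b → n λ _ → b) s e h a)

  decide : ∀ {n} (φ : Formula n) ρ → Dec (⟦ φ ⟧ ρ)
  decide (a ≤′ b) ρ = _ ℤP.≤? _
  decide (a ≡′ b) ρ = _ ℤP.≟ _
  decide ⊥′ ρ = no λ ()
  decide (¬′ φ) ρ = ¬? (decide φ ρ)
  decide (φ ∧′ ψ) ρ = decide φ ρ ×-dec decide ψ ρ
  decide (φ ∨′ ψ) ρ = decide φ ρ ⊎-dec decide ψ ρ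
  decide (φ ⇒′ ψ) ρ = decide φ ρ →-dec decide ψ ρ

  abstract
    linear : ∀ {n} (φ : Formula n) → valid φ ≡ true → ∀ ρ → ⟦ φ ⟧ ρ
    linear φ e ρ = decidable-stable (decide φ ρ)
      (deny-sound ρ φ contradictory (λ s → contradictory-sound s ρ) _ e ([] , [] , []))

-- Counting subsets

module Counting where

  open import Data.Nat using (ℕ; zero; suc; _+_; _≤_; z≤n; s≤s)

  -- Pigeonhole: one occurrence of the head is cut out of `ys`, and as it does not recur in `xs`,
  -- the tail still embeds in the remainder.
  length-⊆ : ∀ {A : Set} {xs ys : List A} → Unique xs → (∀ {x} → x ∈ xs → x ∈ ys) → length xs ≤ length ys
  length-⊆ {xs = []} [] sub = z≤n
  length-⊆ {xs = x ∷ xs} (x∉ ∷ u) sub with ∈P.∈-∃++ (sub (here refl))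
  ... | as , bs , refl = subst (suc (length xs) ≤_) (sym (ListP.length-++-sucʳ as x bs))
    (s≤s (length-⊆ u λ {y} y∈ → drop-x y∈ (∈P.∈-++⁻ as (sub (there y∈)))))
    where
    drop-x : ∀ {y} → y ∈ xs → _ → y ∈ as ++ bs
    drop-x y∈ (inj₁ p) = ∈P.∈-++⁺ˡ p
    drop-x y∈ (inj₂ (here refl)) = ⊥-elim (All.lookup x∉ y∈ refl)
    drop-x y∈ (inj₂ (there p)) = ∈P.∈-++⁺ʳ as p

  ∈-allSubsets : ∀ {n} (S : Subset n) → S ∈ allSubsets n
  ∈-allSubsets [] = here refl
  ∈-allSubsets (true ∷ S) = ∈P.∈-++⁺ˡ (∈P.∈-map⁺ (true ∷_) (∈-allSubsets S))
  ∈-allSubsets {suc n} (false ∷ S) = ∈P.∈-++⁺ʳ (map (true ∷_) (allSubsets n)) (∈P.∈-map⁺ (false ∷_) (∈-allSubsets S))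

  allSubsets-unique : ∀ n → Unique (allSubsets n)
  allSubsets-unique zero = [] ∷ []
  allSubsets-unique (suc n) =
    UniqueP.++⁺ (UniqueP.map⁺ (λ { refl → refl }) (allSubsets-unique n))
      (UniqueP.map⁺ (λ { refl → refl }) (allSubsets-unique n)) heads-differ
    where
    heads-differ : ∀ {S} → S ∈ map (true ∷_) (allSubsets n) × S ∈ map (false ∷_) (allSubsets n) → ⊥
    heads-differ (p , q) with ∈P.∈-map⁻ (true ∷_) p | ∈P.∈-map⁻ (false ∷_) q
    ... | _ , _ , refl | _ , _ , ()

  count : ∀ {n} {P : Pred (Subset n) 0ℓ} → Decidable P → ℕ
  count {n} P? = length (filter P? (allSubsets n))

  module _ {n} {P : Pred (Subset n) 0ℓ} (P? : Decidable P) where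

    count-≤ : (L : List (Subset n)) → (∀ S → P S → S ∈ L) → count P? ≤ length L
    count-≤ L cover = length-⊆ (UniqueP.filter⁺ P? (allSubsets-unique n))
      (λ {S} S∈ → cover S (proj₂ (∈P.∈-filter⁻ P? {xs = allSubsets n} S∈)))

    ≤-count : {L : List (Subset n)} → Unique L → (∀ {S} → S ∈ L → P S) → length L ≤ count P?
    ≤-count u ok = length-⊆ u λ {S} S∈ → ∈P.∈-filter⁺ P? (∈-allSubsets S) (ok S∈)

    count-cong : {Q : Pred (Subset n) 0ℓ} (Q? : Decidable Q) → (∀ S → P S → Q S) → (∀ S → Q S → P S) → count P? ≡ count Q?
    count-cong Q? f g = cong length (ListP.filter-≐ P? Q? ((λ {S} → f S) , (λ {S} → g S)) (allSubsets n))

  length-filter-map : ∀ {A B : Set} (f : A → B) {P : Pred B 0ℓ} (P? : Decidable P) xs →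
    length (filter P? (map f xs)) ≡ length (filter (P? ∘ f) xs)
  length-filter-map f P? [] = refl
  length-filter-map f P? (x ∷ xs) with does (P? (f x))
  ... | true = cong suc (length-filter-map f P? xs)
  ... | false = length-filter-map f P? xs

  count-∷ : ∀ {n} {P : Pred (Subset (suc n)) 0ℓ} (P? : Decidable P) →
    count P? ≡ count (P? ∘ (true ∷_)) + count (P? ∘ (false ∷_))
  count-∷ {n} P? = begin
    length (filter P? (map (true ∷_) (allSubsets n) ++ map (false ∷_) (allSubsets n)))
      ≡⟨ cong length (ListP.filter-++ P? (map (true ∷_) (allSubsets n)) _) ⟩
    length (filter P? (map (true ∷_) (allSubsets n)) ++ filter P? (map (false ∷_) (allSubsets n)))
      ≡⟨ ListP.length-++ (filter P? (map (true ∷_) (allSubsets n))) ⟩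
    _ ≡⟨ cong₂ _+_ (length-filter-map (true ∷_) P? (allSubsets n)) (length-filter-map (false ∷_) P? (allSubsets n)) ⟩
    count (P? ∘ (true ∷_)) + count (P? ∘ (false ∷_)) ∎
    where open ≡-Reasoning

  -- Both halves of the split at the first entry are split at their last entry; of the four
  -- resulting counts the middle two trade places.
  count-∷ʳ : ∀ {n} {P : Pred (Subset (suc n)) 0ℓ} (P? : Decidable P) →
    count P? ≡ count (P? ∘ (_∷ʳ true)) + count (P? ∘ (_∷ʳ false))
  count-∷ʳ {zero} P? = trans (count-∷ P?) (cong₂ _+_
    (count-cong (P? ∘ (true ∷_)) (P? ∘ (_∷ʳ true)) (λ { [] p → p }) (λ { [] p → p }))
    (count-cong (P? ∘ (false ∷_)) (P? ∘ (_∷ʳ false)) (λ { [] p → p }) (λ { [] p → p })))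
  count-∷ʳ {suc n} P? = begin
    count P?
      ≡⟨ count-∷ P? ⟩
    count (P? ∘ (true ∷_)) + count (P? ∘ (false ∷_))
      ≡⟨ cong₂ _+_ (count-∷ʳ (P? ∘ (true ∷_))) (count-∷ʳ (P? ∘ (false ∷_))) ⟩
    (a + b) + (c + e)
      ≡⟨ ℕP.+-assoc a b (c + e) ⟩
    a + (b + (c + e))
      ≡⟨ cong (a +_) (trans (sym (ℕP.+-assoc b c e)) (trans (cong (_+ e) (ℕP.+-comm b c)) (ℕP.+-assoc c b e))) ⟩
    a + (c + (b + e))
      ≡⟨ sym (ℕP.+-assoc a c (b + e)) ⟩
    (a + c) + (b + e)
      ≡⟨ sym (cong₂ _+_ (count-∷ (P? ∘ (_∷ʳ true))) (count-∷ (P? ∘ (_∷ʳ false)))) ⟩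
    count (P? ∘ (_∷ʳ true)) + count (P? ∘ (_∷ʳ false)) ∎
    where
    open ≡-Reasoning
    a = count (P? ∘ λ S → true ∷ (S ∷ʳ true))
    b = count (P? ∘ λ S → true ∷ (S ∷ʳ false))
    c = count (P? ∘ λ S → false ∷ (S ∷ʳ true))
    e = count (P? ∘ λ S → false ∷ (S ∷ʳ false))

-- The number of positive differences, and splitting by minimum and maximum

module PositiveDifferences where

  open Counting
  open import Data.Integer as ℤ using (ℤ; +_; -[1+_]; 0ℤ)
  open import Data.Integer.Tactic.RingSolver using (solve-∀)
  open import Data.Nat using (ℕ; zero; suc; _+_; _∸_; _≤_; _<_; z≤n; s≤s; _≟_)

  At : ∀ {n} → Subset n → ℕ → Set
  At [] k = ⊥
  At (b ∷ S) zero = b ≡ true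
  At (b ∷ S) (suc k) = At S k

  At-< : ∀ {n} (S : Subset n) {k} → At S k → k < n
  At-< (b ∷ S) {zero} h = s≤s z≤n
  At-< (b ∷ S) {suc k} h = s≤s (At-< S h)

  ∈⇒At : ∀ {n} {S : Subset n} {x} → x Subset.∈ S → At S (toℕ x)
  ∈⇒At here = refl
  ∈⇒At (there p) = ∈⇒At p

  At⇒∈ : ∀ {n} (S : Subset n) {k} → At S k → ∃ λ x → x Subset.∈ S × toℕ x ≡ k
  At⇒∈ (true ∷ S) {zero} refl = zero , here , refl
  At⇒∈ (b ∷ S) {suc k} h with At⇒∈ S h
  ... | x , p , refl = suc x , there p , refl

  -- Tests whether `xs` moved up by `t` meets `ys`, in a single pass. With `xs` and `ys` equal, this
  -- decides whether `t` is a difference cheaply enough for the enumerations.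
  meets : ∀ {m n} → Subset m → ℕ → Subset n → Bool
  meets xs (suc t) [] = false
  meets xs (suc t) (_ ∷ ys) = meets xs t ys
  meets [] zero ys = false
  meets (_ ∷ _) zero [] = false
  meets (x ∷ xs) zero (y ∷ ys) = if x ∧ y then true else meets xs zero ys

  meets-sound : ∀ {m n} (xs : Subset m) t (ys : Subset n) → T (meets xs t ys) → ∃ λ i → At xs i × At ys (t + i)
  meets-sound xs (suc t) (_ ∷ ys) h = meets-sound xs t ys h
  meets-sound (true ∷ xs) zero (true ∷ ys) h = 0 , refl , refl
  meets-sound (true ∷ xs) zero (false ∷ ys) h with meets-sound xs zero ys h
  ... | i , p , q = suc i , p , q
  meets-sound (false ∷ xs) zero (y ∷ ys) h with meets-sound xs zero ys h
  ... | i , p , q = suc i , p , q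

  meets-complete : ∀ {m n} (xs : Subset m) t (ys : Subset n) i → At xs i → At ys (t + i) → T (meets xs t ys)
  meets-complete xs (suc t) (_ ∷ ys) i p q = meets-complete xs t ys i p q
  meets-complete (.true ∷ xs) zero (.true ∷ ys) zero refl refl = tt
  meets-complete (true ∷ xs) zero (true ∷ ys) (suc i) p q = tt
  meets-complete (true ∷ xs) zero (false ∷ ys) (suc i) p q = meets-complete xs zero ys i p q
  meets-complete (false ∷ xs) zero (y ∷ ys) (suc i) p q = meets-complete xs zero ys i p q

  module _ {n} (S : Subset n) where

    -- The entry t stands for the difference t + 1.
    shifts : List ℕ
    shifts = filter (λ t → T? (meets S (suc t) S)) (upTo n)

    shifts-unique : Unique shifts
    shifts-unique = UniqueP.filter⁺ (λ t → T? (meets S (suc t) S)) (UniqueP.upTo⁺ n)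

    ∈-shifts⁺ : ∀ t i → At S i → At S (suc t + i) → t ∈ shifts
    ∈-shifts⁺ t i p q = ∈P.∈-filter⁺ (λ t → T? (meets S (suc t) S))
      (∈P.∈-upTo⁺ (ℕP.≤-trans (ℕP.≤-trans (ℕP.m≤m+n (suc t) i) (ℕP.n≤1+n _)) (At-< S q)))
      (meets-complete S (suc t) S i p q)

    ∈-shifts⁻ : ∀ {t} → t ∈ shifts → ∃ λ i → At S i × At S (suc t + i)
    ∈-shifts⁻ {t} t∈ = meets-sound S (suc t) S (proj₂ (∈P.∈-filter⁻ (λ t → T? (meets S (suc t) S)) {xs = upTo n} t∈))

  spread : ∀ {n} → Subset n → ℕ
  spread S = length (shifts S)

  Difference : ∀ {n} → Subset n → ℤ → Set
  Difference S z = ∃₂ λ a b → At S a × At S b × z ≡ + a ℤ.- + b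

  ∈Diff⇒ : ∀ {n} {S : Subset n} {z} → z ∈Diff S → Difference S z
  ∈Diff⇒ (x , y , p , q , e) = toℕ x , toℕ y , ∈⇒At p , ∈⇒At q , e

  ⇒∈Diff : ∀ {n} (S : Subset n) {z} → Difference S z → z ∈Diff S
  ⇒∈Diff S (a , b , p , q , e) with At⇒∈ S p | At⇒∈ S q
  ... | x , p′ , refl | y , q′ , refl = x , y , p′ , q′ , e

  Difference⇒shift : ∀ {n} (S : Subset n) t → Difference S (+ suc t) → t ∈ shifts S
  Difference⇒shift S t (a , b , p , q , e) = ∈-shifts⁺ S t b q (subst (At S) (ℤP.+-injective (trans (lemma (+ a) (+ b)) (cong (ℤ._+ + b) (sym e)))) p)
    where
    lemma : ∀ x y → x ≡ x ℤ.- y ℤ.+ y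
    lemma = solve-∀

  shift⇒Difference : ∀ {n} (S : Subset n) {t} → t ∈ shifts S → Difference S (+ suc t)
  shift⇒Difference S {t} t∈ with ∈-shifts⁻ S t∈
  ... | i , p , q = suc t + i , i , q , p , lemma (+ suc t) (+ i)
    where
    lemma : ∀ x y → x ≡ x ℤ.+ y ℤ.- y
    lemma = solve-∀

  Difference-neg : ∀ {n} (S : Subset n) {z} → Difference S z → Difference S (ℤ.- z)
  Difference-neg S (a , b , p , q , refl) = b , a , q , p , lemma (+ a) (+ b)
    where
    lemma : ∀ x y → ℤ.- (x ℤ.- y) ≡ y ℤ.- x
    lemma = solve-∀

  window-complete : ∀ {n} (S : Subset n) {z} → Difference S z → z ∈ window n
  window-complete {zero} [] (_ , _ , () , _)
  window-complete {suc n} S {z} (a , b , p , q , e) =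
    subst (_∈ window (suc n)) (sym z≡) (∈P.∈-map⁺ (λ i → + i ℤ.- + n) (∈P.∈-upTo⁺ bound))
    where
    -- The window lists + i - n, so a - b stands at index a + (n - b); the truncated subtraction is
    -- exact because b ≤ n.
    i = a + (n ∸ b)
    b≤n : b ≤ n
    b≤n = ℕP.≤-pred (At-< S q)
    bound : i < n + suc (n + 0)
    bound = subst (i <_) (sym (ℕP.+-suc n (n + 0)))
      (s≤s (ℕP.+-mono-≤ (ℕP.≤-pred (At-< S p)) (ℕP.≤-trans (ℕP.m∸n≤m n b) (ℕP.≤-reflexive (sym (ℕP.+-identityʳ n))))))
    z≡ : z ≡ + i ℤ.- + n
    z≡ = trans e (trans (lemma (+ a) (+ (n ∸ b)) (+ b)) (cong (λ k → + i ℤ.- + k) (ℕP.m∸n+n≡m b≤n)))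
      where
      lemma : ∀ x y w → x ℤ.- w ≡ x ℤ.+ y ℤ.- (y ℤ.+ w)
      lemma = solve-∀

  window-unique : ∀ n → Unique (window n)
  window-unique n = UniqueP.map⁺ (λ {i} {j} e → ℤP.+-injective
      (trans (lemma (+ i) (+ (n ∸ 1))) (trans (cong (ℤ._+ + (n ∸ 1)) e) (sym (lemma (+ j) (+ (n ∸ 1)))))))
    (UniqueP.upTo⁺ _)
    where
    lemma : ∀ x k → x ≡ x ℤ.- k ℤ.+ k
    lemma = solve-∀

  module _ {n} (S : Subset n) where

    private
      differences : List ℤ
      differences = filter (λ z → z ∈Diff? S) (window n)

      ∈-differences : ∀ {z} → Difference S z → z ∈ differences
      ∈-differences h = ∈P.∈-filter⁺ (λ z → z ∈Diff? S) (window-complete S h) (⇒∈Diff S h)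

      differences-sound : ∀ {z} → z ∈ differences → Difference S z
      differences-sound z∈ = ∈Diff⇒ (proj₂ (∈P.∈-filter⁻ (λ z → z ∈Diff? S) {xs = window n} z∈))

      symmetric : List ℤ
      symmetric = 0ℤ ∷ map (λ t → + suc t) (shifts S) ++ map -[1+_] (shifts S)

      symmetric-unique : Unique symmetric
      symmetric-unique =
        AllP.++⁺ (AllP.map⁺ (All.universal (λ _ ()) (shifts S))) (AllP.map⁺ (All.universal (λ _ ()) (shifts S))) ∷
        UniqueP.++⁺ (UniqueP.map⁺ (λ { refl → refl }) (shifts-unique S)) (UniqueP.map⁺ (λ { refl → refl }) (shifts-unique S)) signs-differ
        where
        signs-differ : ∀ {z} → z ∈ map (λ t → + suc t) (shifts S) × z ∈ map -[1+_] (shifts S) → ⊥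
        signs-differ (p , q) with ∈P.∈-map⁻ (λ t → + suc t) p | ∈P.∈-map⁻ -[1+_] q
        ... | _ , _ , refl | _ , _ , ()

      length-symmetric : length symmetric ≡ suc (spread S + spread S)
      length-symmetric = cong suc (trans (ListP.length-++ (map (λ t → + suc t) (shifts S)))
        (cong₂ _+_ (ListP.length-map (λ t → + suc t) (shifts S)) (ListP.length-map -[1+_] (shifts S))))

    -- Differences come in pairs ± (t + 1), one for each entry t of `shifts S`, together with 0, for
    -- which an element of `S` is needed.
    diffSetSize-spread : ∀ {a} → At S a → diffSetSize S ≡ suc (spread S + spread S)
    diffSetSize-spread {a} p = trans (ℕP.≤-antisym
      (length-⊆ (UniqueP.filter⁺ (λ z → z ∈Diff? S) (window-unique n)) λ z∈ → to _ (differences-sound z∈))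
      (length-⊆ symmetric-unique λ z∈ → ∈-differences (from z∈))) length-symmetric
      where
      to : ∀ z → Difference S z → z ∈ symmetric
      to (+ zero) h = here refl
      to (+ suc t) h = there (∈P.∈-++⁺ˡ (∈P.∈-map⁺ (λ t → + suc t) (Difference⇒shift S t h)))
      to -[1+ t ] h = there (∈P.∈-++⁺ʳ (map (λ t → + suc t) (shifts S)) (∈P.∈-map⁺ -[1+_] (Difference⇒shift S t (Difference-neg S h))))
      from : ∀ {z} → z ∈ symmetric → Difference S z
      from (here refl) = a , a , p , p , sym (ℤP.+-inverseʳ (+ a))
      from (there z∈) with ∈P.∈-++⁻ (map (λ t → + suc t) (shifts S)) z∈
      ... | inj₁ q with ∈P.∈-map⁻ (λ t → + suc t) q
      ...   | t , t∈ , refl = shift⇒Difference S t∈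
      from (there z∈) | inj₂ q with ∈P.∈-map⁻ -[1+_] q
      ...   | t , t∈ , refl = Difference-neg S (shift⇒Difference S t∈)

    diffSetSize-empty : (∀ a → ¬ At S a) → diffSetSize S ≡ 0
    diffSetSize-empty none = ℕP.n≤0⇒n≡0 (length-⊆ {ys = []} (UniqueP.filter⁺ (λ z → z ∈Diff? S) (window-unique n)) λ z∈ → ⊥-elim (none _ (proj₁ (proj₂ (proj₂ (differences-sound z∈))))))

    spread-empty : (∀ a → ¬ At S a) → spread S ≡ 0
    spread-empty none = ℕP.n≤0⇒n≡0 (length-⊆ {ys = []} (shifts-unique S) λ t∈ → ⊥-elim (none _ (proj₁ (proj₂ (∈-shifts⁻ S t∈)))))

  inhabited? : ∀ {n} (S : Subset n) → Dec (∃ (At S))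
  inhabited? [] = no λ ()
  inhabited? (true ∷ S) = yes (0 , refl)
  inhabited? (false ∷ S) with inhabited? S
  ... | yes (k , p) = yes (suc k , p)
  ... | no none = no λ { (suc k , p) → none (k , p) }

  private
    double-injective : ∀ {m n} → m + m ≡ n + n → m ≡ n
    double-injective {m} {n} e = ℕP.*-cancelˡ-≡ m n 2 (trans (cong (_+_ m) (ℕP.+-identityʳ m)) (trans e (sym (cong (_+_ n) (ℕP.+-identityʳ n)))))

  -- The empty set is the exception to |S - S| = 2 m + 1; its difference set has size 0, which is
  -- not a successor.
  diffSetSize⇒spread : ∀ {n} (S : Subset n) m → diffSetSize S ≡ suc (m + m) → spread S ≡ m
  diffSetSize⇒spread S m e with inhabited? S
  ... | yes (_ , p) = double-injective (ℕP.suc-injective (trans (sym (diffSetSize-spread S p)) e))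
  ... | no none with trans (sym (diffSetSize-empty S λ a p → none (a , p))) e
  ...   | ()

  spread⇒diffSetSize : ∀ {n} (S : Subset n) m → spread S ≡ suc m → diffSetSize S ≡ suc (suc m + suc m)
  spread⇒diffSetSize S m e with inhabited? S
  ... | yes (_ , p) = trans (diffSetSize-spread S p) (cong (λ k → suc (k + k)) e)
  ... | no none with trans (sym (spread-empty S λ a p → none (a , p))) e
  ...   | ()

  -- `leading n` ranges over the subsets of [n + 1] that contain 0, and `spanning n` over those of
  -- [n + 2] that contain 0 and n + 1. Hence d = n + 1 wherever `spanning n` is estimated.
  total leading spanning : ℕ → ℕ → ℕ
  total n m = count {n} (λ S → spread S ≟ m)
  leading n m = count {n} (λ S → spread (true ∷ S) ≟ m)
  spanning n m = count {n} (λ S → spread (true ∷ (S ∷ʳ true)) ≟ m)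

  countDiff-total : ∀ n m → countDiff n (suc (suc m + suc m)) ≡ total n (suc m)
  countDiff-total n m = count-cong {n} (λ S → diffSetSize S ≟ suc (suc m + suc m)) (λ S → spread S ≟ suc m)
    (λ S → diffSetSize⇒spread S (suc m)) (λ S → spread⇒diffSetSize S m)

  spread-mono : ∀ {m n} (S : Subset m) (S′ : Subset n) →
    (∀ t i → At S i → At S (suc t + i) → ∃ λ j → At S′ j × At S′ (suc t + j)) → spread S ≤ spread S′
  spread-mono S S′ h = length-⊆ (shifts-unique S) λ {t} t∈ → move t (∈-shifts⁻ S t∈)
    where
    move : ∀ t → (∃ λ i → At S i × At S (suc t + i)) → t ∈ shifts S′
    move t (i , p , q) with h t i p q
    ... | j , p′ , q′ = ∈-shifts⁺ S′ t j p′ q′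

  spread-false∷ : ∀ {n} (S : Subset n) → spread (false ∷ S) ≡ spread S
  spread-false∷ S = ℕP.≤-antisym
    (spread-mono (false ∷ S) S λ { t (suc i) p q → i , p , subst (At (false ∷ S)) (cong suc (ℕP.+-suc t i)) q })
    (spread-mono S (false ∷ S) λ t i p q → suc i , p , subst (At (false ∷ S)) (sym (cong suc (ℕP.+-suc t i))) q)

  At-∷ʳ⁺ : ∀ {n} (S : Subset n) {b k} → At S k → At (S ∷ʳ b) k
  At-∷ʳ⁺ (_ ∷ S) {k = zero} h = h
  At-∷ʳ⁺ (_ ∷ S) {k = suc k} h = At-∷ʳ⁺ S h

  At-last : ∀ {n} (S : Subset n) → At (S ∷ʳ true) n
  At-last [] = refl
  At-last (_ ∷ S) = At-last S

  At-∷ʳ⁻ : ∀ {n} (S : Subset n) {b k} → At (S ∷ʳ b) k → At S k ⊎ (k ≡ n × b ≡ true)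
  At-∷ʳ⁻ [] {k = zero} h = inj₂ (refl , h)
  At-∷ʳ⁻ (_ ∷ S) {k = zero} h = inj₁ h
  At-∷ʳ⁻ (_ ∷ S) {k = suc k} h with At-∷ʳ⁻ S h
  ... | inj₁ p = inj₁ p
  ... | inj₂ (refl , q) = inj₂ (refl , q)

  spread-∷ʳfalse : ∀ {n} (S : Subset n) → spread (S ∷ʳ false) ≡ spread S
  spread-∷ʳfalse S = ℕP.≤-antisym
    (spread-mono (S ∷ʳ false) S λ t i p q → i , drop-last (At-∷ʳ⁻ S p) , drop-last (At-∷ʳ⁻ S q))
    (spread-mono S (S ∷ʳ false) λ t i p q → i , At-∷ʳ⁺ S p , At-∷ʳ⁺ S q)
    where
    drop-last : ∀ {k} → At S k ⊎ (k ≡ _ × false ≡ true) → At S k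
    drop-last (inj₁ p) = p

  -- A set without 0 is a translate of a subset of [n], and translation preserves differences.
  total-suc : ∀ n m → total (suc n) m ≡ leading n m + total n m
  total-suc n m = trans (count-∷ {n} (λ S → spread S ≟ m)) (cong (_+_ (leading n m))
    (count-cong {n} (λ S → spread (false ∷ S) ≟ m) (λ S → spread S ≟ m)
      (λ S → trans (sym (spread-false∷ S))) (λ S → trans (spread-false∷ S))))

  leading-suc : ∀ n m → leading (suc n) m ≡ spanning n m + leading n m
  leading-suc n m = trans (count-∷ʳ {n} (λ S → spread (true ∷ S) ≟ m)) (cong (_+_ (spanning n m))
    (count-cong {n} (λ S → spread (true ∷ (S ∷ʳ false)) ≟ m) (λ S → spread (true ∷ S) ≟ m)
      (λ S → trans (sym (spread-∷ʳfalse (true ∷ S)))) (λ S → trans (spread-∷ʳfalse (true ∷ S)))))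

-- Point sets between 0 and d and their positive differences

module Configurations where

  open LinearArithmetic
  open import Data.Integer using (ℤ; +_; _+_; _-_; _≤_; 0ℤ; 1ℤ)
  open import Data.Nat as ℕ using (ℕ; suc)

  infix 6 _≡any_
  _≡any_ : ∀ {n} → Expr n → List (Expr n) → Formula n
  e ≡any [] = ⊥′
  e ≡any (x ∷ xs) = e ≡′ x ∨′ e ≡any xs

  coincidence : ∀ {n} → List (Expr n) → Formula n
  coincidence [] = ⊥′
  coincidence (x ∷ xs) = x ≡any xs ∨′ coincidence xs

  any⇒∈ : ∀ {n} (e : Expr n) es ρ → ⟦ e ≡any es ⟧ ρ → ⟦ e ⟧ₑ ρ ∈ map (λ x → ⟦ x ⟧ₑ ρ) es
  any⇒∈ e (x ∷ es) ρ (inj₁ p) = here p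
  any⇒∈ e (x ∷ es) ρ (inj₂ p) = there (any⇒∈ e es ρ p)

  ∈⇒any : ∀ {n} (e : Expr n) es ρ → ⟦ e ⟧ₑ ρ ∈ map (λ x → ⟦ x ⟧ₑ ρ) es → ⟦ e ≡any es ⟧ ρ
  ∈⇒any e (x ∷ es) ρ (here p) = inj₁ p
  ∈⇒any e (x ∷ es) ρ (there p) = inj₂ (∈⇒any e es ρ p)

  ¬coincidence⇒Unique : ∀ {n} (es : List (Expr n)) ρ → ¬ ⟦ coincidence es ⟧ ρ → Unique (map (λ x → ⟦ x ⟧ₑ ρ) es)
  ¬coincidence⇒Unique [] ρ h = []
  ¬coincidence⇒Unique (e ∷ es) ρ h =
    AllP.¬Any⇒All¬ _ (λ p → h (inj₁ (∈⇒any e es ρ p))) ∷ ¬coincidence⇒Unique es ρ (h ∘ inj₂)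

  infix 4 _≺_
  -- By computation the meaning of `<′`, so that instances of `linear` apply without conversion.
  _≺_ : ℤ → ℤ → Set
  x ≺ y = 1ℤ + x ≤ y

  Gap : List ℤ → ℤ → Set
  Gap E e = 0ℤ ≺ e × ∃₂ λ a b → a ∈ E × b ∈ E × e ≡ a - b

  -- A set E of integers with minimum 0 and maximum d whose differences take exactly m positive values.
  record Config (d : ℤ) (E : List ℤ) (m : ℕ) : Set where
    field
      0∈      : 0ℤ ∈ E
      d∈      : d ∈ E
      0≺d     : 0ℤ ≺ d
      bounded : ∀ {z} → z ∈ E → 0ℤ ≤ z × z ≤ d
      few     : ∀ {ds} → Unique ds → All (Gap E) ds → length ds ℕ.≤ m
      many    : ∀ {L} → (∀ {e} → Gap E e → e ∈ L) → m ℕ.≤ length L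

  -- Since 0 and d always belong to `E`, a set is encoded by its points strictly between them.
  Covered : ℤ → List ℤ → List ℤ → Set
  Covered d E l = (∀ {z} → z ∈ l → z ∈ E) × (∀ {z} → z ∈ E → 0ℤ ≺ z → z ≺ d → z ∈ l)

  x₀ : ∀ {n} → Expr (1 ℕ.+ n)
  x₀ = var (# 0)
  x₁ : ∀ {n} → Expr (2 ℕ.+ n)
  x₁ = var (# 1)
  x₂ : ∀ {n} → Expr (3 ℕ.+ n)
  x₂ = var (# 2)
  x₃ : ∀ {n} → Expr (4 ℕ.+ n)
  x₃ = var (# 3)
  x₄ : ∀ {n} → Expr (5 ℕ.+ n)
  x₄ = var (# 4)
  x₅ : ∀ {n} → Expr (6 ℕ.+ n)
  x₅ = var (# 5)

  gap : ∀ {E a b} → a ∈ E → b ∈ E → b ≺ a → Gap E (a - b)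
  gap {E} {a} {b} a∈ b∈ l = linear (x₁ <′ x₀ ⇒′ con 0ℤ <′ x₀ ⊖ x₁) refl (a ∷ b ∷ []) l , a , b , a∈ , b∈ , refl

  gap₀ : ∀ {E a} → 0ℤ ∈ E → a ∈ E → 0ℤ ≺ a → Gap E a
  gap₀ {E} {a} 0∈ a∈ l = l , a , 0ℤ , a∈ , 0∈ , sym (ℤP.+-identityʳ a)

  module _ {d : ℤ} {E : List ℤ} {m : ℕ} (c : Config d E m) where
    open Config c

    -- The source of all relations between points: among more than `m` expressions for positive
    -- differences two must agree, and each possible agreement is a linear equation.
    coincide : ∀ {k} (es : List (Expr k)) ρ → All (λ e → Gap E (⟦ e ⟧ₑ ρ)) es → m ℕ.< length es → ⟦ coincidence es ⟧ ρ
    coincide es ρ gaps lt with decide (coincidence es) ρ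
    ... | yes p = p
    ... | no h = ⊥-elim (ℕP.<⇒≱ lt (subst (ℕ._≤ m) (ListP.length-map _ es) (few (¬coincidence⇒Unique es ρ h) (AllP.map⁺ gaps))))

    search-for : ∀ {k} (φ : Formula (suc k)) ρ →
      (∃ λ z → z ∈ E × ⟦ φ ⟧ (z ∷ ρ)) ⊎ (∀ {z} → z ∈ E → ¬ ⟦ φ ⟧ (z ∷ ρ))
    search-for φ ρ with Any.any? (λ z → decide φ (z ∷ ρ)) E
    ... | yes p = inj₁ (find p)
    ... | no h = inj₂ λ z∈ p → h (lose z∈ p)

    -- Under z ↦ d - z the difference a - b becomes (d - b) - (d - a), so the set of positive
    -- differences does not change.
    mirror : Config d (map (_-_ d) E) m
    mirror = record
      { 0∈ = subst (_∈ map (_-_ d) E) (ℤP.+-inverseʳ d) (∈P.∈-map⁺ (_-_ d) d∈)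
      ; d∈ = subst (_∈ map (_-_ d) E) (ℤP.+-identityʳ d) (∈P.∈-map⁺ (_-_ d) 0∈)
      ; 0≺d = 0≺d
      ; bounded = λ z∈ → bounded′ (∈P.∈-map⁻ (_-_ d) z∈)
      ; few = λ u gaps → few u (All.map back gaps)
      ; many = λ cover → many λ g → cover (forth g)
      }
      where
      bounded′ : ∀ {z} → (∃ λ y → y ∈ E × z ≡ d - y) → 0ℤ ≤ z × z ≤ d
      bounded′ (y , y∈ , refl) =
        linear (con 0ℤ ≤′ x₀ ∧′ x₀ ≤′ x₁ ⇒′ con 0ℤ ≤′ x₁ ⊖ x₀ ∧′ x₁ ⊖ x₀ ≤′ x₁) refl (y ∷ d ∷ []) (bounded y∈)
      flip : ∀ {a b} → a - b ≡ (d - b) - (d - a)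
      flip {a} {b} = linear (x₀ ⊖ x₁ ≡′ x₂ ⊖ x₁ ⊖ (x₂ ⊖ x₀)) refl (a ∷ b ∷ d ∷ [])
      unflip : ∀ {a b} → (d - a) - (d - b) ≡ b - a
      unflip {a} {b} = linear (x₂ ⊖ x₀ ⊖ (x₂ ⊖ x₁) ≡′ x₁ ⊖ x₀) refl (a ∷ b ∷ d ∷ [])
      back : ∀ {e} → Gap (map (_-_ d) E) e → Gap E e
      back (l , _ , _ , p , q , eq) with ∈P.∈-map⁻ (_-_ d) p | ∈P.∈-map⁻ (_-_ d) q
      ... | a , a∈ , refl | b , b∈ , refl = l , b , a , b∈ , a∈ , trans eq (unflip {a} {b})
      forth : ∀ {e} → Gap E e → Gap (map (_-_ d) E) e
      forth (l , a , b , p , q , eq) = l , d - b , d - a , ∈P.∈-map⁺ (_-_ d) q , ∈P.∈-map⁺ (_-_ d) p , trans eq (flip {a} {b})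

  d-[d-z] : ∀ d z → d - (d - z) ≡ z
  d-[d-z] d z = linear (x₀ ⊖ (x₀ ⊖ x₁) ≡′ x₁) refl (d ∷ z ∷ [])

  covered-mirror : ∀ {d E l} → Covered d (map (_-_ d) E) l → Covered d E (map (_-_ d) l)
  covered-mirror {d} {E} {l} (f , g) = (λ z∈ → to (∈P.∈-map⁻ (_-_ d) z∈)) , from
    where
    to : ∀ {z} → (∃ λ y → y ∈ l × z ≡ d - y) → z ∈ E
    to (y , y∈ , refl) with ∈P.∈-map⁻ (_-_ d) (f y∈)
    ... | x , x∈ , refl = subst (_∈ E) (sym (d-[d-z] d x)) x∈
    from : ∀ {z} → z ∈ E → 0ℤ ≺ z → z ≺ d → z ∈ map (_-_ d) l
    from {z} z∈ p q = subst (_∈ map (_-_ d) l) (d-[d-z] d z)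
      (∈P.∈-map⁺ (_-_ d) (g (∈P.∈-map⁺ (_-_ d) z∈)
        (linear (x₀ <′ x₁ ⇒′ con 0ℤ <′ x₁ ⊖ x₀) refl (z ∷ d ∷ []) q)
        (linear (con 0ℤ <′ x₀ ⇒′ x₁ ⊖ x₀ <′ x₁) refl (z ∷ d ∷ []) p)))

  sublists : List ℤ → List (List ℤ)
  sublists [] = [] ∷ []
  sublists (y ∷ ys) = map (y ∷_) (sublists ys) ++ sublists ys

  -- The points of `R` are forced, those of `Y` are optional.
  extensions : List ℤ → List ℤ → List (List ℤ)
  extensions R Y = map (R ++_) (sublists Y)

  filter∈sublists : ∀ E Y → filter (_∈? E) Y ∈ sublists Y
  filter∈sublists E [] = here refl
  filter∈sublists E (y ∷ Y) with does (y ∈? E)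
  ... | true = ∈P.∈-++⁺ˡ (∈P.∈-map⁺ (y ∷_) (filter∈sublists E Y))
  ... | false = ∈P.∈-++⁺ʳ (map (y ∷_) (sublists Y)) (filter∈sublists E Y)

  covered-extension : ∀ {d E} R Y → All (_∈ E) R →
    (∀ {z} → z ∈ E → 0ℤ ≺ z → z ≺ d → z ∈ R ++ Y) → ∃ λ l → l ∈ extensions R Y × Covered d E l
  covered-extension {d} {E} R Y R⊆ cover =
    R ++ filter (_∈? E) Y , ∈P.∈-map⁺ (R ++_) (filter∈sublists E Y) , to , λ z∈ p q → from z∈ (∈P.∈-++⁻ R (cover z∈ p q))
    where
    to : ∀ {z} → z ∈ R ++ filter (_∈? E) Y → z ∈ E
    to z∈ with ∈P.∈-++⁻ R z∈
    ... | inj₁ p = All.lookup R⊆ p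
    ... | inj₂ p = proj₂ (∈P.∈-filter⁻ (_∈? E) {xs = Y} p)
    from : ∀ {z} → z ∈ E → z ∈ R ⊎ z ∈ Y → z ∈ R ++ filter (_∈? E) Y
    from z∈ (inj₁ p) = ∈P.∈-++⁺ˡ p
    from z∈ (inj₂ p) = ∈P.∈-++⁺ʳ R (∈P.∈-filter⁺ (_∈? E) p z∈)

-- Orbits of z ↦ d - z and the relations between three of them

module Orbits where

  open LinearArithmetic
  open Configurations
  open import Data.Integer using (ℤ; +≤+; +_; _+_; _-_; _≤_; 0ℤ)
  open import Data.Nat as ℕ using (ℕ; zero; suc)

  -- The points between 0 and d whose orbit has two elements.
  interior : ∀ {n} → Expr n → Expr n → Formula n
  interior d u = con 0ℤ <′ u ∧′ u <′ d ∧′ ¬′ (u ⊕ u ≡′ d)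

  apart : ∀ {n} → Expr n → Expr n → Expr n → Formula n
  apart d u v = ¬′ (u ≡′ v) ∧′ ¬′ (u ⊕ v ≡′ d)

  compare : ∀ x y → x ≺ y ⊎ (x ≡ y ⊎ y ≺ x)
  compare x y = linear (x₀ <′ x₁ ∨′ (x₀ ≡′ x₁ ∨′ x₁ <′ x₀)) refl (x ∷ y ∷ [])

  triple : ∀ {n} → Expr n → Expr n → Expr n → Expr n → Formula n
  triple d u v w = interior d u ∧′ interior d v ∧′ interior d w ∧′ apart d u v ∧′ apart d u w ∧′ apart d v w

  orbits : ∀ {n} → Expr n → List (Expr n) → List (Expr n)
  orbits d [] = []
  orbits d (u ∷ us) = u ∷ d ⊖ u ∷ orbits d us

  ints : ℕ → List ℤ
  ints k = map (λ i → + suc i) (upTo k)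

  -- The exact quotient if there is one. A case that needs d to be divisible by k thus costs at most
  -- one choice of unit.
  quotients : ∀ k .{{_ : ℕ.NonZero k}} → ℕ → List ℤ
  quotients k N = if does (N ℕ./ k ℕ.* k ℕP.≟ N) then + (N ℕ./ k) ∷ [] else []

  times : ℕ → ℤ → ℤ
  times zero z = 0ℤ
  times (suc k) z = z + times k z

  infixl 8 _×′_
  -- The recursion follows that of `times`, so that the value of `k ×′ e` is `times k` of the value
  -- of `e` by computation.
  _×′_ : ∀ {n} → ℕ → Expr n → Expr n
  zero ×′ e = con 0ℤ
  suc k ×′ e = e ⊕ k ×′ e

  times-+ : ∀ k i → times k (+ i) ≡ + (i ℕ.* k)
  times-+ zero i = cong +_ (sym (ℕP.*-zeroʳ i))
  times-+ (suc k) i = trans (cong (_+_ (+ i)) (times-+ k i)) (cong +_ (sym (ℕP.*-suc i k)))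

  ∈-ints : ∀ k .{{_ : ℕ.NonZero k}} {N z} → 0ℤ ≺ z → times k z ≤ + N → z ∈ ints (N ℕ./ k)
  ∈-ints k {N} {+ suc i} _ h = ∈P.∈-map⁺ (λ i → + suc i) (∈P.∈-upTo⁺
    (subst (ℕ._≤ N ℕ./ k) (DivMod.m*n/n≡m (suc i) k) (DivMod./-monoˡ-≤ k (ℤP.drop‿+≤+ (subst (_≤ + N) (times-+ k (suc i)) h)))))
  ∈-ints k {N} {+ zero} (+≤+ ())

  ∈-quotients : ∀ k .{{_ : ℕ.NonZero k}} {N z} → 0ℤ ≤ z → times k z ≡ + N → z ∈ quotients k N
  ∈-quotients k {N} {+ i} _ h = exact (N ℕ./ k) (trans (cong (ℕ._/ k) (sym i*k≡N)) (DivMod.m*n/n≡m i k)) i*k≡N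
    where
    i*k≡N : i ℕ.* k ≡ N
    i*k≡N = ℤP.+-injective (trans (sym (times-+ k i)) h)
    exact : ∀ q → q ≡ i → i ℕ.* k ≡ N → + i ∈ (if does (q ℕ.* k ℕP.≟ N) then + q ∷ [] else [])
    exact q refl refl with q ℕ.* k ℕ.≡ᵇ q ℕ.* k | ℕP.≡⇒≡ᵇ (q ℕ.* k) (q ℕ.* k) refl
    ... | true | _ = here refl

  -- For 0 < 2p < d this is the residue of 3p modulo d, since then 3p < 2d.
  third : ℤ → ℤ → ℤ
  third d p = if does (p + p + p ℤP.<? d) then p + p + p else p + p + p - d

  progression : ℤ → ℤ → List (List ℤ)
  progression d p = extensions (p ∷ p + p ∷ third d p ∷ []) (d - p ∷ d - (p + p) ∷ [])

  multiples : ℤ → List ℤ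
  multiples e = e ∷ times 2 e ∷ times 3 e ∷ times 4 e ∷ times 5 e ∷ times 6 e ∷ []

  progressions sevenths : ℕ → List (List ℤ)
  progressions N = concatMap (progression (+ N)) (ints (N ℕ./ 2))
  sevenths N = concatMap (λ e → extensions [] (multiples e)) (quotients 7 N)

  Candidate : List (List ℤ) → ℤ → List ℤ → Set
  Candidate L d E = ∃ λ l → l ∈ L × Covered d E l

  candidate-⊆ : ∀ {L L′ d E} → (∀ {l} → l ∈ L → l ∈ L′) → Candidate L d E → Candidate L′ d E
  candidate-⊆ sub (l , l∈ , cov) = l , sub l∈ , cov

  ∈-concatMap : ∀ {A B : Set} (f : A → List B) {x xs y} → x ∈ xs → y ∈ f x → y ∈ concatMap f xs
  ∈-concatMap f x∈ y∈ = ∈P.∈-concatMap⁺ f (lose x∈ y∈)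

  third-below : ∀ {d p} → p + p + p ≺ d → third d p ≡ p + p + p
  third-below {d} {p} l with p + p + p ℤP.<? d
  ... | yes _ = refl
  ... | no h = ⊥-elim (h (ℤP.suc[i]≤j⇒i<j l))

  third-above : ∀ {d p} → 0ℤ ≺ p + p + p - d → third d p ≡ p + p + p - d
  third-above {d} {p} l with p + p + p ℤP.<? d
  ... | no _ = refl
  ... | yes h = ⊥-elim (linear (con 0ℤ <′ x₀ ⊕ x₀ ⊕ x₀ ⊖ x₁ ⇒′ ¬′ (x₀ ⊕ x₀ ⊕ x₀ <′ x₁)) refl (p ∷ d ∷ []) l (ℤP.i<j⇒suc[i]≤j h))

  -- The last three disjuncts are doublings in the mirror image: `v ⊕ v ≡′ u ⊕ d` says that d - u =
  -- 2 (d - v).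
  doubled : ∀ {n} → Expr n → Expr n → Expr n → Expr n → Formula n
  doubled d u v w =
    v ≡′ u ⊕ u ∨′ w ≡′ u ⊕ u ∨′ w ≡′ v ⊕ v ∨′ v ⊕ v ≡′ u ⊕ d ∨′ w ⊕ w ≡′ u ⊕ d ∨′ w ⊕ w ≡′ v ⊕ d

  tripled : ∀ {n} → Expr n → Expr n → Expr n → Formula n
  tripled d p r = r ≡′ 3 ×′ p ∨′ r ≡′ 3 ×′ p ⊖ d

  -- In units of d/7 the pair (p, r) is (1, 3), (1, 4), (2, 1), (2, 6), (3, 2) or (3, 5); the orbits
  -- of p, 2p, r then exhaust the multiples of d/7 between 0 and d.
  seventhly : ∀ {n} → Expr n → Expr n → Expr n → Formula n
  seventhly d p r =
    7 ×′ p ≡′ d ∧′ r ≡any (3 ×′ p ∷ 4 ×′ p ∷ []) ∨′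
    7 ×′ p ≡′ 2 ×′ d ∧′ (7 ×′ r ≡′ d ∨′ 7 ×′ r ≡′ 6 ×′ d) ∨′
    7 ×′ p ≡′ 3 ×′ d ∧′ (7 ×′ r ≡′ 2 ×′ d ∨′ 7 ×′ r ≡′ 5 ×′ d)

  -- Given u, v, w whose orbits under z ↦ d − z are distinct and of size 2, those orbits and d are all the positive differences.
  module Triples {N E} (c : Config (+ N) E 7) where
    open Config c

    private
      d : ℤ
      d = + N

    Triple : ℤ → ℤ → ℤ → Set
    Triple u v w = (u ∈ E × v ∈ E × w ∈ E) × ⟦ triple x₃ x₀ x₁ x₂ ⟧ (u ∷ v ∷ w ∷ d ∷ [])

    swap₁₂ : ∀ {u v w} → Triple u v w → Triple v u w
    swap₁₂ {u} {v} {w} ((a , b , e) , h) =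
      (b , a , e) , linear (triple x₃ x₀ x₁ x₂ ⇒′ triple x₃ x₁ x₀ x₂) refl (u ∷ v ∷ w ∷ d ∷ []) h

    swap₂₃ : ∀ {u v w} → Triple u v w → Triple u w v
    swap₂₃ {u} {v} {w} ((a , b , e) , h) =
      (a , e , b) , linear (triple x₃ x₀ x₁ x₂ ⇒′ triple x₃ x₀ x₂ x₁) refl (u ∷ v ∷ w ∷ d ∷ []) h

    u≢v : ∀ {u v w} → Triple u v w → u ≢ v
    u≢v {u} {v} {w} (_ , h) = linear (triple x₃ x₀ x₁ x₂ ⇒′ ¬′ (x₀ ≡′ x₁)) refl (u ∷ v ∷ w ∷ d ∷ []) h

    Sorted : Set
    Sorted = ∃ λ u → ∃ λ v → ∃ λ w → Triple u v w × u ≺ v × v ≺ w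

    insert : ∀ {u v w} → Triple u v w → u ≺ v → Sorted
    insert {u} {v} {w} t l with compare v w | compare u w
    ... | inj₁ l′ | _ = u , v , w , t , l , l′
    ... | inj₂ (inj₁ e) | _ = ⊥-elim (u≢v (swap₂₃ (swap₁₂ t)) e)
    ... | inj₂ (inj₂ l′) | inj₁ l″ = u , w , v , swap₂₃ t , l″ , l′
    ... | inj₂ (inj₂ l′) | inj₂ (inj₁ e) = ⊥-elim (u≢v (swap₂₃ t) e)
    ... | inj₂ (inj₂ l′) | inj₂ (inj₂ l″) = w , u , v , swap₁₂ (swap₂₃ t) , l″ , l

    sort : ∀ {u v w} → Triple u v w → Sorted
    sort {u} {v} {w} t with compare u v
    ... | inj₁ l = insert t l
    ... | inj₂ (inj₁ e) = ⊥-elim (u≢v t e)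
    ... | inj₂ (inj₂ l) = insert (swap₁₂ t) l

    -- The three orbits and d are seven different positive differences, so the eighth expression
    -- `a − b` must repeat one of them.
    gap-in-orbit : ∀ {a b u v w} → Triple u v w → a ∈ E → b ∈ E → b ≺ a →
      ⟦ x₀ ⊖ x₁ ≡any (x₅ ∷ orbits x₅ (x₂ ∷ x₃ ∷ x₄ ∷ [])) ⟧ (a ∷ b ∷ u ∷ v ∷ w ∷ d ∷ [])
    gap-in-orbit {a} {b} {u} {v} {w} t@((u∈ , v∈ , w∈) , h@((0u , ud , _) , (0v , vd , _) , (0w , wd , _) , _)) a∈ b∈ l =
      linear (triple x₅ x₂ x₃ x₄ ⇒′ coincidence (x₀ ⊖ x₁ ∷ all) ⇒′ x₀ ⊖ x₁ ≡any all) refl ρ h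
        (coincide c (x₀ ⊖ x₁ ∷ all) ρ
          (gap a∈ b∈ l ∷ gap₀ 0∈ d∈ 0≺d ∷ gap₀ 0∈ u∈ 0u ∷ gap d∈ u∈ ud ∷ gap₀ 0∈ v∈ 0v ∷ gap d∈ v∈ vd ∷ gap₀ 0∈ w∈ 0w ∷ gap d∈ w∈ wd ∷ [])
          ℕP.≤-refl)
      where
      ρ = a ∷ b ∷ u ∷ v ∷ w ∷ d ∷ []
      all : List (Expr 6)
      all = x₅ ∷ orbits x₅ (x₂ ∷ x₃ ∷ x₄ ∷ [])

    distance-in-orbit : ∀ {a b u v w} → Triple u v w → a ∈ E → b ∈ E → a ≢ b →
      ⟦ x₀ ⊖ x₁ ≡any (x₅ ∷ orbits x₅ (x₂ ∷ x₃ ∷ x₄ ∷ [])) ∨′ x₁ ⊖ x₀ ≡any (x₅ ∷ orbits x₅ (x₂ ∷ x₃ ∷ x₄ ∷ [])) ⟧ (a ∷ b ∷ u ∷ v ∷ w ∷ d ∷ [])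
    distance-in-orbit {a} {b} t a∈ b∈ a≢b with compare a b
    ... | inj₁ l = inj₂ (gap-in-orbit t b∈ a∈ l)
    ... | inj₂ (inj₁ e) = ⊥-elim (a≢b e)
    ... | inj₂ (inj₂ l) = inj₁ (gap-in-orbit t a∈ b∈ l)

    in-orbit : ∀ {z u v w} → Triple u v w → z ∈ E → 0ℤ ≺ z →
      ⟦ x₀ ≡any (x₄ ∷ orbits x₄ (x₁ ∷ x₂ ∷ x₃ ∷ [])) ⟧ (z ∷ u ∷ v ∷ w ∷ d ∷ [])
    in-orbit {z} {u} {v} {w} t z∈ l =
      linear (x₀ ⊖ con 0ℤ ≡any (x₄ ∷ orbits x₄ (x₁ ∷ x₂ ∷ x₃ ∷ [])) ⇒′ x₀ ≡any (x₄ ∷ orbits x₄ (x₁ ∷ x₂ ∷ x₃ ∷ [])))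
        refl (z ∷ u ∷ v ∷ w ∷ d ∷ []) (gap-in-orbit t z∈ 0∈ l)

    -- The distances v - u, w - v and their sum w - u are all among the seven known differences;
    -- every consistent choice contains a doubling, possibly in the mirror image.
    doubling : ∀ {u v w} → Triple u v w → u ≺ v → v ≺ w → ⟦ doubled x₃ x₀ x₁ x₂ ⟧ (u ∷ v ∷ w ∷ d ∷ [])
    doubling {u} {v} {w} t@((u∈ , v∈ , w∈) , h) l l′ =
      linear (triple x₃ x₀ x₁ x₂ ⇒′ x₀ <′ x₁ ⇒′ x₁ <′ x₂ ⇒′
          x₁ ⊖ x₀ ≡any all ⇒′ x₂ ⊖ x₁ ≡any all ⇒′ x₂ ⊖ x₀ ≡any all ⇒′ doubled x₃ x₀ x₁ x₂) refl (u ∷ v ∷ w ∷ d ∷ [])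
        h l l′ (gap-in-orbit t v∈ u∈ l) (gap-in-orbit t w∈ v∈ l′)
        (gap-in-orbit t w∈ u∈ (linear (x₀ <′ x₁ ⇒′ x₁ <′ x₂ ⇒′ x₀ <′ x₂) refl (u ∷ v ∷ w ∷ []) l l′))
      where
      all : List (Expr 4)
      all = x₃ ∷ orbits x₃ (x₀ ∷ x₁ ∷ x₂ ∷ [])

    -- Apart from three solutions inside (d/7)ℤ, the third orbit of p, 2p, r is that of 3p.
    tripling : ∀ {p r} → Triple p (p + p) r → ⟦ tripled x₂ x₀ x₁ ∨′ seventhly x₂ x₀ x₁ ⟧ (p ∷ r ∷ d ∷ [])
    tripling {p} {r} t@((p∈ , q∈ , r∈) , h) =
      linear (triple x₂ x₀ (x₀ ⊕ x₀) x₁ ⇒′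
          (x₁ ⊖ x₀ ≡any all ∨′ x₀ ⊖ x₁ ≡any all) ⇒′ (x₁ ⊖ (x₀ ⊕ x₀) ≡any all ∨′ x₀ ⊕ x₀ ⊖ x₁ ≡any all) ⇒′
          tripled x₂ x₀ x₁ ∨′ seventhly x₂ x₀ x₁) refl (p ∷ r ∷ d ∷ [])
        h (distance-in-orbit t r∈ p∈ (u≢v (swap₂₃ t) ∘ sym)) (distance-in-orbit t r∈ q∈ (u≢v (swap₂₃ (swap₁₂ t)) ∘ sym))
      where
      all : List (Expr 3)
      all = x₂ ∷ orbits x₂ (x₀ ∷ x₀ ⊕ x₀ ∷ x₁ ∷ [])

-- Three orbits: progressions p, 2p, 3p and multiples of d/7

module Progressions where

  open LinearArithmetic
  open Configurations
  open Orbits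
  open import Data.Integer using (ℤ; +_; _+_; _-_; _≤_; 0ℤ)
  open import Data.Nat using (ℕ)

  multiples′ : ∀ {n} → Expr n → List (Expr n)
  multiples′ e = e ∷ 2 ×′ e ∷ 3 ×′ e ∷ 4 ×′ e ∷ 5 ×′ e ∷ 6 ×′ e ∷ []

  InSevenths : ℕ → List ℤ → Set
  InSevenths N E = ∃ λ e → 0ℤ ≤ e × times 7 e ≡ + N × (∀ {z} → z ∈ E → 0ℤ ≺ z → z ≺ + N → z ∈ multiples e)

  module _ {N E} (c : Config (+ N) E 7) where
    open Config c
    open Triples c

    private
      d : ℤ
      d = + N

    -- In each solution the unit d/7 is at hand: it is p, r, d - r or d - 2p.
    in-sevenths : ∀ {p r} → Triple p (p + p) r → ⟦ seventhly x₂ x₀ x₁ ⟧ (p ∷ r ∷ d ∷ []) → InSevenths N E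
    in-sevenths {p} {r} t@(_ , h) (inj₁ s) =
      p , linear (interior x₂ x₀ ⇒′ con 0ℤ ≤′ x₀) refl (p ∷ r ∷ d ∷ []) (proj₁ h) , proj₁ s ,
      λ {z} z∈ 0z zd → any⇒∈ x₀ (multiples′ x₁) (z ∷ p ∷ r ∷ d ∷ [])
        (linear (x₀ <′ x₃ ⇒′ x₀ ≡any (x₃ ∷ orbits x₃ (x₁ ∷ x₁ ⊕ x₁ ∷ x₂ ∷ [])) ⇒′
            7 ×′ x₁ ≡′ x₃ ∧′ x₂ ≡any (3 ×′ x₁ ∷ 4 ×′ x₁ ∷ []) ⇒′ x₀ ≡any multiples′ x₁)
          refl (z ∷ p ∷ r ∷ d ∷ []) zd (in-orbit t z∈ 0z) s)
    in-sevenths {p} {r} t@(_ , h) (inj₂ (inj₁ (s , inj₁ s′))) =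
      r , linear (interior x₂ x₁ ⇒′ con 0ℤ ≤′ x₁) refl (p ∷ r ∷ d ∷ []) (proj₁ (proj₂ (proj₂ h))) , s′ ,
      λ {z} z∈ 0z zd → any⇒∈ x₀ (multiples′ x₂) (z ∷ p ∷ r ∷ d ∷ [])
        (linear (x₀ <′ x₃ ⇒′ x₀ ≡any (x₃ ∷ orbits x₃ (x₁ ∷ x₁ ⊕ x₁ ∷ x₂ ∷ [])) ⇒′
            7 ×′ x₁ ≡′ 2 ×′ x₃ ⇒′ 7 ×′ x₂ ≡′ x₃ ⇒′ x₀ ≡any multiples′ x₂)
          refl (z ∷ p ∷ r ∷ d ∷ []) zd (in-orbit t z∈ 0z) s s′)
    in-sevenths {p} {r} t@(_ , h) (inj₂ (inj₁ (s , inj₂ s′))) =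
      d - r , linear (interior x₂ x₁ ⇒′ con 0ℤ ≤′ x₂ ⊖ x₁) refl (p ∷ r ∷ d ∷ []) (proj₁ (proj₂ (proj₂ h))) ,
      linear (7 ×′ x₁ ≡′ 6 ×′ x₂ ⇒′ 7 ×′ (x₂ ⊖ x₁) ≡′ x₂) refl (p ∷ r ∷ d ∷ []) s′ ,
      λ {z} z∈ 0z zd → any⇒∈ x₀ (multiples′ (x₃ ⊖ x₂)) (z ∷ p ∷ r ∷ d ∷ [])
        (linear (x₀ <′ x₃ ⇒′ x₀ ≡any (x₃ ∷ orbits x₃ (x₁ ∷ x₁ ⊕ x₁ ∷ x₂ ∷ [])) ⇒′
            7 ×′ x₁ ≡′ 2 ×′ x₃ ⇒′ 7 ×′ x₂ ≡′ 6 ×′ x₃ ⇒′ x₀ ≡any multiples′ (x₃ ⊖ x₂))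
          refl (z ∷ p ∷ r ∷ d ∷ []) zd (in-orbit t z∈ 0z) s s′)
    in-sevenths {p} {r} t@(_ , h) (inj₂ (inj₂ (s , s′))) =
      d - (p + p) , linear (interior x₂ (x₀ ⊕ x₀) ⇒′ con 0ℤ ≤′ x₂ ⊖ (x₀ ⊕ x₀)) refl (p ∷ r ∷ d ∷ []) (proj₁ (proj₂ h)) ,
      linear (7 ×′ x₀ ≡′ 3 ×′ x₂ ⇒′ 7 ×′ (x₂ ⊖ (x₀ ⊕ x₀)) ≡′ x₂) refl (p ∷ r ∷ d ∷ []) s ,
      λ {z} z∈ 0z zd → any⇒∈ x₀ (multiples′ (x₃ ⊖ (x₁ ⊕ x₁))) (z ∷ p ∷ r ∷ d ∷ [])
        (linear (x₀ <′ x₃ ⇒′ x₀ ≡any (x₃ ∷ orbits x₃ (x₁ ∷ x₁ ⊕ x₁ ∷ x₂ ∷ [])) ⇒′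
            7 ×′ x₁ ≡′ 3 ×′ x₃ ⇒′ (7 ×′ x₂ ≡′ 2 ×′ x₃ ∨′ 7 ×′ x₂ ≡′ 5 ×′ x₃) ⇒′ x₀ ≡any multiples′ (x₃ ⊖ (x₁ ⊕ x₁)))
          refl (z ∷ p ∷ r ∷ d ∷ []) zd (in-orbit t z∈ 0z) s s′)

    other-member : ∀ {p q r z} → Triple p q r → z ∈ E → z ≡ d - r → Triple p q z
    other-member {p} {q} {r} ((p∈ , q∈ , _) , h) z∈ refl = (p∈ , q∈ , z∈) ,
      linear (triple x₃ x₀ x₁ x₂ ⇒′ triple x₃ x₀ x₁ (x₃ ⊖ x₂)) refl (p ∷ q ∷ r ∷ d ∷ []) h

    third≡ : ∀ {p r} → Triple p (p + p) r → ⟦ tripled x₂ x₀ x₁ ⟧ (p ∷ r ∷ d ∷ []) → third d p ≡ r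
    third≡ {p} {r} (_ , h) (inj₁ e) = trans (third-below {d} {p}
        (linear (interior x₂ x₁ ⇒′ x₁ ≡′ 3 ×′ x₀ ⇒′ x₀ ⊕ x₀ ⊕ x₀ <′ x₂) refl (p ∷ r ∷ d ∷ []) (proj₁ (proj₂ (proj₂ h))) e))
      (linear (x₁ ≡′ 3 ×′ x₀ ⇒′ x₀ ⊕ x₀ ⊕ x₀ ≡′ x₁) refl (p ∷ r ∷ d ∷ []) e)
    third≡ {p} {r} (_ , h) (inj₂ e) = trans (third-above {d} {p}
        (linear (interior x₂ x₁ ⇒′ x₁ ≡′ 3 ×′ x₀ ⊖ x₂ ⇒′ con 0ℤ <′ x₀ ⊕ x₀ ⊕ x₀ ⊖ x₂) refl (p ∷ r ∷ d ∷ []) (proj₁ (proj₂ (proj₂ h))) e))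
      (linear (x₁ ≡′ 3 ×′ x₀ ⊖ x₂ ⇒′ x₀ ⊕ x₀ ⊕ x₀ ⊖ x₂ ≡′ x₁) refl (p ∷ r ∷ d ∷ []) e)

    progression-candidate : ∀ {p r} → Triple p (p + p) r → Candidate (progressions N) d E ⊎ InSevenths N E
    progression-candidate {p} {r} t@((p∈ , q∈ , r∈) , h) with decide (seventhly x₂ x₀ x₁) (p ∷ r ∷ d ∷ [])
    ... | yes s = inj₂ (in-sevenths t s)
    ... | no ¬s = inj₁ (candidate-⊆
      (λ l∈ → (∈-concatMap (progression d)
        (∈-ints 2 (proj₁ (proj₁ h)) (linear (interior x₁ (x₀ ⊕ x₀) ⇒′ 2 ×′ x₀ ≤′ x₁) refl (p ∷ d ∷ []) (proj₁ (proj₂ h)))) l∈))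
      (covered-extension (p ∷ p + p ∷ third d p ∷ []) (d - p ∷ d - (p + p) ∷ [])
        (p∈ ∷ q∈ ∷ subst (_∈ E) (sym r≡) r∈ ∷ []) λ {z} z∈ 0z zd → cover z∈ 0z zd))
      where
      r-tripled : ⟦ tripled x₂ x₀ x₁ ⟧ (p ∷ r ∷ d ∷ [])
      r-tripled = linear (tripled x₂ x₀ x₁ ∨′ seventhly x₂ x₀ x₁ ⇒′ ¬′ seventhly x₂ x₀ x₁ ⇒′ tripled x₂ x₀ x₁)
        refl (p ∷ r ∷ d ∷ []) (tripling t) ¬s
      r≡ : third d p ≡ r
      r≡ = third≡ t r-tripled
      -- If d - r belonged to `E`, it could replace r in the triple and would also be 3p or 3p - d,
      -- which puts r at 0, d/2 or d. The exceptional solutions are exchanged with each other by r ↦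
      -- d - r, so they do not reappear. Hence d - r is not among the optional points of
      -- `progression`.
      reflected : ∀ {z} → z ∈ E → z ≢ d - r
      reflected {z} z∈ e = linear
        (triple x₂ x₀ (x₀ ⊕ x₀) x₁ ⇒′ tripled x₂ x₀ x₁ ⇒′ ¬′ seventhly x₂ x₀ x₁ ⇒′ x₃ ≡′ x₂ ⊖ x₁ ⇒′
          ¬′ (tripled x₂ x₀ x₃ ∨′ seventhly x₂ x₀ x₃))
        refl (p ∷ r ∷ d ∷ z ∷ []) h r-tripled ¬s e (tripling (other-member t z∈ e))
      cover : ∀ {z} → z ∈ E → 0ℤ ≺ z → z ≺ d → z ∈ p ∷ p + p ∷ third d p ∷ d - p ∷ d - (p + p) ∷ []
      cover {z} z∈ 0z zd = subst (λ s → z ∈ p ∷ p + p ∷ s ∷ d - p ∷ d - (p + p) ∷ []) (sym r≡)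
        (any⇒∈ x₀ (x₁ ∷ x₁ ⊕ x₁ ∷ x₂ ∷ x₃ ⊖ x₁ ∷ x₃ ⊖ (x₁ ⊕ x₁) ∷ []) (z ∷ p ∷ r ∷ d ∷ [])
          (linear (x₀ <′ x₃ ⇒′ ¬′ (x₀ ≡′ x₃ ⊖ x₂) ⇒′ x₀ ≡any (x₃ ∷ orbits x₃ (x₁ ∷ x₁ ⊕ x₁ ∷ x₂ ∷ [])) ⇒′
              x₀ ≡any (x₁ ∷ x₁ ⊕ x₁ ∷ x₂ ∷ x₃ ⊖ x₁ ∷ x₃ ⊖ (x₁ ⊕ x₁) ∷ []))
            refl (z ∷ p ∷ r ∷ d ∷ []) zd (reflected z∈) (in-orbit t z∈ 0z)))

    mirror-triple : ∀ {u v w} → Triple u v w → Triples.Triple (mirror c) (d - u) (d - v) (d - w)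
    mirror-triple {u} {v} {w} ((u∈ , v∈ , w∈) , h) =
      (∈P.∈-map⁺ (_-_ d) u∈ , ∈P.∈-map⁺ (_-_ d) v∈ , ∈P.∈-map⁺ (_-_ d) w∈) ,
      linear (triple x₃ x₀ x₁ x₂ ⇒′ triple x₃ (x₃ ⊖ x₀) (x₃ ⊖ x₁) (x₃ ⊖ x₂)) refl (u ∷ v ∷ w ∷ d ∷ []) h

  mirrored : ℤ → List (List ℤ) → List (List ℤ)
  mirrored d = map (map (_-_ d))

  candidate-mirror : ∀ {N E L} → Candidate L (+ N) (map (_-_ (+ N)) E) → Candidate (mirrored (+ N) L) (+ N) E
  candidate-mirror {N} (l , l∈ , cov) = map (_-_ (+ N)) l , ∈P.∈-map⁺ (map (_-_ (+ N))) l∈ , covered-mirror cov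

  chains : ℕ → List (List ℤ)
  chains N = (progressions N ++ mirrored (+ N) (progressions N)) ++ sevenths N

  sevenths-candidate : ∀ {N E} → InSevenths N E → Candidate (chains N) (+ N) E
  sevenths-candidate {N} (e , 0≤e , 7e , cover) = candidate-⊆
    (λ l∈ → ∈P.∈-++⁺ʳ (progressions N ++ mirrored (+ N) (progressions N))
      (∈-concatMap (λ e → extensions [] (multiples e)) (∈-quotients 7 0≤e 7e) l∈))
    (covered-extension [] (multiples e) [] cover)

  -- The multiples of d/7 are permuted by z ↦ d - z.
  mirror-sevenths : ∀ {N E} → InSevenths N (map (_-_ (+ N)) E) → InSevenths N E
  mirror-sevenths {N} (e , 0≤e , 7e , cover) = e , 0≤e , 7e , λ {z} z∈ 0z zd →
    any⇒∈ x₀ (multiples′ x₂) (z ∷ d ∷ e ∷ []) (linear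
      (7 ×′ x₂ ≡′ x₁ ⇒′ x₁ ⊖ x₀ ≡any multiples′ x₂ ⇒′ x₀ ≡any multiples′ x₂) refl (z ∷ d ∷ e ∷ []) 7e
      (∈⇒any (x₁ ⊖ x₀) (multiples′ x₂) (z ∷ d ∷ e ∷ []) (cover (∈P.∈-map⁺ (_-_ d) z∈)
        (linear (x₀ <′ x₁ ⇒′ con 0ℤ <′ x₁ ⊖ x₀) refl (z ∷ d ∷ []) zd)
        (linear (con 0ℤ <′ x₀ ⇒′ x₁ ⊖ x₀ <′ x₁) refl (z ∷ d ∷ []) 0z))))
    where
    d : ℤ
    d = + N

  module _ {N E} (c : Config (+ N) E 7) where
    open Triples c

    private
      d : ℤ
      d = + N

    double-candidate : ∀ {p q r} → Triple p q r → q ≡ p + p → Candidate (chains N) d E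
    double-candidate t refl with progression-candidate c t
    ... | inj₁ cand = candidate-⊆ (λ l∈ → ∈P.∈-++⁺ˡ (∈P.∈-++⁺ˡ l∈)) cand
    ... | inj₂ s = sevenths-candidate s

    -- In the mirror image d - q is twice d - p, which is the case of a doubling.
    codouble-candidate : ∀ {p q r} → Triple p q r → p + p ≡ q + d → Candidate (chains N) d E
    codouble-candidate {p} {q} {r} t e with progression-candidate (mirror c)
      (subst (λ s → Triples.Triple (mirror c) (d - p) s (d - r))
        (linear (x₀ ⊕ x₀ ≡′ x₁ ⊕ x₂ ⇒′ x₂ ⊖ x₁ ≡′ x₂ ⊖ x₀ ⊕ (x₂ ⊖ x₀)) refl (p ∷ q ∷ d ∷ []) e)
        (mirror-triple c t))
    ... | inj₁ cand = candidate-⊆ (λ l∈ → ∈P.∈-++⁺ˡ (∈P.∈-++⁺ʳ (progressions N) l∈)) (candidate-mirror cand)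
    ... | inj₂ s = sevenths-candidate (mirror-sevenths s)

    triple-candidate : ∀ {u v w} → Triple u v w → Candidate (chains N) d E
    triple-candidate t with sort t
    ... | u , v , w , s , l , l′ with doubling s l l′
    ...   | inj₁ e = double-candidate s e
    ...   | inj₂ (inj₁ e) = double-candidate (swap₂₃ s) e
    ...   | inj₂ (inj₂ (inj₁ e)) = double-candidate (swap₂₃ (swap₁₂ s)) e
    ...   | inj₂ (inj₂ (inj₂ (inj₁ e))) = codouble-candidate (swap₁₂ s) e
    ...   | inj₂ (inj₂ (inj₂ (inj₂ (inj₁ e)))) = codouble-candidate (swap₁₂ (swap₂₃ s)) e
    ...   | inj₂ (inj₂ (inj₂ (inj₂ (inj₂ e)))) = codouble-candidate (swap₁₂ (swap₂₃ (swap₁₂ s))) e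

-- Two orbits, with or without the midpoint

module TwoOrbits where

  open LinearArithmetic
  open Configurations
  open Orbits
  open Progressions
  open import Data.Integer using (ℤ; +_; _+_; _-_; _≤_; 0ℤ)
  open import Data.Nat as ℕ using (ℕ)

  third-orbit : ∀ {n} → Expr n → Expr n → Expr n → Expr n → Formula n
  third-orbit d u v z = interior d z ∧′ apart d u z ∧′ apart d v z

  pair : ∀ {n} → Expr n → Expr n → Expr n → Formula n
  pair d u v = interior d u ∧′ interior d v ∧′ apart d u v

  within : ∀ {n} → Expr n → Expr n → Formula n
  within d z = con 0ℤ ≤′ z ∧′ z ≤′ d

  -- Here 8e = d. One orbit lies at the quarters 2e, 6e; the other is {e, 7e} or {3e, 5e}.
  eighths : ℤ → List (List ℤ)
  eighths e = extensions (times 4 e ∷ []) (times 2 e ∷ times 6 e ∷ e ∷ times 7 e ∷ []) ++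
    extensions (times 4 e ∷ []) (times 2 e ∷ times 6 e ∷ times 3 e ∷ times 5 e ∷ [])

  -- With 2h = d, the optional points are the orbits of x and of h - x.
  around : ℤ → ℤ → ℤ → List (List ℤ)
  around d h x = extensions (h ∷ []) (x ∷ d - x ∷ h - x ∷ h + x ∷ [])

  centrals : ℕ → List (List ℤ)
  centrals N = concatMap (λ h → concatMap (around (+ N) h) (ints (N ℕ./ 4))) (quotients 2 N) ++ concatMap eighths (quotients 8 N)

  oneSided : ℤ → ℤ → ℤ → List (List ℤ)
  oneSided d x y = (x ∷ d - x ∷ y ∷ []) ∷ (x ∷ d - x ∷ d - y ∷ []) ∷ []

  twoSided : ℤ → ℤ → ℤ → List (List ℤ)
  twoSided d x y = (x ∷ d - x ∷ y ∷ d - y ∷ []) ∷ oneSided d x y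

  -- For the pair (2t, t) only `oneSided` is listed, as the set with both orbits full already occurs
  -- under (t, 2t). In the last entry 3x = d and t is free.
  laterals₁ : ℕ → ℤ → List (List ℤ)
  laterals₁ N t = twoSided (+ N) t (t + t) ++ oneSided (+ N) (t + t) t ++ twoSided (+ N) t (t + t + t - + N) ++
    concatMap (λ x → twoSided (+ N) x t) (quotients 3 N)

  laterals : ℕ → List (List ℤ)
  laterals N = concatMap (laterals₁ N) (ints (N ℕ./ 2))

  module Pairs {N E} (c : Config (+ N) E 7) where
    open Config c

    private
      d : ℤ
      d = + N

    Pair : ℤ → ℤ → Set
    Pair u v = (u ∈ E × v ∈ E) × ⟦ pair x₂ x₀ x₁ ⟧ (u ∷ v ∷ d ∷ [])

    swap : ∀ {u v} → Pair u v → Pair v u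
    swap {u} {v} ((u∈ , v∈) , h) = (v∈ , u∈) , linear (pair x₂ x₀ x₁ ⇒′ pair x₂ x₁ x₀) refl (u ∷ v ∷ d ∷ []) h

    OnlyOrbits : ℤ → ℤ → Set
    OnlyOrbits u v = ∀ {z} → z ∈ E → ¬ ⟦ third-orbit x₃ x₁ x₂ x₀ ⟧ (z ∷ u ∷ v ∷ d ∷ [])

    swap-only : ∀ {u v} → OnlyOrbits u v → OnlyOrbits v u
    swap-only only z∈ (h , a , b) = only z∈ (h , b , a)

    -- Two orbits and the midpoint

    module Central {h} (h∈ : h ∈ E) (2h≡d : times 2 h ≡ d) where

      -- For points between 0 and d: v is the distance from u to h, or the mirror image of that
      -- distance.
      rectangular : ∀ {n} → Expr n → Expr n → Expr n → Formula n
      rectangular h u v = v ≡any (h ⊕ u ∷ u ⊖ h ∷ h ⊖ u ∷ 3 ×′ h ⊖ u ∷ [])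

      central : ∀ {n} → Expr n → Expr n → Expr n → Expr n → Formula n
      central d h u v =
        4 ×′ u ≡′ d ∨′ 4 ×′ u ≡′ 3 ×′ d ∨′ 4 ×′ v ≡′ d ∨′ 4 ×′ v ≡′ 3 ×′ d ∨′
        rectangular h u v

      -- The two orbits, d and h are six differences; two further distances `e` and `f` make eight,
      -- one too many. `φ` records the order of the points, which determines the signs in `e` and
      -- `f`.
      from-distances : ∀ {u v} → Pair u v → (e f : Expr 4) (φ ψ : Formula 4) →
        valid (pair x₃ x₀ x₁ ⇒′ 2 ×′ x₂ ≡′ x₃ ⇒′ φ ⇒′ coincidence (e ∷ f ∷ x₂ ∷ x₃ ∷ orbits x₃ (x₀ ∷ x₁ ∷ [])) ⇒′ ψ) ≡ true →
        let ρ = u ∷ v ∷ h ∷ d ∷ [] in ⟦ φ ⟧ ρ → Gap E (⟦ e ⟧ₑ ρ) → Gap E (⟦ f ⟧ₑ ρ) → ⟦ ψ ⟧ ρ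
      from-distances {u} {v} ((u∈ , v∈) , q@((0u , ud , _) , (0v , vd , _) , _)) e f φ ψ ok r ge gf =
        linear (pair x₃ x₀ x₁ ⇒′ 2 ×′ x₂ ≡′ x₃ ⇒′ φ ⇒′ coincidence es ⇒′ ψ) ok (u ∷ v ∷ h ∷ d ∷ []) q 2h≡d r
          (coincide c es (u ∷ v ∷ h ∷ d ∷ [])
            (ge ∷ gf ∷ gap₀ 0∈ h∈ (linear (2 ×′ x₀ ≡′ x₁ ⇒′ con 0ℤ <′ x₁ ⇒′ con 0ℤ <′ x₀) refl (h ∷ d ∷ []) 2h≡d 0≺d) ∷ gap₀ 0∈ d∈ 0≺d ∷
              gap₀ 0∈ u∈ 0u ∷ gap d∈ u∈ ud ∷ gap₀ 0∈ v∈ 0v ∷ gap d∈ v∈ vd ∷ []) ℕP.≤-refl)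
        where
        es : List (Expr 4)
        es = e ∷ f ∷ x₂ ∷ x₃ ∷ orbits x₃ (x₀ ∷ x₁ ∷ [])

      h≢ : ∀ {u} → u + u ≢ d → u ≢ h
      h≢ {u} n e = linear (2 ×′ x₀ ≡′ x₁ ⇒′ ¬′ (x₂ ⊕ x₂ ≡′ x₁) ⇒′ ¬′ (x₂ ≡′ x₀)) refl (h ∷ d ∷ u ∷ []) 2h≡d n e

      central-relation : ∀ {u v} → Pair u v → ⟦ central x₃ x₂ x₀ x₁ ⟧ (u ∷ v ∷ h ∷ d ∷ [])
      central-relation {u} {v} p@((u∈ , v∈) , (_ , _ , 2u) , (_ , _ , 2v) , _) with compare u h | compare v h
      ... | inj₂ (inj₁ e) | _ = ⊥-elim (h≢ 2u e)
      ... | _ | inj₂ (inj₁ e) = ⊥-elim (h≢ 2v e)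
      ... | inj₁ l | inj₁ l′ =
        from-distances p (x₂ ⊖ x₀) (x₂ ⊖ x₁) (x₀ <′ x₂ ∧′ x₁ <′ x₂) (central x₃ x₂ x₀ x₁) refl (l , l′) (gap h∈ u∈ l) (gap h∈ v∈ l′)
      ... | inj₁ l | inj₂ (inj₂ l′) =
        from-distances p (x₂ ⊖ x₀) (x₁ ⊖ x₂) (x₀ <′ x₂ ∧′ x₂ <′ x₁) (central x₃ x₂ x₀ x₁) refl (l , l′) (gap h∈ u∈ l) (gap v∈ h∈ l′)
      ... | inj₂ (inj₂ l) | inj₁ l′ =
        from-distances p (x₀ ⊖ x₂) (x₂ ⊖ x₁) (x₂ <′ x₀ ∧′ x₁ <′ x₂) (central x₃ x₂ x₀ x₁) refl (l , l′) (gap u∈ h∈ l) (gap h∈ v∈ l′)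
      ... | inj₂ (inj₂ l) | inj₂ (inj₂ l′) =
        from-distances p (x₀ ⊖ x₂) (x₁ ⊖ x₂) (x₂ <′ x₀ ∧′ x₂ <′ x₁) (central x₃ x₂ x₀ x₁) refl (l , l′) (gap u∈ h∈ l) (gap v∈ h∈ l′)

      around-candidate : ∀ {x} → 0ℤ ≺ x → times 4 x ≤ d →
        (∀ {z} → z ∈ E → 0ℤ ≺ z → z ≺ d → z ∈ h ∷ x ∷ d - x ∷ h - x ∷ h + x ∷ []) → Candidate (centrals N) d E
      around-candidate {x} 0x 4x cover = candidate-⊆
        (λ l∈ → ∈P.∈-++⁺ˡ (∈-concatMap (λ h → concatMap (around d h) (ints (N ℕ./ 4)))
          (∈-quotients 2 (linear (2 ×′ x₀ ≡′ x₁ ⇒′ con 0ℤ <′ x₁ ⇒′ con 0ℤ ≤′ x₀) refl (h ∷ d ∷ []) 2h≡d 0≺d) 2h≡d)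
          (∈-concatMap (around d h) (∈-ints 4 0x 4x) l∈)))
        (covered-extension (h ∷ []) (x ∷ d - x ∷ h - x ∷ h + x ∷ []) (h∈ ∷ []) cover)

      rectangle : ∀ {n} → Expr n → Expr n → Expr n → List (Expr n)
      rectangle d h x = h ∷ x ∷ d ⊖ x ∷ h ⊖ x ∷ h ⊕ x ∷ []

      rectangle-cover : ∀ {u v} → OnlyOrbits u v → (φ : Formula 5) (x : Expr 5) →
        valid (con 0ℤ <′ x₀ ⇒′ x₀ <′ x₄ ⇒′ 2 ×′ x₃ ≡′ x₄ ⇒′ rectangular x₃ x₁ x₂ ⇒′ ¬′ third-orbit x₄ x₁ x₂ x₀ ⇒′ φ ⇒′ x₀ ≡any rectangle x₄ x₃ x) ≡ true →
        ⟦ rectangular x₂ x₀ x₁ ⟧ (u ∷ v ∷ h ∷ d ∷ []) → ∀ {z} → ⟦ φ ⟧ (z ∷ u ∷ v ∷ h ∷ d ∷ []) → z ∈ E → 0ℤ ≺ z → z ≺ d →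
        z ∈ map (λ e → ⟦ e ⟧ₑ (z ∷ u ∷ v ∷ h ∷ d ∷ [])) (rectangle x₄ x₃ x)
      rectangle-cover {u} {v} only φ x ok s {z} r z∈ 0z zd = any⇒∈ x₀ (rectangle x₄ x₃ x) (z ∷ u ∷ v ∷ h ∷ d ∷ [])
        (linear (con 0ℤ <′ x₀ ⇒′ x₀ <′ x₄ ⇒′ 2 ×′ x₃ ≡′ x₄ ⇒′ rectangular x₃ x₁ x₂ ⇒′ ¬′ third-orbit x₄ x₁ x₂ x₀ ⇒′ φ ⇒′ x₀ ≡any rectangle x₄ x₃ x)
          ok (z ∷ u ∷ v ∷ h ∷ d ∷ []) 0z zd 2h≡d s (only z∈) r)

      -- The points x, h - x, h + x, d - x are named by the smallest of them, which is at most d/4.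
      -- The quarter of [0, d] that contains u decides whether it is u, h - u, u - h or d - u.
      rectangle-candidate : ∀ {u v} → Pair u v → OnlyOrbits u v →
        ⟦ rectangular x₂ x₀ x₁ ⟧ (u ∷ v ∷ h ∷ d ∷ []) → Candidate (centrals N) d E
      rectangle-candidate {u} {v} p@((u∈ , v∈) , q) only s with linear
        (4 ×′ x₀ ≤′ x₁ ∨′ x₁ <′ 4 ×′ x₀ ∧′ x₀ ⊕ x₀ <′ x₁ ∨′ x₁ ≡′ x₀ ⊕ x₀ ∨′ x₁ <′ x₀ ⊕ x₀ ∧′ 4 ×′ x₀ ≤′ 3 ×′ x₁ ∨′ 3 ×′ x₁ <′ 4 ×′ x₀)
        refl (u ∷ d ∷ [])
      ... | inj₁ r = around-candidate
        (linear (pair x₃ x₀ x₁ ⇒′ con 0ℤ <′ x₀) refl (u ∷ v ∷ h ∷ d ∷ []) q) r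
        (rectangle-cover only (4 ×′ x₁ ≤′ x₄) x₁ refl s r)
      ... | inj₂ (inj₁ (r , r′)) = around-candidate
        (linear (x₀ ⊕ x₀ <′ x₃ ⇒′ 2 ×′ x₂ ≡′ x₃ ⇒′ con 0ℤ <′ x₂ ⊖ x₀) refl (u ∷ v ∷ h ∷ d ∷ []) r′ 2h≡d)
        (linear (x₃ <′ 4 ×′ x₀ ⇒′ 2 ×′ x₂ ≡′ x₃ ⇒′ 4 ×′ (x₂ ⊖ x₀) ≤′ x₃) refl (u ∷ v ∷ h ∷ d ∷ []) r 2h≡d)
        (rectangle-cover only (x₁ ⊕ x₁ <′ x₄) (x₃ ⊖ x₁) refl s r′)
      ... | inj₂ (inj₂ (inj₁ r)) = ⊥-elim (linear (pair x₂ x₀ x₁ ⇒′ ¬′ (x₂ ≡′ x₀ ⊕ x₀)) refl (u ∷ v ∷ d ∷ []) q r)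
      ... | inj₂ (inj₂ (inj₂ (inj₁ (r , r′)))) = around-candidate
        (linear (x₃ <′ x₀ ⊕ x₀ ⇒′ 2 ×′ x₂ ≡′ x₃ ⇒′ con 0ℤ <′ x₀ ⊖ x₂) refl (u ∷ v ∷ h ∷ d ∷ []) r 2h≡d)
        (linear (4 ×′ x₀ ≤′ 3 ×′ x₃ ⇒′ 2 ×′ x₂ ≡′ x₃ ⇒′ 4 ×′ (x₀ ⊖ x₂) ≤′ x₃) refl (u ∷ v ∷ h ∷ d ∷ []) r′ 2h≡d)
        (rectangle-cover only (x₄ <′ x₁ ⊕ x₁) (x₁ ⊖ x₃) refl s r)
      ... | inj₂ (inj₂ (inj₂ (inj₂ r))) = around-candidate
        (linear (pair x₃ x₀ x₁ ⇒′ con 0ℤ <′ x₃ ⊖ x₀) refl (u ∷ v ∷ h ∷ d ∷ []) q)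
        (linear (3 ×′ x₃ <′ 4 ×′ x₀ ⇒′ 4 ×′ (x₃ ⊖ x₀) ≤′ x₃) refl (u ∷ v ∷ h ∷ d ∷ []) r)
        (rectangle-cover only (3 ×′ x₄ <′ 4 ×′ x₁) (x₄ ⊖ x₁) refl s r)

      eighth : ∀ {n} → Expr n → Expr n → Formula n
      eighth d v = 8 ×′ v ≡′ d ∨′ 8 ×′ v ≡′ 3 ×′ d ∨′ 8 ×′ v ≡′ 5 ×′ d ∨′ 8 ×′ v ≡′ 7 ×′ d

      quarter : ∀ {n} → Expr n → Expr n → Formula n
      quarter d u = 4 ×′ u ≡′ d ∨′ 4 ×′ u ≡′ 3 ×′ d

      -- For u at a quarter the distance from u to h is itself u or d - u and yields no relation;
      -- the distances from v to u and to h are used instead.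
      eighth-relation : ∀ {u v} → Pair u v → ⟦ quarter x₁ x₀ ⟧ (u ∷ d ∷ []) → ⟦ eighth x₁ x₀ ⟧ (v ∷ d ∷ [])
      eighth-relation {u} {v} p@((u∈ , v∈) , (_ , _ , 2u) , (_ , _ , 2v) , (u≢v , _)) s with compare u v | compare v h
      ... | inj₂ (inj₁ e) | _ = ⊥-elim (u≢v e)
      ... | _ | inj₂ (inj₁ e) = ⊥-elim (h≢ 2v e)
      ... | inj₁ l | inj₁ l′ =
        from-distances p (x₁ ⊖ x₀) (x₂ ⊖ x₁) (quarter x₃ x₀ ∧′ x₀ <′ x₁ ∧′ x₁ <′ x₂) (eighth x₃ x₁) refl (s , l , l′) (gap v∈ u∈ l) (gap h∈ v∈ l′)
      ... | inj₁ l | inj₂ (inj₂ l′) =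
        from-distances p (x₁ ⊖ x₀) (x₁ ⊖ x₂) (quarter x₃ x₀ ∧′ x₀ <′ x₁ ∧′ x₂ <′ x₁) (eighth x₃ x₁) refl (s , l , l′) (gap v∈ u∈ l) (gap v∈ h∈ l′)
      ... | inj₂ (inj₂ l) | inj₁ l′ =
        from-distances p (x₀ ⊖ x₁) (x₂ ⊖ x₁) (quarter x₃ x₀ ∧′ x₁ <′ x₀ ∧′ x₁ <′ x₂) (eighth x₃ x₁) refl (s , l , l′) (gap u∈ v∈ l) (gap h∈ v∈ l′)
      ... | inj₂ (inj₂ l) | inj₂ (inj₂ l′) =
        from-distances p (x₀ ⊖ x₁) (x₁ ⊖ x₂) (quarter x₃ x₀ ∧′ x₁ <′ x₀ ∧′ x₂ <′ x₁) (eighth x₃ x₁) refl (s , l , l′) (gap u∈ v∈ l) (gap v∈ h∈ l′)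

      eighths-candidate : ∀ {e} → 0ℤ ≤ e → times 8 e ≡ d → Candidate (eighths e) d E → Candidate (centrals N) d E
      eighths-candidate 0≤e 8e = candidate-⊆
        (λ l∈ → ∈P.∈-++⁺ʳ (concatMap (λ h → concatMap (around d h) (ints (N ℕ./ 4))) (quotients 2 N))
          (∈-concatMap eighths (∈-quotients 8 0≤e 8e) l∈))

      at-centre : ∀ {e} → times 8 e ≡ d → times 4 e ∈ E
      at-centre {e} 8e = subst (_∈ E) (linear (8 ×′ x₀ ≡′ x₂ ⇒′ 2 ×′ x₁ ≡′ x₂ ⇒′ x₁ ≡′ 4 ×′ x₀) refl (e ∷ h ∷ d ∷ []) 8e 2h≡d) h∈

      outer inner : ∀ {n} → Expr n → List (Expr n)
      outer e = 4 ×′ e ∷ 2 ×′ e ∷ 6 ×′ e ∷ e ∷ 7 ×′ e ∷ []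
      inner e = 4 ×′ e ∷ 2 ×′ e ∷ 6 ×′ e ∷ 3 ×′ e ∷ 5 ×′ e ∷ []

      outer-candidate : ∀ {e} → 0ℤ ≤ e → times 8 e ≡ d →
        (∀ {z} → z ∈ E → 0ℤ ≺ z → z ≺ d → z ∈ map (λ x → ⟦ x ⟧ₑ (e ∷ [])) (outer x₀)) → Candidate (centrals N) d E
      outer-candidate {e} 0≤e 8e cover = eighths-candidate 0≤e 8e (candidate-⊆ ∈P.∈-++⁺ˡ
        (covered-extension (times 4 e ∷ []) (times 2 e ∷ times 6 e ∷ e ∷ times 7 e ∷ []) (at-centre {e} 8e ∷ []) cover))

      inner-candidate : ∀ {e} → 0ℤ ≤ e → times 8 e ≡ d →
        (∀ {z} → z ∈ E → 0ℤ ≺ z → z ≺ d → z ∈ map (λ x → ⟦ x ⟧ₑ (e ∷ [])) (inner x₀)) → Candidate (centrals N) d E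
      inner-candidate {e} 0≤e 8e cover = eighths-candidate 0≤e 8e (candidate-⊆
        (∈P.∈-++⁺ʳ (extensions (times 4 e ∷ []) (times 2 e ∷ times 6 e ∷ e ∷ times 7 e ∷ [])))
        (covered-extension (times 4 e ∷ []) (times 2 e ∷ times 6 e ∷ times 3 e ∷ times 5 e ∷ []) (at-centre {e} 8e ∷ []) cover))

      quarter-candidate : ∀ {u v} → Pair u v → OnlyOrbits u v → ⟦ quarter x₁ x₀ ⟧ (u ∷ d ∷ []) → Candidate (centrals N) d E
      quarter-candidate {u} {v} p@(_ , q) only s with eighth-relation p s
      ... | inj₁ r = outer-candidate
        (linear (8 ×′ x₀ ≡′ x₁ ⇒′ con 0ℤ <′ x₁ ⇒′ con 0ℤ ≤′ x₀) refl (v ∷ d ∷ []) r 0≺d) r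
        λ {z} z∈ 0z zd → any⇒∈ x₀ (outer x₂) (z ∷ u ∷ v ∷ d ∷ []) (linear
          (con 0ℤ <′ x₀ ⇒′ x₀ <′ x₃ ⇒′ quarter x₃ x₁ ⇒′ 8 ×′ x₂ ≡′ x₃ ⇒′ ¬′ third-orbit x₃ x₁ x₂ x₀ ⇒′ x₀ ≡any outer x₂)
          refl (z ∷ u ∷ v ∷ d ∷ []) 0z zd s r (only z∈))
      ... | inj₂ (inj₁ r) = inner-candidate
        (linear (8 ×′ x₀ ≡′ 3 ×′ x₁ ⇒′ con 0ℤ <′ x₁ ⇒′ 2 ×′ x₂ ≡′ x₁ ⇒′ con 0ℤ ≤′ x₂ ⊖ x₀) refl (v ∷ d ∷ h ∷ []) r 0≺d 2h≡d)
        (linear (8 ×′ x₀ ≡′ 3 ×′ x₁ ⇒′ 2 ×′ x₂ ≡′ x₁ ⇒′ 8 ×′ (x₂ ⊖ x₀) ≡′ x₁) refl (v ∷ d ∷ h ∷ []) r 2h≡d)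
        λ {z} z∈ 0z zd → any⇒∈ x₀ (inner (x₄ ⊖ x₂)) (z ∷ u ∷ v ∷ d ∷ h ∷ []) (linear
          (con 0ℤ <′ x₀ ⇒′ x₀ <′ x₃ ⇒′ quarter x₃ x₁ ⇒′ 8 ×′ x₂ ≡′ 3 ×′ x₃ ⇒′ 2 ×′ x₄ ≡′ x₃ ⇒′ ¬′ third-orbit x₃ x₁ x₂ x₀ ⇒′ x₀ ≡any inner (x₄ ⊖ x₂))
          refl (z ∷ u ∷ v ∷ d ∷ h ∷ []) 0z zd s r 2h≡d (only z∈))
      ... | inj₂ (inj₂ (inj₁ r)) = inner-candidate
        (linear (8 ×′ x₀ ≡′ 5 ×′ x₁ ⇒′ con 0ℤ <′ x₁ ⇒′ 2 ×′ x₂ ≡′ x₁ ⇒′ con 0ℤ ≤′ x₀ ⊖ x₂) refl (v ∷ d ∷ h ∷ []) r 0≺d 2h≡d)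
        (linear (8 ×′ x₀ ≡′ 5 ×′ x₁ ⇒′ 2 ×′ x₂ ≡′ x₁ ⇒′ 8 ×′ (x₀ ⊖ x₂) ≡′ x₁) refl (v ∷ d ∷ h ∷ []) r 2h≡d)
        λ {z} z∈ 0z zd → any⇒∈ x₀ (inner (x₂ ⊖ x₄)) (z ∷ u ∷ v ∷ d ∷ h ∷ []) (linear
          (con 0ℤ <′ x₀ ⇒′ x₀ <′ x₃ ⇒′ quarter x₃ x₁ ⇒′ 8 ×′ x₂ ≡′ 5 ×′ x₃ ⇒′ 2 ×′ x₄ ≡′ x₃ ⇒′ ¬′ third-orbit x₃ x₁ x₂ x₀ ⇒′ x₀ ≡any inner (x₂ ⊖ x₄))
          refl (z ∷ u ∷ v ∷ d ∷ h ∷ []) 0z zd s r 2h≡d (only z∈))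
      ... | inj₂ (inj₂ (inj₂ r)) = outer-candidate
        (linear (8 ×′ x₀ ≡′ 7 ×′ x₁ ⇒′ con 0ℤ <′ x₁ ⇒′ con 0ℤ ≤′ x₁ ⊖ x₀) refl (v ∷ d ∷ []) r 0≺d)
        (linear (8 ×′ x₀ ≡′ 7 ×′ x₁ ⇒′ 8 ×′ (x₁ ⊖ x₀) ≡′ x₁) refl (v ∷ d ∷ []) r)
        λ {z} z∈ 0z zd → any⇒∈ x₀ (outer (x₃ ⊖ x₂)) (z ∷ u ∷ v ∷ d ∷ []) (linear
          (con 0ℤ <′ x₀ ⇒′ x₀ <′ x₃ ⇒′ quarter x₃ x₁ ⇒′ 8 ×′ x₂ ≡′ 7 ×′ x₃ ⇒′ ¬′ third-orbit x₃ x₁ x₂ x₀ ⇒′ x₀ ≡any outer (x₃ ⊖ x₂))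
          refl (z ∷ u ∷ v ∷ d ∷ []) 0z zd s r (only z∈))

      central-candidate : ∀ {u v} → Pair u v → OnlyOrbits u v → Candidate (centrals N) d E
      central-candidate p only with central-relation p
      ... | inj₁ e = quarter-candidate p only (inj₁ e)
      ... | inj₂ (inj₁ e) = quarter-candidate p only (inj₂ e)
      ... | inj₂ (inj₂ (inj₁ e)) = quarter-candidate (swap p) (swap-only only) (inj₁ e)
      ... | inj₂ (inj₂ (inj₂ (inj₁ e))) = quarter-candidate (swap p) (swap-only only) (inj₂ e)
      ... | inj₂ (inj₂ (inj₂ (inj₂ s))) = rectangle-candidate p only s

    -- Two orbits without the midpoint

    two-sided-candidate : ∀ {x y} → x ∈ E → d - x ∈ E → y ∈ E → d - y ∈ E →
      (∀ {z} → z ∈ E → 0ℤ ≺ z → z ≺ d → z ∈ x ∷ d - x ∷ y ∷ d - y ∷ []) → Candidate (twoSided d x y) d E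
    two-sided-candidate x∈ x′∈ y∈ y′∈ cover = _ , here refl , All.lookup (x∈ ∷ x′∈ ∷ y∈ ∷ y′∈ ∷ []) , cover

    one-sided-candidate : ∀ {x y} → x ∈ E → d - x ∈ E → (y ∈ E × ¬ d - y ∈ E) ⊎ (d - y ∈ E × ¬ y ∈ E) →
      (∀ {z} → z ∈ E → 0ℤ ≺ z → z ≺ d → z ∈ x ∷ d - x ∷ y ∷ d - y ∷ []) → Candidate (oneSided d x y) d E
    one-sided-candidate {x} {y} x∈ x′∈ (inj₁ (y∈ , y′∉)) cover =
      _ , here refl , All.lookup (x∈ ∷ x′∈ ∷ y∈ ∷ []) , λ z∈ p q → drop z∈ (cover z∈ p q)
      where
      drop : ∀ {z} → z ∈ E → z ∈ x ∷ d - x ∷ y ∷ d - y ∷ [] → z ∈ x ∷ d - x ∷ y ∷ []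
      drop z∈ (here e) = here e
      drop z∈ (there (here e)) = there (here e)
      drop z∈ (there (there (here e))) = there (there (here e))
      drop z∈ (there (there (there (here refl)))) = ⊥-elim (y′∉ z∈)
    one-sided-candidate {x} {y} x∈ x′∈ (inj₂ (y′∈ , y∉)) cover =
      _ , there (here refl) , All.lookup (x∈ ∷ x′∈ ∷ y′∈ ∷ []) , λ z∈ p q → drop z∈ (cover z∈ p q)
      where
      drop : ∀ {z} → z ∈ E → z ∈ x ∷ d - x ∷ y ∷ d - y ∷ [] → z ∈ x ∷ d - x ∷ d - y ∷ []
      drop z∈ (here e) = here e
      drop z∈ (there (here e)) = there (here e)
      drop z∈ (there (there (here refl))) = ⊥-elim (y∉ z∈)
      drop z∈ (there (there (there (here e)))) = there (there (here e))

    sided-candidate : ∀ {x y} → x ∈ E → d - x ∈ E → y ∈ E ⊎ d - y ∈ E →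
      (∀ {z} → z ∈ E → 0ℤ ≺ z → z ≺ d → z ∈ x ∷ d - x ∷ y ∷ d - y ∷ []) →
      (y ∈ E × d - y ∈ E) ⊎ Candidate (oneSided d x y) d E
    sided-candidate {x} {y} x∈ x′∈ some-y cover with y ∈? E | (d - y) ∈? E | some-y
    ... | yes y∈ | yes y′∈ | _ = inj₁ (y∈ , y′∈)
    ... | yes y∈ | no y′∉ | _ = inj₂ (one-sided-candidate x∈ x′∈ (inj₁ (y∈ , y′∉)) cover)
    ... | no y∉ | yes y′∈ | _ = inj₂ (one-sided-candidate x∈ x′∈ (inj₂ (y′∈ , y∉)) cover)
    ... | no y∉ | no y′∉ | inj₁ y∈ = ⊥-elim (y∉ y∈)
    ... | no y∉ | no y′∉ | inj₂ y′∈ = ⊥-elim (y′∉ y′∈)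

    twoSided-candidate : ∀ {x y} → x ∈ E → d - x ∈ E → y ∈ E ⊎ d - y ∈ E →
      (∀ {z} → z ∈ E → 0ℤ ≺ z → z ≺ d → z ∈ x ∷ d - x ∷ y ∷ d - y ∷ []) → Candidate (twoSided d x y) d E
    twoSided-candidate x∈ x′∈ some-y cover with sided-candidate x∈ x′∈ some-y cover
    ... | inj₁ (y∈ , y′∈) = two-sided-candidate x∈ x′∈ y∈ y′∈ cover
    ... | inj₂ cand = candidate-⊆ there cand

    InLaterals : ℤ → Set
    InLaterals t = ∀ {L} → (∀ {l} → l ∈ L → l ∈ laterals₁ N t) → Candidate L d E → Candidate (laterals N) d E

    in-laterals : ∀ {t} → 0ℤ ≺ t → times 2 t ≤ d → InLaterals t
    in-laterals 0t 2t sub = candidate-⊆ λ l∈ → ∈-concatMap (laterals₁ N) (∈-ints 2 0t 2t) (sub l∈)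

    double-lateral : ∀ {t} → 0ℤ ≺ t → times 2 t ≤ d → t ∈ E → d - t ∈ E → (t + t) ∈ E ⊎ d - (t + t) ∈ E →
      (∀ {z} → z ∈ E → 0ℤ ≺ z → z ≺ d → z ∈ t ∷ d - t ∷ t + t ∷ d - (t + t) ∷ []) → Candidate (laterals N) d E
    double-lateral 0t 2t t∈ t′∈ some-y cover = in-laterals 0t 2t ∈P.∈-++⁺ˡ (twoSided-candidate t∈ t′∈ some-y cover)

    -- If both t and d - t occur, the set is found under the doubling of t; only the sets with one
    -- of them are listed for this case.
    half-lateral : ∀ {t} → 0ℤ ≺ t → times 2 t ≤ d → t + t ∈ E → d - (t + t) ∈ E → t ∈ E ⊎ d - t ∈ E →
      (∀ {z} → z ∈ E → 0ℤ ≺ z → z ≺ d → z ∈ t + t ∷ d - (t + t) ∷ t ∷ d - t ∷ []) → Candidate (laterals N) d E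
    half-lateral {t} 0t 2t x∈ x′∈ some-t cover with sided-candidate x∈ x′∈ some-t cover
    ... | inj₁ (t∈ , t′∈) = double-lateral 0t 2t t∈ t′∈ (inj₁ x∈) λ {z} z∈ p q → turn (cover z∈ p q)
      where
      turn : ∀ {z} → z ∈ t + t ∷ d - (t + t) ∷ t ∷ d - t ∷ [] → z ∈ t ∷ d - t ∷ t + t ∷ d - (t + t) ∷ []
      turn (here e) = there (there (here e))
      turn (there (here e)) = there (there (there (here e)))
      turn (there (there (here e))) = here e
      turn (there (there (there (here e)))) = there (here e)
    ... | inj₂ cand = in-laterals 0t 2t (λ l∈ → ∈P.∈-++⁺ʳ (twoSided d t (t + t)) (∈P.∈-++⁺ˡ l∈)) cand

    triple-lateral : ∀ {t} → 0ℤ ≺ t → times 2 t ≤ d → t ∈ E → d - t ∈ E → t + t + t - d ∈ E ⊎ d - (t + t + t - d) ∈ E →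
      (∀ {z} → z ∈ E → 0ℤ ≺ z → z ≺ d → z ∈ t ∷ d - t ∷ t + t + t - d ∷ d - (t + t + t - d) ∷ []) → Candidate (laterals N) d E
    triple-lateral {t} 0t 2t t∈ t′∈ some-y cover = in-laterals 0t 2t
      (λ l∈ → ∈P.∈-++⁺ʳ (twoSided d t (t + t)) (∈P.∈-++⁺ʳ (oneSided d (t + t) t) (∈P.∈-++⁺ˡ l∈)))
      (twoSided-candidate t∈ t′∈ some-y cover)

    third-lateral : ∀ {x t} → 0ℤ ≤ x → times 3 x ≡ d → 0ℤ ≺ t → times 2 t ≤ d → x ∈ E → d - x ∈ E → t ∈ E ⊎ d - t ∈ E →
      (∀ {z} → z ∈ E → 0ℤ ≺ z → z ≺ d → z ∈ x ∷ d - x ∷ t ∷ d - t ∷ []) → Candidate (laterals N) d E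
    third-lateral {x} {t} 0x 3x 0t 2t x∈ x′∈ some-t cover = in-laterals 0t 2t
      (λ l∈ → ∈P.∈-++⁺ʳ (twoSided d t (t + t)) (∈P.∈-++⁺ʳ (oneSided d (t + t) t) (∈P.∈-++⁺ʳ (twoSided d t (t + t + t - d))
        (∈-concatMap (λ x → twoSided d x t) (∈-quotients 3 0x 3x) l∈))))
      (twoSided-candidate x∈ x′∈ some-t cover)

    -- The coincidences among d, u, d - u, v, d - v, d - 2u and the distances from v to u and to d -
    -- u. The family with m = 8 is defined by excluding the same relations in `φ₈`.
    lateral : ∀ {n} → Expr n → Expr n → Expr n → Formula n
    lateral d u v =
      3 ×′ u ≡′ d ∨′ v ⊕ d ≡′ 3 ×′ u ∨′ v ⊕ 3 ×′ u ≡′ 2 ×′ d ∨′ v ≡′ u ⊕ u ∨′ v ⊕ 2 ×′ u ≡′ d ∨′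
      2 ×′ v ≡′ u ∨′ 2 ×′ v ⊕ u ≡′ 2 ×′ d ∨′ 2 ×′ v ≡′ d ⊕ u ∨′ 2 ×′ v ⊕ u ≡′ d

    from-gaps : ∀ {u v} → Pair u v → d - u ∈ E → u ≺ d - u → (e f : Expr 3) (φ : Formula 3) →
      valid (pair x₂ x₀ x₁ ⇒′ x₀ <′ x₂ ⊖ x₀ ⇒′ φ ⇒′ coincidence (e ∷ f ∷ x₂ ⊖ x₀ ⊖ x₀ ∷ x₂ ∷ orbits x₂ (x₀ ∷ x₁ ∷ [])) ⇒′ lateral x₂ x₀ x₁) ≡ true →
      let ρ = u ∷ v ∷ d ∷ [] in ⟦ φ ⟧ ρ → Gap E (⟦ e ⟧ₑ ρ) → Gap E (⟦ f ⟧ₑ ρ) → ⟦ lateral x₂ x₀ x₁ ⟧ ρ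
    from-gaps {u} {v} ((u∈ , v∈) , q@((0u , ud , _) , (0v , vd , _) , _)) u′∈ l e f φ ok r ge gf =
      linear (pair x₂ x₀ x₁ ⇒′ x₀ <′ x₂ ⊖ x₀ ⇒′ φ ⇒′ coincidence es ⇒′ lateral x₂ x₀ x₁) ok (u ∷ v ∷ d ∷ []) q l r
        (coincide c es (u ∷ v ∷ d ∷ []) (ge ∷ gf ∷ gap u′∈ u∈ l ∷ gap₀ 0∈ d∈ 0≺d ∷
          gap₀ 0∈ u∈ 0u ∷ gap d∈ u∈ ud ∷ gap₀ 0∈ v∈ 0v ∷ gap d∈ v∈ vd ∷ []) ℕP.≤-refl)
      where
      es : List (Expr 3)
      es = e ∷ f ∷ x₂ ⊖ x₀ ⊖ x₀ ∷ x₂ ∷ orbits x₂ (x₀ ∷ x₁ ∷ [])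

    lateral-relation : ∀ {u v} → Pair u v → d - u ∈ E → u ≺ d - u → ⟦ lateral x₂ x₀ x₁ ⟧ (u ∷ v ∷ d ∷ [])
    lateral-relation {u} {v} p@((u∈ , v∈) , _ , _ , (u≢v , u+v≢d)) u′∈ l with compare v u | compare v (d - u)
    ... | inj₂ (inj₁ e) | _ = ⊥-elim (u≢v (sym e))
    ... | _ | inj₂ (inj₁ e) = ⊥-elim (u+v≢d (linear (x₁ ≡′ x₂ ⊖ x₀ ⇒′ x₀ ⊕ x₁ ≡′ x₂) refl (u ∷ v ∷ d ∷ []) e))
    ... | inj₁ k | inj₁ k′ = from-gaps p u′∈ l (x₀ ⊖ x₁) (x₂ ⊖ x₀ ⊖ x₁) (x₁ <′ x₀) refl k (gap u∈ v∈ k) (gap u′∈ v∈ k′)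
    ... | inj₁ k | inj₂ (inj₂ k′) = ⊥-elim (linear (x₁ <′ x₀ ⇒′ x₀ <′ x₂ ⊖ x₀ ⇒′ ¬′ (x₂ ⊖ x₀ <′ x₁)) refl (u ∷ v ∷ d ∷ []) k l k′)
    ... | inj₂ (inj₂ k) | inj₁ k′ =
      from-gaps p u′∈ l (x₁ ⊖ x₀) (x₂ ⊖ x₀ ⊖ x₁) (x₀ <′ x₁ ∧′ x₁ <′ x₂ ⊖ x₀) refl (k , k′) (gap v∈ u∈ k) (gap u′∈ v∈ k′)
    ... | inj₂ (inj₂ k) | inj₂ (inj₂ k′) =
      from-gaps p u′∈ l (x₁ ⊖ x₀) (x₁ ⊖ (x₂ ⊖ x₀)) (x₂ ⊖ x₀ <′ x₁) refl k′ (gap v∈ u∈ k) (gap v∈ u′∈ k′)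

    module Lateral (no-half : ∀ {z} → z ∈ E → ¬ times 2 z ≡ d) where

      square : ∀ {n} → Expr n → Expr n → Expr n → List (Expr n)
      square d x y = x ∷ d ⊖ x ∷ y ∷ d ⊖ y ∷ []

      move : ∀ {a b} → a ∈ E → b ≡ a → b ∈ E
      move a∈ refl = a∈

      cover : ∀ {u v} → OnlyOrbits u v → (φ : Formula 4) → (x y : Expr 4) →
        valid (con 0ℤ <′ x₀ ⇒′ x₀ <′ x₃ ⇒′ ¬′ third-orbit x₃ x₁ x₂ x₀ ⇒′ ¬′ (2 ×′ x₀ ≡′ x₃) ⇒′ φ ⇒′ x₀ ≡any square x₃ x y) ≡ true →
        ∀ {z} → ⟦ φ ⟧ (z ∷ u ∷ v ∷ d ∷ []) → z ∈ E → 0ℤ ≺ z → z ≺ d →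
        z ∈ map (λ e → ⟦ e ⟧ₑ (z ∷ u ∷ v ∷ d ∷ [])) (square x₃ x y)
      cover {u} {v} only φ x y ok {z} h z∈ 0z zd = any⇒∈ x₀ (square x₃ x y) (z ∷ u ∷ v ∷ d ∷ [])
        (linear (con 0ℤ <′ x₀ ⇒′ x₀ <′ x₃ ⇒′ ¬′ third-orbit x₃ x₁ x₂ x₀ ⇒′ ¬′ (2 ×′ x₀ ≡′ x₃) ⇒′ φ ⇒′ x₀ ≡any square x₃ x y)
          ok (z ∷ u ∷ v ∷ d ∷ []) 0z zd (only z∈) (no-half z∈) h)

      below-half : ∀ {u} → u ≺ d - u → times 2 u ≤ d
      below-half {u} l = linear (x₀ <′ x₁ ⊖ x₀ ⇒′ 2 ×′ x₀ ≤′ x₁) refl (u ∷ d ∷ []) l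

      third-case : ∀ {u v} → Pair u v → OnlyOrbits u v → d - u ∈ E → times 3 u ≡ d → Candidate (laterals N) d E
      third-case {u} {v} ((u∈ , v∈) , q@((0u , _) , _)) only u′∈ e with linear (2 ×′ x₀ ≤′ x₁ ∨′ 2 ×′ (x₁ ⊖ x₀) ≤′ x₁) refl (v ∷ d ∷ [])
      ... | inj₁ 2v = third-lateral (linear (con 0ℤ <′ x₀ ⇒′ con 0ℤ ≤′ x₀) refl (u ∷ []) 0u) e
        (linear (interior x₁ x₀ ⇒′ con 0ℤ <′ x₀) refl (v ∷ d ∷ []) (proj₁ (proj₂ q))) 2v u∈ u′∈ (inj₁ v∈)
        (cover only (3 ×′ x₁ ≡′ x₃) x₁ x₂ refl e)
      ... | inj₂ 2v = third-lateral (linear (con 0ℤ <′ x₀ ⇒′ con 0ℤ ≤′ x₀) refl (u ∷ []) 0u) e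
        (linear (interior x₁ x₀ ⇒′ con 0ℤ <′ x₁ ⊖ x₀) refl (v ∷ d ∷ []) (proj₁ (proj₂ q))) 2v u∈ u′∈
        (inj₂ (move v∈ (d-[d-z] d v)))
        (cover only (3 ×′ x₁ ≡′ x₃) x₁ (x₃ ⊖ x₂) refl e)

      -- The nine relations form four groups: 3u = d; v or d - v is 3u - d; v or d - v is 2u; twice
      -- v or twice d - v is u or d - u.
      lateral-candidate′ : ∀ {u v} → Pair u v → OnlyOrbits u v → d - u ∈ E → u ≺ d - u → Candidate (laterals N) d E
      lateral-candidate′ {u} {v} p@((u∈ , v∈) , q@((0u , _) , _)) only u′∈ l with lateral-relation p u′∈ l
      ... | inj₁ e = third-case p only u′∈ e
      ... | inj₂ (inj₁ e) =
        triple-lateral 0u (below-half {u} l) u∈ u′∈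
          (inj₁ (move v∈ (linear (x₁ ⊕ x₂ ≡′ 3 ×′ x₀ ⇒′ x₀ ⊕ x₀ ⊕ x₀ ⊖ x₂ ≡′ x₁) refl (u ∷ v ∷ d ∷ []) e)))
          (cover only (x₂ ⊕ x₃ ≡′ 3 ×′ x₁) x₁ (x₁ ⊕ x₁ ⊕ x₁ ⊖ x₃) refl e)
      ... | inj₂ (inj₂ (inj₁ e)) =
        triple-lateral 0u (below-half {u} l) u∈ u′∈
          (inj₂ (move v∈ (linear (x₁ ⊕ 3 ×′ x₀ ≡′ 2 ×′ x₂ ⇒′ x₂ ⊖ (x₀ ⊕ x₀ ⊕ x₀ ⊖ x₂) ≡′ x₁) refl (u ∷ v ∷ d ∷ []) e)))
          (cover only (x₂ ⊕ 3 ×′ x₁ ≡′ 2 ×′ x₃) x₁ (x₁ ⊕ x₁ ⊕ x₁ ⊖ x₃) refl e)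
      ... | inj₂ (inj₂ (inj₂ (inj₁ e))) =
        double-lateral 0u (below-half {u} l) u∈ u′∈
          (inj₁ (move v∈ (sym e)))
          (cover only (x₂ ≡′ x₁ ⊕ x₁) x₁ (x₁ ⊕ x₁) refl e)
      ... | inj₂ (inj₂ (inj₂ (inj₂ (inj₁ e)))) =
        double-lateral 0u (below-half {u} l) u∈ u′∈
          (inj₂ (move v∈ (linear (x₁ ⊕ 2 ×′ x₀ ≡′ x₂ ⇒′ x₂ ⊖ (x₀ ⊕ x₀) ≡′ x₁) refl (u ∷ v ∷ d ∷ []) e)))
          (cover only (x₂ ⊕ 2 ×′ x₁ ≡′ x₃) x₁ (x₁ ⊕ x₁) refl e)
      ... | inj₂ (inj₂ (inj₂ (inj₂ (inj₂ (inj₁ e))))) =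
        half-lateral (linear (2 ×′ x₁ ≡′ x₀ ⇒′ con 0ℤ <′ x₀ ⇒′ con 0ℤ <′ x₁) refl (u ∷ v ∷ []) e 0u)
          (linear (2 ×′ x₁ ≡′ x₀ ⇒′ interior x₂ x₀ ⇒′ 2 ×′ x₁ ≤′ x₂) refl (u ∷ v ∷ d ∷ []) e (proj₁ q))
          (move u∈ (linear (2 ×′ x₁ ≡′ x₀ ⇒′ x₁ ⊕ x₁ ≡′ x₀) refl (u ∷ v ∷ []) e))
          (move u′∈ (linear (2 ×′ x₁ ≡′ x₀ ⇒′ x₂ ⊖ (x₁ ⊕ x₁) ≡′ x₂ ⊖ x₀) refl (u ∷ v ∷ d ∷ []) e))
          (inj₁ v∈)
          (cover only (2 ×′ x₂ ≡′ x₁) (x₂ ⊕ x₂) x₂ refl e)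
      ... | inj₂ (inj₂ (inj₂ (inj₂ (inj₂ (inj₂ (inj₁ e)))))) =
        half-lateral {d - v} (linear (interior x₁ x₀ ⇒′ con 0ℤ <′ x₁ ⊖ x₀) refl (v ∷ d ∷ []) (proj₁ (proj₂ q)))
          (linear (2 ×′ x₁ ⊕ x₀ ≡′ 2 ×′ x₂ ⇒′ interior x₂ x₀ ⇒′ 2 ×′ (x₂ ⊖ x₁) ≤′ x₂) refl (u ∷ v ∷ d ∷ []) e (proj₁ q))
          (move u∈ (linear (2 ×′ x₁ ⊕ x₀ ≡′ 2 ×′ x₂ ⇒′ x₂ ⊖ x₁ ⊕ (x₂ ⊖ x₁) ≡′ x₀) refl (u ∷ v ∷ d ∷ []) e))
          (move u′∈ (linear (2 ×′ x₁ ⊕ x₀ ≡′ 2 ×′ x₂ ⇒′ x₂ ⊖ (x₂ ⊖ x₁ ⊕ (x₂ ⊖ x₁)) ≡′ x₂ ⊖ x₀) refl (u ∷ v ∷ d ∷ []) e))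
          (inj₂ (move v∈ (d-[d-z] d v)))
          (cover only (2 ×′ x₂ ⊕ x₁ ≡′ 2 ×′ x₃) (x₃ ⊖ x₂ ⊕ (x₃ ⊖ x₂)) (x₃ ⊖ x₂) refl e)
      ... | inj₂ (inj₂ (inj₂ (inj₂ (inj₂ (inj₂ (inj₂ (inj₁ e))))))) =
        half-lateral {d - v} (linear (interior x₁ x₀ ⇒′ con 0ℤ <′ x₁ ⊖ x₀) refl (v ∷ d ∷ []) (proj₁ (proj₂ q)))
          (linear (2 ×′ x₁ ≡′ x₂ ⊕ x₀ ⇒′ interior x₂ x₀ ⇒′ 2 ×′ (x₂ ⊖ x₁) ≤′ x₂) refl (u ∷ v ∷ d ∷ []) e (proj₁ q))
          (move u′∈ (linear (2 ×′ x₁ ≡′ x₂ ⊕ x₀ ⇒′ x₂ ⊖ x₁ ⊕ (x₂ ⊖ x₁) ≡′ x₂ ⊖ x₀) refl (u ∷ v ∷ d ∷ []) e))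
          (move u∈ (linear (2 ×′ x₁ ≡′ x₂ ⊕ x₀ ⇒′ x₂ ⊖ (x₂ ⊖ x₁ ⊕ (x₂ ⊖ x₁)) ≡′ x₀) refl (u ∷ v ∷ d ∷ []) e))
          (inj₂ (move v∈ (d-[d-z] d v)))
          (cover only (2 ×′ x₂ ≡′ x₃ ⊕ x₁) (x₃ ⊖ x₂ ⊕ (x₃ ⊖ x₂)) (x₃ ⊖ x₂) refl e)
      ... | inj₂ (inj₂ (inj₂ (inj₂ (inj₂ (inj₂ (inj₂ (inj₂ e))))))) =
        half-lateral (linear (interior x₁ x₀ ⇒′ con 0ℤ <′ x₀) refl (v ∷ d ∷ []) (proj₁ (proj₂ q)))
          (linear (2 ×′ x₁ ⊕ x₀ ≡′ x₂ ⇒′ interior x₂ x₀ ⇒′ 2 ×′ x₁ ≤′ x₂) refl (u ∷ v ∷ d ∷ []) e (proj₁ q))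
          (move u′∈ (linear (2 ×′ x₁ ⊕ x₀ ≡′ x₂ ⇒′ x₁ ⊕ x₁ ≡′ x₂ ⊖ x₀) refl (u ∷ v ∷ d ∷ []) e))
          (move u∈ (linear (2 ×′ x₁ ⊕ x₀ ≡′ x₂ ⇒′ x₂ ⊖ (x₁ ⊕ x₁) ≡′ x₀) refl (u ∷ v ∷ d ∷ []) e))
          (inj₁ v∈)
          (cover only (2 ×′ x₂ ⊕ x₁ ≡′ x₃) (x₂ ⊕ x₂) x₂ refl e)

-- Classification of the sets with m = 2, 4 and 7

module Classification where

  open LinearArithmetic
  open Configurations
  open Orbits
  open Progressions
  open TwoOrbits
  open import Data.Integer using (ℤ; +_; _+_; _-_; _≤_; 0ℤ)
  open import Data.Nat as ℕ using (ℕ; z≤n; s≤s)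

  isolated : ℕ → List (List ℤ)
  isolated N = [] ∷ map (λ h → h ∷ []) (quotients 2 N)

  module _ {N E m} (c : Config (+ N) E m) where
    open Config c

    private
      d : ℤ
      d = + N

    Midpoint : Set
    Midpoint = (∃ λ h → h ∈ E × times 2 h ≡ d) ⊎ (∀ {z} → z ∈ E → ¬ times 2 z ≡ d)

    midpoint? : Midpoint
    midpoint? = search-for c (2 ×′ x₀ ≡′ x₁) (d ∷ [])

    NonCentral : Set
    NonCentral = (∃ λ u → u ∈ E × ⟦ interior x₁ x₀ ⟧ (u ∷ d ∷ [])) ⊎ (∀ {z} → z ∈ E → ¬ ⟦ interior x₁ x₀ ⟧ (z ∷ d ∷ []))

    noncentral? : NonCentral
    noncentral? = search-for c (interior x₁ x₀) (d ∷ [])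

    midpoint-candidate : ∀ {h} → (∀ {z} → z ∈ E → ¬ ⟦ interior x₁ x₀ ⟧ (z ∷ d ∷ [])) → h ∈ E → times 2 h ≡ d →
      Candidate (map (λ h → h ∷ []) (quotients 2 N)) d E
    midpoint-candidate {h} none h∈ 2h = h ∷ [] ,
      ∈P.∈-map⁺ (λ h → h ∷ []) (∈-quotients 2 (linear (2 ×′ x₀ ≡′ x₁ ⇒′ con 0ℤ <′ x₁ ⇒′ con 0ℤ ≤′ x₀) refl (h ∷ d ∷ []) 2h 0≺d) 2h) ,
      (λ { (here refl) → h∈ }) ,
      λ {z} z∈ 0z zd → here (linear (con 0ℤ <′ x₀ ⇒′ x₀ <′ x₁ ⇒′ 2 ×′ x₂ ≡′ x₁ ⇒′ ¬′ interior x₁ x₀ ⇒′ x₀ ≡′ x₂) refl (z ∷ d ∷ h ∷ []) 0z zd 2h (none z∈))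

    isolated-candidate : (∀ {z} → z ∈ E → ¬ ⟦ interior x₁ x₀ ⟧ (z ∷ d ∷ [])) → Candidate (isolated N) d E
    isolated-candidate none with midpoint?
    ... | inj₁ (h , h∈ , 2h) = candidate-⊆ there (midpoint-candidate none h∈ 2h)
    ... | inj₂ no-half = [] , here refl , (λ ()) ,
      λ {z} z∈ 0z zd → ⊥-elim (linear (con 0ℤ <′ x₀ ⇒′ x₀ <′ x₁ ⇒′ ¬′ (2 ×′ x₀ ≡′ x₁) ⇒′ ¬′ interior x₁ x₀ ⇒′ ⊥′) refl (z ∷ d ∷ []) 0z zd (no-half z∈) (none z∈))

    -- The counterpart of `coincide`: it rules out sets with too few differences.
    too-many : ∀ {L} → (∀ {a b} → a ∈ E → b ∈ E → b ≺ a → a - b ∈ L) → length L ℕ.< m → ⊥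
    too-many {L} cover lt = ℕP.<⇒≱ lt (many λ { (0e , a , b , a∈ , b∈ , refl) →
      cover a∈ b∈ (linear (con 0ℤ <′ x₀ ⊖ x₁ ⇒′ x₁ <′ x₀) refl (a ∷ b ∷ []) 0e) })

  candidates₂ : ℕ → List (List ℤ)
  candidates₂ N = map (λ h → h ∷ []) (quotients 2 N)

  -- A point u off the midpoint gives three differences d, u, d - u, and {0, d} gives only one.
  classify₂ : ∀ {N E} → Config (+ N) E 2 → Candidate (candidates₂ N) (+ N) E
  classify₂ {N} {E} c with noncentral? c | midpoint? c
  ... | inj₁ (u , u∈ , h@(0u , ud , _)) | _ = ⊥-elim (linear (interior x₁ x₀ ⇒′ ¬′ coincidence (x₁ ∷ orbits x₁ (x₀ ∷ [])))
    refl (u ∷ + N ∷ []) h (coincide c (x₁ ∷ orbits x₁ (x₀ ∷ [])) (u ∷ + N ∷ []) (gap₀ 0∈ d∈ 0≺d ∷ gap₀ 0∈ u∈ 0u ∷ gap d∈ u∈ ud ∷ []) ℕP.≤-refl))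
    where open Config c
  ... | inj₂ none | inj₁ (h , h∈ , 2h) = midpoint-candidate c none h∈ 2h
  ... | inj₂ none | inj₂ no-half = ⊥-elim (too-many c {+ N ∷ []} (λ {a} {b} a∈ b∈ l → here (linear
    (within x₂ x₀ ⇒′ within x₂ x₁ ⇒′ ¬′ interior x₂ x₀ ⇒′ ¬′ interior x₂ x₁ ⇒′ ¬′ (2 ×′ x₀ ≡′ x₂) ⇒′ ¬′ (2 ×′ x₁ ≡′ x₂) ⇒′
      x₁ <′ x₀ ⇒′ x₀ ⊖ x₁ ≡′ x₂) refl (a ∷ b ∷ + N ∷ []) (bounded a∈) (bounded b∈) (none a∈) (none b∈) (no-half a∈) (no-half b∈) l)) (s≤s (s≤s z≤n)))
    where open Config c

  candidates₄ : ℕ → List (List ℤ)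
  candidates₄ N = isolated N ++ map (λ t → t ∷ + N - t ∷ []) (ints (N ℕ./ 2)) ++
    concatMap (λ e → extensions [] (e ∷ times 2 e ∷ times 3 e ∷ [])) (quotients 4 N)

  module Four {N E} (c : Config (+ N) E 4) where
    open Config c

    private
      d : ℤ
      d = + N

    one-orbit : ∀ {u} → u ∈ E → ⟦ interior x₁ x₀ ⟧ (u ∷ d ∷ []) → ∀ {z} → z ∈ E → ¬ ⟦ interior x₂ x₀ ∧′ apart x₂ x₁ x₀ ⟧ (z ∷ u ∷ d ∷ [])
    one-orbit {u} u∈ h@(0u , ud , _) {z} z∈ k@((0z , zd , _) , _) =
      linear (interior x₂ x₁ ⇒′ (interior x₂ x₀ ∧′ apart x₂ x₁ x₀) ⇒′ ¬′ coincidence (x₂ ∷ orbits x₂ (x₁ ∷ x₀ ∷ []))) refl (z ∷ u ∷ d ∷ []) h k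
        (coincide c (x₂ ∷ orbits x₂ (x₁ ∷ x₀ ∷ [])) (z ∷ u ∷ d ∷ [])
          (gap₀ 0∈ d∈ 0≺d ∷ gap₀ 0∈ u∈ 0u ∷ gap d∈ u∈ ud ∷ gap₀ 0∈ z∈ 0z ∷ gap d∈ z∈ zd ∷ []) ℕP.≤-refl)

    quarters-candidate : ∀ {e} → 0ℤ ≤ e → times 4 e ≡ d →
      (∀ {z} → z ∈ E → 0ℤ ≺ z → z ≺ d → z ∈ e ∷ times 2 e ∷ times 3 e ∷ []) → Candidate (candidates₄ N) d E
    quarters-candidate {e} 0e 4e cover = candidate-⊆
      (λ l∈ → ∈P.∈-++⁺ʳ (isolated N) (∈P.∈-++⁺ʳ (map (λ t → t ∷ d - t ∷ []) (ints (N ℕ./ 2)))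
        (∈-concatMap (λ e → extensions [] (e ∷ times 2 e ∷ times 3 e ∷ [])) (∈-quotients 4 0e 4e) l∈)))
      (covered-extension [] (e ∷ times 2 e ∷ times 3 e ∷ []) [] cover)

    symmetric-candidate : ∀ {u} → 0ℤ ≺ u → times 2 u ≤ d → u ∈ E → d - u ∈ E →
      (∀ {z} → z ∈ E → 0ℤ ≺ z → z ≺ d → z ∈ u ∷ d - u ∷ []) → Candidate (candidates₄ N) d E
    symmetric-candidate 0u 2u u∈ u′∈ cover = _ , ∈P.∈-++⁺ʳ (isolated N) (∈P.∈-++⁺ˡ (∈P.∈-map⁺ (λ t → t ∷ d - t ∷ []) (∈-ints 2 0u 2u))) ,
      All.lookup (u∈ ∷ u′∈ ∷ []) , cover

    quarter-relation : ∀ {u h} → u ∈ E → ⟦ interior x₁ x₀ ⟧ (u ∷ d ∷ []) → h ∈ E → times 2 h ≡ d → ⟦ 4 ×′ x₀ ≡′ x₁ ∨′ 4 ×′ x₀ ≡′ 3 ×′ x₁ ⟧ (u ∷ d ∷ [])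
    quarter-relation {u} {h} u∈ k@(0u , ud , 2u) h∈ 2h with compare u h
    ... | inj₂ (inj₁ e) = ⊥-elim (linear (2 ×′ x₁ ≡′ x₂ ⇒′ interior x₂ x₀ ⇒′ ¬′ (x₀ ≡′ x₁)) refl (u ∷ h ∷ d ∷ []) 2h k e)
    ... | inj₁ l = linear
      (interior x₂ x₀ ⇒′ 2 ×′ x₁ ≡′ x₂ ⇒′ x₀ <′ x₁ ⇒′ coincidence (x₁ ⊖ x₀ ∷ x₁ ∷ x₂ ∷ orbits x₂ (x₀ ∷ [])) ⇒′ 4 ×′ x₀ ≡′ x₂ ∨′ 4 ×′ x₀ ≡′ 3 ×′ x₂)
      refl (u ∷ h ∷ d ∷ []) k 2h l (coincide c (x₁ ⊖ x₀ ∷ x₁ ∷ x₂ ∷ orbits x₂ (x₀ ∷ [])) (u ∷ h ∷ d ∷ [])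
        (gap h∈ u∈ l ∷ gap₀ 0∈ h∈ (linear (2 ×′ x₀ ≡′ x₁ ⇒′ con 0ℤ <′ x₁ ⇒′ con 0ℤ <′ x₀) refl (h ∷ d ∷ []) 2h 0≺d) ∷
          gap₀ 0∈ d∈ 0≺d ∷ gap₀ 0∈ u∈ 0u ∷ gap d∈ u∈ ud ∷ []) ℕP.≤-refl)
    ... | inj₂ (inj₂ l) = linear
      (interior x₂ x₀ ⇒′ 2 ×′ x₁ ≡′ x₂ ⇒′ x₁ <′ x₀ ⇒′ coincidence (x₀ ⊖ x₁ ∷ x₁ ∷ x₂ ∷ orbits x₂ (x₀ ∷ [])) ⇒′ 4 ×′ x₀ ≡′ x₂ ∨′ 4 ×′ x₀ ≡′ 3 ×′ x₂)
      refl (u ∷ h ∷ d ∷ []) k 2h l (coincide c (x₀ ⊖ x₁ ∷ x₁ ∷ x₂ ∷ orbits x₂ (x₀ ∷ [])) (u ∷ h ∷ d ∷ [])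
        (gap u∈ h∈ l ∷ gap₀ 0∈ h∈ (linear (2 ×′ x₀ ≡′ x₁ ⇒′ con 0ℤ <′ x₁ ⇒′ con 0ℤ <′ x₀) refl (h ∷ d ∷ []) 2h 0≺d) ∷
          gap₀ 0∈ d∈ 0≺d ∷ gap₀ 0∈ u∈ 0u ∷ gap d∈ u∈ ud ∷ []) ℕP.≤-refl)

    -- If the midpoint is present, u lies at a quarter. Otherwise d - u must be present as well,
    -- because {0, u, d} has only three differences.
    orbit-candidate : ∀ {u} → u ∈ E → ⟦ interior x₁ x₀ ⟧ (u ∷ d ∷ []) → Candidate (candidates₄ N) d E
    orbit-candidate {u} u∈ k with midpoint? c | (d - u) ∈? E
    ... | inj₁ (h , h∈ , 2h) | _ with quarter-relation u∈ k h∈ 2h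
    ...   | inj₁ 4u = quarters-candidate (linear (interior x₁ x₀ ⇒′ con 0ℤ ≤′ x₀) refl (u ∷ d ∷ []) k) 4u
      λ {z} z∈ 0z zd → any⇒∈ x₀ (x₁ ∷ 2 ×′ x₁ ∷ 3 ×′ x₁ ∷ []) (z ∷ u ∷ d ∷ []) (linear
        (4 ×′ x₁ ≡′ x₂ ⇒′ con 0ℤ <′ x₀ ⇒′ x₀ <′ x₂ ⇒′ ¬′ (interior x₂ x₀ ∧′ apart x₂ x₁ x₀) ⇒′ x₀ ≡any (x₁ ∷ 2 ×′ x₁ ∷ 3 ×′ x₁ ∷ []))
        refl (z ∷ u ∷ d ∷ []) 4u 0z zd (one-orbit u∈ k z∈))
    ...   | inj₂ 4u = quarters-candidate (linear (interior x₁ x₀ ⇒′ con 0ℤ ≤′ x₁ ⊖ x₀) refl (u ∷ d ∷ []) k)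
      (linear (4 ×′ x₀ ≡′ 3 ×′ x₁ ⇒′ 4 ×′ (x₁ ⊖ x₀) ≡′ x₁) refl (u ∷ d ∷ []) 4u)
      λ {z} z∈ 0z zd → any⇒∈ x₀ (x₂ ⊖ x₁ ∷ 2 ×′ (x₂ ⊖ x₁) ∷ 3 ×′ (x₂ ⊖ x₁) ∷ []) (z ∷ u ∷ d ∷ []) (linear
        (4 ×′ x₁ ≡′ 3 ×′ x₂ ⇒′ con 0ℤ <′ x₀ ⇒′ x₀ <′ x₂ ⇒′ ¬′ (interior x₂ x₀ ∧′ apart x₂ x₁ x₀) ⇒′ x₀ ≡any (x₂ ⊖ x₁ ∷ 2 ×′ (x₂ ⊖ x₁) ∷ 3 ×′ (x₂ ⊖ x₁) ∷ []))
        refl (z ∷ u ∷ d ∷ []) 4u 0z zd (one-orbit u∈ k z∈))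
    orbit-candidate {u} u∈ k | inj₂ no-half | no u′∉ = ⊥-elim (too-many c {d ∷ u ∷ d - u ∷ []} (λ {a} {b} a∈ b∈ l →
      any⇒∈ (x₀ ⊖ x₁) (x₃ ∷ x₂ ∷ x₃ ⊖ x₂ ∷ []) (a ∷ b ∷ u ∷ d ∷ []) (linear
        (within x₃ x₀ ⇒′ within x₃ x₁ ⇒′ x₁ <′ x₀ ⇒′ ¬′ (2 ×′ x₀ ≡′ x₃) ⇒′ ¬′ (2 ×′ x₁ ≡′ x₃) ⇒′ ¬′ (x₀ ≡′ x₃ ⊖ x₂) ⇒′ ¬′ (x₁ ≡′ x₃ ⊖ x₂) ⇒′
          ¬′ (interior x₃ x₀ ∧′ apart x₃ x₂ x₀) ⇒′ ¬′ (interior x₃ x₁ ∧′ apart x₃ x₂ x₁) ⇒′ x₀ ⊖ x₁ ≡any (x₃ ∷ x₂ ∷ x₃ ⊖ x₂ ∷ []))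
        refl (a ∷ b ∷ u ∷ d ∷ []) (bounded a∈) (bounded b∈) l (no-half a∈) (no-half b∈) (λ { refl → u′∉ a∈ }) (λ { refl → u′∉ b∈ }) (one-orbit u∈ k a∈) (one-orbit u∈ k b∈)))
      ℕP.≤-refl)
    orbit-candidate {u} u∈ k | inj₂ no-half | yes u′∈ with linear (2 ×′ x₀ ≤′ x₁ ∨′ 2 ×′ (x₁ ⊖ x₀) ≤′ x₁) refl (u ∷ d ∷ [])
    ... | inj₁ 2u = symmetric-candidate (linear (interior x₁ x₀ ⇒′ con 0ℤ <′ x₀) refl (u ∷ d ∷ []) k) 2u u∈ u′∈
      λ {z} z∈ 0z zd → any⇒∈ x₀ (x₁ ∷ x₂ ⊖ x₁ ∷ []) (z ∷ u ∷ d ∷ []) (linear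
        (con 0ℤ <′ x₀ ⇒′ x₀ <′ x₂ ⇒′ ¬′ (2 ×′ x₀ ≡′ x₂) ⇒′ ¬′ (interior x₂ x₀ ∧′ apart x₂ x₁ x₀) ⇒′ x₀ ≡any (x₁ ∷ x₂ ⊖ x₁ ∷ []))
        refl (z ∷ u ∷ d ∷ []) 0z zd (no-half z∈) (one-orbit u∈ k z∈))
    ... | inj₂ 2u = symmetric-candidate (linear (interior x₁ x₀ ⇒′ con 0ℤ <′ x₁ ⊖ x₀) refl (u ∷ d ∷ []) k) 2u u′∈ (subst (_∈ E) (sym (d-[d-z] d u)) u∈)
      λ {z} z∈ 0z zd → any⇒∈ x₀ (x₂ ⊖ x₁ ∷ x₂ ⊖ (x₂ ⊖ x₁) ∷ []) (z ∷ u ∷ d ∷ []) (linear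
        (con 0ℤ <′ x₀ ⇒′ x₀ <′ x₂ ⇒′ ¬′ (2 ×′ x₀ ≡′ x₂) ⇒′ ¬′ (interior x₂ x₀ ∧′ apart x₂ x₁ x₀) ⇒′ x₀ ≡any (x₂ ⊖ x₁ ∷ x₂ ⊖ (x₂ ⊖ x₁) ∷ []))
        refl (z ∷ u ∷ d ∷ []) 0z zd (no-half z∈) (one-orbit u∈ k z∈))

  classify₄ : ∀ {N E} → Config (+ N) E 4 → Candidate (candidates₄ N) (+ N) E
  classify₄ c with noncentral? c
  ... | inj₁ (u , u∈ , k) = Four.orbit-candidate c u∈ k
  ... | inj₂ none = candidate-⊆ ∈P.∈-++⁺ˡ (isolated-candidate c none)

  candidates₇ : ℕ → List (List ℤ)
  candidates₇ N = isolated N ++ chains N ++ centrals N ++ laterals N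

  module Seven {N E} (c : Config (+ N) E 7) where
    open Config c
    open Pairs c

    private
      d : ℤ
      d = + N

    -- One orbit and the midpoint have at most the six differences d, h, u, d - u, |d - 2u|, |h -
    -- u|. If the midpoint is absent, h = u stands in for it, so that both cases are treated at
    -- once.
    few-points : ∀ {u h} → (times 2 h ≡ d ⊎ u ≡ h) → (∀ {z} → z ∈ E → times 2 z ≡ d → z ≡ h) → ⟦ interior x₁ x₀ ⟧ (u ∷ d ∷ []) →
      ¬ (∀ {z} → z ∈ E → ¬ ⟦ interior x₂ x₀ ∧′ apart x₂ x₁ x₀ ⟧ (z ∷ u ∷ d ∷ []))
    few-points {u} {h} h≡ mid k one with linear (x₀ ⊕ x₀ <′ x₁ ∨′ x₁ ≤′ x₀ ⊕ x₀) refl (u ∷ d ∷ [])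
    ... | inj₁ l = too-many c {map (λ e → ⟦ e ⟧ₑ (u ∷ h ∷ d ∷ [])) (x₂ ∷ x₁ ∷ x₀ ∷ x₂ ⊖ x₀ ∷ x₂ ⊖ (x₀ ⊕ x₀) ∷ x₁ ⊖ x₀ ∷ [])} (λ {a} {b} a∈ b∈ l′ →
      any⇒∈ (x₀ ⊖ x₁) (x₄ ∷ x₃ ∷ x₂ ∷ x₄ ⊖ x₂ ∷ x₄ ⊖ (x₂ ⊕ x₂) ∷ x₃ ⊖ x₂ ∷ []) (a ∷ b ∷ u ∷ h ∷ d ∷ []) (linear
        (interior x₄ x₂ ⇒′ x₂ ⊕ x₂ <′ x₄ ⇒′ (2 ×′ x₃ ≡′ x₄ ∨′ x₂ ≡′ x₃) ⇒′ within x₄ x₀ ⇒′ within x₄ x₁ ⇒′ x₁ <′ x₀ ⇒′ (2 ×′ x₀ ≡′ x₄ ⇒′ x₀ ≡′ x₃) ⇒′ (2 ×′ x₁ ≡′ x₄ ⇒′ x₁ ≡′ x₃) ⇒′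
          ¬′ (interior x₄ x₀ ∧′ apart x₄ x₂ x₀) ⇒′ ¬′ (interior x₄ x₁ ∧′ apart x₄ x₂ x₁) ⇒′
          x₀ ⊖ x₁ ≡any (x₄ ∷ x₃ ∷ x₂ ∷ x₄ ⊖ x₂ ∷ x₄ ⊖ (x₂ ⊕ x₂) ∷ x₃ ⊖ x₂ ∷ []))
        refl (a ∷ b ∷ u ∷ h ∷ d ∷ []) k l h≡ (bounded a∈) (bounded b∈) l′ (mid a∈) (mid b∈) (one a∈) (one b∈))) ℕP.≤-refl
    ... | inj₂ l = too-many c {map (λ e → ⟦ e ⟧ₑ (u ∷ h ∷ d ∷ [])) (x₂ ∷ x₁ ∷ x₀ ∷ x₂ ⊖ x₀ ∷ x₀ ⊕ x₀ ⊖ x₂ ∷ x₀ ⊖ x₁ ∷ [])} (λ {a} {b} a∈ b∈ l′ →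
      any⇒∈ (x₀ ⊖ x₁) (x₄ ∷ x₃ ∷ x₂ ∷ x₄ ⊖ x₂ ∷ x₂ ⊕ x₂ ⊖ x₄ ∷ x₂ ⊖ x₃ ∷ []) (a ∷ b ∷ u ∷ h ∷ d ∷ []) (linear
        (interior x₄ x₂ ⇒′ x₄ ≤′ x₂ ⊕ x₂ ⇒′ (2 ×′ x₃ ≡′ x₄ ∨′ x₂ ≡′ x₃) ⇒′ within x₄ x₀ ⇒′ within x₄ x₁ ⇒′ x₁ <′ x₀ ⇒′ (2 ×′ x₀ ≡′ x₄ ⇒′ x₀ ≡′ x₃) ⇒′ (2 ×′ x₁ ≡′ x₄ ⇒′ x₁ ≡′ x₃) ⇒′
          ¬′ (interior x₄ x₀ ∧′ apart x₄ x₂ x₀) ⇒′ ¬′ (interior x₄ x₁ ∧′ apart x₄ x₂ x₁) ⇒′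
          x₀ ⊖ x₁ ≡any (x₄ ∷ x₃ ∷ x₂ ∷ x₄ ⊖ x₂ ∷ x₂ ⊕ x₂ ⊖ x₄ ∷ x₂ ⊖ x₃ ∷ []))
        refl (a ∷ b ∷ u ∷ h ∷ d ∷ []) k l h≡ (bounded a∈) (bounded b∈) l′ (mid a∈) (mid b∈) (one a∈) (one b∈))) ℕP.≤-refl

    one-orbit : ∀ {u} → ⟦ interior x₁ x₀ ⟧ (u ∷ d ∷ []) →
      ¬ (∀ {z} → z ∈ E → ¬ ⟦ interior x₂ x₀ ∧′ apart x₂ x₁ x₀ ⟧ (z ∷ u ∷ d ∷ []))
    one-orbit {u} k with midpoint? c
    ... | inj₁ (h , h∈ , 2h) = few-points (inj₁ 2h)
      (λ {z} _ 2z → linear (2 ×′ x₀ ≡′ x₂ ⇒′ 2 ×′ x₁ ≡′ x₂ ⇒′ x₀ ≡′ x₁) refl (z ∷ h ∷ d ∷ []) 2z 2h) k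
    ... | inj₂ no-half = few-points {u} {u} (inj₂ refl) (λ z∈ 2z → ⊥-elim (no-half z∈ 2z)) k

    module _ (no-half : ∀ {z} → z ∈ E → ¬ times 2 z ≡ d) where
      open Lateral no-half

      -- Both points of the orbit of u are present, so u may be taken to be the smaller one.
      oriented : ∀ {u v} → Pair u v → OnlyOrbits u v → d - u ∈ E → Candidate (laterals N) d E
      oriented {u} {v} p@((u∈ , v∈) , q) only u′∈ with linear (x₀ <′ x₁ ⊖ x₀ ∨′ x₁ ≡′ x₀ ⊕ x₀ ∨′ x₁ ⊖ x₀ <′ x₁ ⊖ (x₁ ⊖ x₀)) refl (u ∷ d ∷ [])
      ... | inj₁ l = lateral-candidate′ p only u′∈ l
      ... | inj₂ (inj₁ e) = ⊥-elim (linear (pair x₂ x₀ x₁ ⇒′ ¬′ (x₂ ≡′ x₀ ⊕ x₀)) refl (u ∷ v ∷ d ∷ []) q e)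
      ... | inj₂ (inj₂ l) = lateral-candidate′
        ((u′∈ , v∈) , linear (pair x₂ x₀ x₁ ⇒′ pair x₂ (x₂ ⊖ x₀) x₁) refl (u ∷ v ∷ d ∷ []) q)
        (λ {z} z∈ k → only z∈ (linear (third-orbit x₃ (x₃ ⊖ x₁) x₂ x₀ ⇒′ third-orbit x₃ x₁ x₂ x₀) refl (z ∷ u ∷ v ∷ d ∷ []) k))
        (subst (_∈ E) (sym (d-[d-z] d u)) u∈) l

      -- With one point from each orbit and no midpoint the set is {0, u, v, d}, which has at most
      -- six differences. Hence one of the orbits is full.
      four-points : ∀ {u v} → Pair u v → OnlyOrbits u v → u ≺ v → ¬ d - u ∈ E → ¬ d - v ∈ E → ⊥
      four-points {u} {v} (_ , q) only l u′∉ v′∉ = too-many c {map (λ e → ⟦ e ⟧ₑ (u ∷ v ∷ d ∷ [])) (x₂ ∷ x₀ ∷ x₁ ∷ x₂ ⊖ x₀ ∷ x₂ ⊖ x₁ ∷ x₁ ⊖ x₀ ∷ [])} (λ {a} {b} a∈ b∈ l′ →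
        any⇒∈ (x₀ ⊖ x₁) (x₄ ∷ x₂ ∷ x₃ ∷ x₄ ⊖ x₂ ∷ x₄ ⊖ x₃ ∷ x₃ ⊖ x₂ ∷ []) (a ∷ b ∷ u ∷ v ∷ d ∷ []) (linear
          (pair x₄ x₂ x₃ ⇒′ x₂ <′ x₃ ⇒′ within x₄ x₀ ⇒′ within x₄ x₁ ⇒′ x₁ <′ x₀ ⇒′ ¬′ (2 ×′ x₀ ≡′ x₄) ⇒′ ¬′ (2 ×′ x₁ ≡′ x₄) ⇒′
            ¬′ (x₀ ≡′ x₄ ⊖ x₂) ⇒′ ¬′ (x₀ ≡′ x₄ ⊖ x₃) ⇒′ ¬′ (x₁ ≡′ x₄ ⊖ x₂) ⇒′ ¬′ (x₁ ≡′ x₄ ⊖ x₃) ⇒′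
            ¬′ third-orbit x₄ x₂ x₃ x₀ ⇒′ ¬′ third-orbit x₄ x₂ x₃ x₁ ⇒′
            x₀ ⊖ x₁ ≡any (x₄ ∷ x₂ ∷ x₃ ∷ x₄ ⊖ x₂ ∷ x₄ ⊖ x₃ ∷ x₃ ⊖ x₂ ∷ []))
          refl (a ∷ b ∷ u ∷ v ∷ d ∷ []) q l (bounded a∈) (bounded b∈) l′ (no-half a∈) (no-half b∈)
          (λ { refl → u′∉ a∈ }) (λ { refl → v′∉ a∈ }) (λ { refl → u′∉ b∈ }) (λ { refl → v′∉ b∈ }) (only a∈) (only b∈))) ℕP.≤-refl

      lateral-candidate : ∀ {u v} → Pair u v → OnlyOrbits u v → Candidate (laterals N) d E
      lateral-candidate {u} {v} p@(_ , q@(_ , _ , u≢v , _)) only with (d - u) ∈? E | (d - v) ∈? E | compare u v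
      ... | yes u′∈ | _ | _ = oriented p only u′∈
      ... | no _ | yes v′∈ | _ = oriented (swap p) (swap-only only) v′∈
      ... | no u′∉ | no v′∉ | inj₁ l = ⊥-elim (four-points p only l u′∉ v′∉)
      ... | no u′∉ | no v′∉ | inj₂ (inj₁ e) = ⊥-elim (u≢v e)
      ... | no u′∉ | no v′∉ | inj₂ (inj₂ l) = ⊥-elim (four-points (swap p) (swap-only only) l v′∉ u′∉)

    pair-candidate : ∀ {u v} → Pair u v → Candidate (candidates₇ N) d E
    pair-candidate {u} {v} p@((u∈ , v∈) , q@(ku , kv , uv)) with search-for c (third-orbit x₃ x₁ x₂ x₀) (u ∷ v ∷ d ∷ []) | midpoint? c
    ... | inj₁ (w , w∈ , kw , uw , vw) | _ = candidate-⊆ (λ l∈ → ∈P.∈-++⁺ʳ (isolated N) (∈P.∈-++⁺ˡ l∈))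
      (triple-candidate c ((u∈ , v∈ , w∈) , ku , kv , kw , uv , uw , vw))
    ... | inj₂ only | inj₁ (h , h∈ , 2h) = candidate-⊆
      (λ l∈ → ∈P.∈-++⁺ʳ (isolated N) (∈P.∈-++⁺ʳ (chains N) (∈P.∈-++⁺ˡ l∈)))
      (Central.central-candidate h∈ 2h p only)
    ... | inj₂ only | inj₂ no-half = candidate-⊆
      (λ l∈ → ∈P.∈-++⁺ʳ (isolated N) (∈P.∈-++⁺ʳ (chains N) (∈P.∈-++⁺ʳ (centrals N) l∈)))
      (lateral-candidate no-half p only)

  classify₇ : ∀ {N E} → Config (+ N) E 7 → Candidate (candidates₇ N) (+ N) E
  classify₇ {N} {E} c with noncentral? c
  ... | inj₂ none = candidate-⊆ ∈P.∈-++⁺ˡ (isolated-candidate c none)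
  ... | inj₁ (u , u∈ , k) with search-for c (interior x₂ x₀ ∧′ apart x₂ x₁ x₀) (u ∷ + N ∷ [])
  ...   | inj₁ (v , v∈ , k′ , uv) = Seven.pair-candidate c ((u∈ , v∈) , k , k′ , uv)
  ...   | inj₂ one = ⊥-elim (Seven.one-orbit c k one)

-- Translation between subsets and lists of inner points

module Realisation where

  open LinearArithmetic
  open Configurations
  open Counting
  open PositiveDifferences
  open import Data.Integer as ℤ using (ℤ; +_; -[1+_]; 0ℤ)
  open import Data.Nat using (ℕ; zero; suc; _+_; _≤_; _<_; _≡ᵇ_; z≤n; s≤s; _≟_)

  span : ∀ {n} → Subset n → Subset (2 + n)
  span S = true ∷ (S ∷ʳ true)

  at? : ∀ {n} (S : Subset n) k → Dec (At S k)
  at? [] k = no λ ()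
  at? (true ∷ S) zero = yes refl
  at? (false ∷ S) zero = no λ ()
  at? (b ∷ S) (suc k) = at? S k

  elements : ∀ {n} → Subset n → List ℤ
  elements {n} S = map +_ (filter (at? S) (upTo n))

  ∈-elements⁺ : ∀ {n} (S : Subset n) {k} → At S k → + k ∈ elements S
  ∈-elements⁺ S h = ∈P.∈-map⁺ +_ (∈P.∈-filter⁺ (at? S) (∈P.∈-upTo⁺ (At-< S h)) h)

  ∈-elements⁻ : ∀ {n} (S : Subset n) {z} → z ∈ elements S → ∃ λ k → z ≡ + k × At S k
  ∈-elements⁻ {n} S z∈ with ∈P.∈-map⁻ +_ z∈
  ... | k , k∈ , e = k , e , proj₂ (∈P.∈-filter⁻ (at? S) {xs = upTo n} k∈)

  elements-difference : ∀ {n} (S : Subset n) {e} → Gap (elements S) e → Difference S e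
  elements-difference S (_ , a , b , a∈ , b∈ , eq) with ∈-elements⁻ S a∈ | ∈-elements⁻ S b∈
  ... | i , refl , p | j , refl , q = i , j , p , q , eq

  ∈-positive-shifts : ∀ {n} (S : Subset n) {e} → 0ℤ ≺ e → Difference S e → e ∈ map (λ t → + suc t) (shifts S)
  ∈-positive-shifts S {+ suc t} _ h = ∈P.∈-map⁺ (λ t → + suc t) (Difference⇒shift S t h)
  ∈-positive-shifts S {+ zero} (ℤ.+≤+ ()) h

  positive-shifts-gap : ∀ {n} (S : Subset n) {e} → e ∈ map (λ t → + suc t) (shifts S) → Gap (elements S) e
  positive-shifts-gap S e∈ with ∈P.∈-map⁻ (λ t → + suc t) e∈
  ... | t , t∈ , refl with shift⇒Difference S t∈
  ...   | a , b , p , q , eq = ℤ.+≤+ (s≤s z≤n) , + a , + b , ∈-elements⁺ S p , ∈-elements⁺ S q , eq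

  length-positive-shifts : ∀ {n} (S : Subset n) → length (map (λ t → + suc t) (shifts S)) ≡ spread S
  length-positive-shifts S = ListP.length-map (λ t → + suc t) (shifts S)

  positive-shifts-unique : ∀ {n} (S : Subset n) → Unique (map (λ t → + suc t) (shifts S))
  positive-shifts-unique S = UniqueP.map⁺ (λ { refl → refl }) (shifts-unique S)

  config : ∀ {n m} (S : Subset n) → spread (span S) ≡ m → Config (+ suc n) (elements (span S)) m
  config {n} S refl = record
    { 0∈ = ∈-elements⁺ (span S) refl
    ; d∈ = ∈-elements⁺ (span S) (At-last S)
    ; 0≺d = ℤ.+≤+ (s≤s z≤n)
    ; bounded = λ z∈ → bounded (∈-elements⁻ (span S) z∈)
    ; few = λ u gaps → subst (_ ≤_) (length-positive-shifts (span S)) (length-⊆ u λ e∈ →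
        ∈-positive-shifts (span S) (proj₁ (All.lookup gaps e∈)) (elements-difference (span S) (All.lookup gaps e∈)))
    ; many = λ cover → subst (_≤ _) (length-positive-shifts (span S)) (length-⊆ (positive-shifts-unique (span S)) λ e∈ →
        cover (positive-shifts-gap (span S) e∈))
    }
    where
    bounded : ∀ {z} → (∃ λ k → z ≡ + k × At (span S) k) → 0ℤ ℤ.≤ z × z ℤ.≤ + suc n
    bounded (k , refl , h) = ℤ.+≤+ z≤n , ℤ.+≤+ (ℕP.≤-pred (At-< (span S) h))

  member : ℕ → List ℤ → Bool
  member k [] = false
  member k (+ j ∷ l) = if k ≡ᵇ j then true else member k l
  member k (-[1+ _ ] ∷ l) = member k l

  member⁺ : ∀ {k l} → + k ∈ l → member k l ≡ true
  member⁺ {k} {.(+ k) ∷ l} (here refl) with k ≡ᵇ k | ℕP.≡⇒≡ᵇ k k refl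
  ... | true | _ = refl
  member⁺ {k} {+ j ∷ l} (there p) with k ≡ᵇ j
  ... | true = refl
  ... | false = member⁺ p
  member⁺ {k} { -[1+ j ] ∷ l} (there p) = member⁺ p

  member⁻ : ∀ {k l} → member k l ≡ true → + k ∈ l
  member⁻ {k} {+ j ∷ l} e with k ≡ᵇ j in eq
  ... | true = here (cong +_ (ℕP.≡ᵇ⇒≡ k j (subst T (sym eq) tt)))
  ... | false = there (member⁻ e)
  member⁻ {k} { -[1+ j ] ∷ l} e = there (member⁻ e)

  -- The subset of [n] whose element k − o stands for each integer k in the list.
  ofCode : ∀ n → ℕ → List ℤ → Subset n
  ofCode zero o l = []
  ofCode (suc n) o l = member o l ∷ ofCode n (suc o) l

  At-ofCode⁺ : ∀ n o {l k} → k < n → + (o + k) ∈ l → At (ofCode n o l) k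
  At-ofCode⁺ (suc n) o {l} {zero} lt p = member⁺ (subst (λ j → + j ∈ l) (ℕP.+-identityʳ o) p)
  At-ofCode⁺ (suc n) o {l} {suc k} (s≤s lt) p = At-ofCode⁺ n (suc o) lt (subst (λ j → + j ∈ l) (ℕP.+-suc o k) p)

  At-ofCode⁻ : ∀ n o {l k} → At (ofCode n o l) k → + (o + k) ∈ l
  At-ofCode⁻ (suc n) o {l} {zero} h = subst (λ j → + j ∈ l) (sym (ℕP.+-identityʳ o)) (member⁻ h)
  At-ofCode⁻ (suc n) o {l} {suc k} h = subst (λ j → + j ∈ l) (sym (ℕP.+-suc o k)) (At-ofCode⁻ n (suc o) h)

  At-ext : ∀ {n} (S S′ : Subset n) → (∀ {k} → At S k → At S′ k) → (∀ {k} → At S′ k → At S k) → S ≡ S′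
  At-ext [] [] f g = refl
  At-ext (b ∷ S) (b′ ∷ S′) f g = cong₂ _∷_ (heads b b′ (f {zero}) (g {zero})) (At-ext S S′ (λ {k} → f {suc k}) (λ {k} → g {suc k}))
    where
    heads : ∀ b b′ → (b ≡ true → b′ ≡ true) → (b′ ≡ true → b ≡ true) → b ≡ b′
    heads true b′ f g = sym (f refl)
    heads false false f g = refl
    heads false true f g = g refl

  At-span⁺ : ∀ {n} (S : Subset n) {k} → At S k → At (span S) (suc k)
  At-span⁺ S h = At-∷ʳ⁺ S h

  At-span⁻ : ∀ {n} (S : Subset n) {k} → k < n → At (span S) (suc k) → At S k
  At-span⁻ S lt h with At-∷ʳ⁻ S h
  ... | inj₁ p = p
  ... | inj₂ (refl , _) = ⊥-elim (ℕP.<-irrefl refl lt)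

  ofCode-covered : ∀ {n} (S : Subset n) {l} → Covered (+ suc n) (elements (span S)) l → S ≡ ofCode n 1 l
  ofCode-covered {n} S {l} (f , g) = At-ext S (ofCode n 1 l) to from
    where
    to : ∀ {k} → At S k → At (ofCode n 1 l) k
    to h = At-ofCode⁺ n 1 (At-< S h) (g (∈-elements⁺ (span S) (At-span⁺ S h)) (ℤ.+≤+ (s≤s z≤n)) (ℤ.+≤+ (s≤s (At-< S h))))
    from : ∀ {k} → At (ofCode n 1 l) k → At S k
    from {k} h with ∈-elements⁻ (span S) (f (At-ofCode⁻ n 1 h))
    ... | .(suc k) , refl , p = At-span⁻ S (At-< (ofCode n 1 l) h) p

  -- Repetitions among the candidates remain; an upper bound tolerates them.
  realised : ℕ → ℕ → List (List ℤ) → List (List ℤ)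
  realised n m = filter (λ l → spread (span (ofCode n 1 l)) ≟ m)

  spanning-≤ : ∀ n m L → (∀ {E} → Config (+ suc n) E m → ∃ λ l → l ∈ L × Covered (+ suc n) E l) →
    spanning n m ≤ length (realised n m L)
  spanning-≤ n m L classify = subst (spanning n m ≤_) (ListP.length-map (ofCode n 1) (realised n m L))
    (count-≤ {n} (λ S → spread (span S) ≟ m) (map (ofCode n 1) (realised n m L)) cover)
    where
    cover : ∀ S → spread (span S) ≡ m → S ∈ map (ofCode n 1) (realised n m L)
    cover S h with classify (config S h)
    ... | l , l∈ , cov with ofCode-covered S cov
    ...   | refl = ∈P.∈-map⁺ (ofCode n 1) (∈P.∈-filter⁺ (λ l → spread (span (ofCode n 1 l)) ≟ m) l∈ h)

  spanning-≤′ : ∀ n m L → (∀ {E} → Config (+ suc n) E m → ∃ λ l → l ∈ L × Covered (+ suc n) E l) → spanning n m ≤ length L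
  spanning-≤′ n m L classify = ℕP.≤-trans (spanning-≤ n m L classify) (ListP.length-filter (λ l → spread (span (ofCode n 1 l)) ≟ m) L)

  module _ {n : ℕ} {l : List ℤ} (inside : ∀ {z} → z ∈ l → 0ℤ ≺ z × z ≺ + suc n) where

    private
      E : List ℤ
      E = 0ℤ ∷ + suc n ∷ l

      S : Subset n
      S = ofCode n 1 l

    ∈⇒At-span : ∀ {k} → + k ∈ E → At (span S) k
    ∈⇒At-span (here refl) = refl
    ∈⇒At-span (there (here refl)) = At-last S
    ∈⇒At-span {zero} (there (there p)) = refl
    ∈⇒At-span {suc k} (there (there p)) with inside p
    ... | _ , ℤ.+≤+ (s≤s lt) = At-span⁺ S (At-ofCode⁺ n 1 lt p)

    At-span⇒∈ : ∀ {k} → At (span S) k → + k ∈ E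
    At-span⇒∈ {zero} h = here refl
    At-span⇒∈ {suc k} h with At-∷ʳ⁻ S h
    ... | inj₁ p = there (there (At-ofCode⁻ n 1 p))
    ... | inj₂ (refl , _) = there (here refl)

    nonneg : ∀ {z} → z ∈ E → ∃ λ k → z ≡ + k
    nonneg (here refl) = 0 , refl
    nonneg (there (here refl)) = _ , refl
    nonneg {+ k} (there (there p)) = k , refl
    nonneg { -[1+ k ] } (there (there p)) with inside p
    ... | () , _

    gap-difference : ∀ {e} → Gap E e → Difference (span S) e
    gap-difference (_ , a , b , a∈ , b∈ , eq) with nonneg a∈ | nonneg b∈
    ... | i , refl | j , refl = i , j , ∈⇒At-span a∈ , ∈⇒At-span b∈ , eq

    spread-ofCode : ∀ {ds} → Unique ds → All (Gap E) ds → (∀ {e} → Gap E e → e ∈ ds) → spread (span S) ≡ length ds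
    spread-ofCode u gaps cover = ℕP.≤-antisym
      (subst (_≤ _) (length-positive-shifts (span S)) (length-⊆ (positive-shifts-unique (span S)) λ e∈ → cover (gap-of (positive-shifts-gap (span S) e∈))))
      (subst (_ ≤_) (length-positive-shifts (span S)) (length-⊆ u λ e∈ →
        ∈-positive-shifts (span S) (proj₁ (All.lookup gaps e∈)) (gap-difference (All.lookup gaps e∈))))
      where
      gap-of : ∀ {e} → Gap (elements (span S)) e → Gap E e
      gap-of (0e , a , b , a∈ , b∈ , eq) with ∈-elements⁻ (span S) a∈ | ∈-elements⁻ (span S) b∈
      ... | i , refl , p | j , refl , q = 0e , + i , + j , At-span⇒∈ p , At-span⇒∈ q , eq

  map-unique : ∀ {A B : Set} (f : A → B) {xs} → Unique xs → (∀ {x y} → x ∈ xs → y ∈ xs → f x ≡ f y → x ≡ y) → Unique (map f xs)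
  map-unique f [] inj = []
  map-unique f (x∉ ∷ u) inj =
    AllP.map⁺ (All.tabulate λ y∈ e → All.lookup x∉ y∈ (inj (here refl) (there y∈) e)) ∷ map-unique f u λ x∈ y∈ → inj (there x∈) (there y∈)

  -- Equal subsets may come from codes in different order, so injectivity is phrased by membership
  -- instead of equality of codes.
  ≤-spanning : ∀ {A : Set} n m (xs : List A) (code : A → List ℤ) → Unique xs →
    (∀ {x} → x ∈ xs → ∀ {z} → z ∈ code x → 0ℤ ≺ z × z ≺ + suc n) →
    (∀ {x} → x ∈ xs → spread (span (ofCode n 1 (code x))) ≡ m) →
    (∀ {x y} → x ∈ xs → y ∈ xs → (∀ {z} → z ∈ code x → z ∈ code y) → x ≡ y) →
    length xs ≤ spanning n m
  ≤-spanning {A} n m xs code u inside good inj = subst (_≤ spanning n m) (ListP.length-map (λ x → ofCode n 1 (code x)) xs)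
    (≤-count {n} (λ S → spread (span S) ≟ m) (map-unique (λ x → ofCode n 1 (code x)) u λ x∈ y∈ e → inj x∈ y∈ (transfer x∈ e))
      λ S∈ → ok (∈P.∈-map⁻ (λ x → ofCode n 1 (code x)) S∈))
    where
    ok : ∀ {S} → (∃ λ x → x ∈ xs × S ≡ ofCode n 1 (code x)) → spread (span S) ≡ m
    ok (x , x∈ , refl) = good x∈
    transfer : ∀ {x y} → x ∈ xs → ofCode n 1 (code x) ≡ ofCode n 1 (code y) → ∀ {z} → z ∈ code x → z ∈ code y
    transfer {x} x∈ e {+ suc k} z∈ with inside x∈ z∈
    ... | _ , ℤ.+≤+ (s≤s lt) = At-ofCode⁻ n 1 (subst (λ S → At S k) e (At-ofCode⁺ n 1 lt z∈))
    transfer x∈ e {+ zero} z∈ with inside x∈ z∈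
    ... | ℤ.+≤+ () , _
    transfer x∈ e { -[1+ _ ] } z∈ with inside x∈ z∈
    ... | () , _

-- Families with m = 1, 3, 5, 6 and 8

module Families where

  open LinearArithmetic
  open Configurations
  open Orbits
  open Counting
  open PositiveDifferences
  open Realisation
  open import Data.Integer as ℤ using (ℤ; +_; -[1+_]; _-_; _+_; _≤_; 0ℤ; 1ℤ)
  open import Data.Nat as ℕ using (ℕ; zero; suc; z≤n; s≤s)

  ⟦_⟧ₗ : ∀ {k} → List (Expr k) → Vec ℤ k → List ℤ
  ⟦ es ⟧ₗ ρ = map (λ e → ⟦ e ⟧ₑ ρ) es

  every : ∀ {k} → (Expr k → Formula k) → List (Expr k) → Formula k
  every f [] = con 0ℤ ≡′ con 0ℤ
  every f (e ∷ es) = f e ∧′ every f es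

  every-∈ : ∀ {k} (f : Expr k → Formula k) {es e} ρ → ⟦ every f es ⟧ ρ → e ∈ es → ⟦ f e ⟧ ρ
  every-∈ f ρ (h , hs) (here refl) = h
  every-∈ f ρ (h , hs) (there p) = every-∈ f ρ hs p

  subtractions : ∀ {k} → List (Expr k) → List (Expr k) → List (Expr k)
  subtractions [] bs = []
  subtractions (a ∷ as) bs = map (a ⊖_) bs ++ subtractions as bs

  ∈-subtractions⁺ : ∀ {k as bs} {a b : Expr k} → a ∈ as → b ∈ bs → (a ⊖ b) ∈ subtractions as bs
  ∈-subtractions⁺ {as = a ∷ as} (here refl) b∈ = ∈P.∈-++⁺ˡ (∈P.∈-map⁺ (a ⊖_) b∈)
  ∈-subtractions⁺ {as = a ∷ as} {bs} (there a∈) b∈ = ∈P.∈-++⁺ʳ (map (a ⊖_) bs) (∈-subtractions⁺ a∈ b∈)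

  ∈-subtractions⁻ : ∀ {k} as bs {e : Expr k} → e ∈ subtractions as bs → ∃ λ a → ∃ λ b → a ∈ as × b ∈ bs × e ≡ a ⊖ b
  ∈-subtractions⁻ (a ∷ as) bs e∈ with ∈P.∈-++⁻ (map (a ⊖_) bs) e∈
  ... | inj₁ p with ∈P.∈-map⁻ (a ⊖_) p
  ...   | b , b∈ , refl = a , b , here refl , b∈ , refl
  ∈-subtractions⁻ (a ∷ as) bs e∈ | inj₂ p with ∈-subtractions⁻ as bs p
  ... | a′ , b , a∈ , b∈ , eq = a′ , b , there a∈ , b∈ , eq

  points : ∀ {k} → Expr k → List (Expr k) → List (Expr k)
  points d code = con 0ℤ ∷ d ∷ code

  inside : ∀ {k} → Expr k → List (Expr k) → Formula k
  inside d = every (λ e → con 0ℤ <′ e ∧′ e <′ d)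

  -- All of this is linear in the parameters of the set, so one validity check determines the spread
  -- throughout a family.
  differences-are : ∀ {k} → Expr k → List (Expr k) → List (Expr k) → Formula k
  differences-are d code es = ¬′ coincidence es ∧′
    every (λ e → con 0ℤ <′ e ∧′ e ≡any subtractions (points d code) (points d code)) es ∧′
    every (λ δ → con 0ℤ <′ δ ⇒′ δ ≡any es) (subtractions (points d code) (points d code))

  code-inside : ∀ {k} (φ : Formula k) d code → valid (φ ⇒′ inside d code) ≡ true → ∀ ρ → ⟦ φ ⟧ ρ →
    ∀ {z} → z ∈ ⟦ code ⟧ₗ ρ → 0ℤ ≺ z × z ≺ ⟦ d ⟧ₑ ρ
  code-inside φ d code ok ρ h z∈ with ∈P.∈-map⁻ (λ e → ⟦ e ⟧ₑ ρ) z∈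
  ... | e , e∈ , refl = every-∈ (λ e → con 0ℤ <′ e ∧′ e <′ d) ρ (linear (φ ⇒′ inside d code) ok ρ h) e∈

  spread-code : ∀ {k n} (φ : Formula k) d code es → valid (φ ⇒′ inside d code) ≡ true → valid (φ ⇒′ differences-are d code es) ≡ true →
    ∀ ρ → ⟦ d ⟧ₑ ρ ≡ + suc n → ⟦ φ ⟧ ρ → spread (span (ofCode n 1 (⟦ code ⟧ₗ ρ))) ≡ length es
  spread-code {n = n} φ d code es ok ok′ ρ d≡ h = trans
    (spread-ofCode {n} {⟦ code ⟧ₗ ρ} (λ {z} z∈ → subst (λ w → 0ℤ ≺ z × z ≺ w) d≡ (code-inside φ d code ok ρ h z∈))
      (¬coincidence⇒Unique es ρ (proj₁ facts))
      (All.tabulate λ e∈ → gap-of (∈P.∈-map⁻ value e∈))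
      (λ g → cover g))
    (ListP.length-map value es)
    where
    value = λ e → ⟦ e ⟧ₑ ρ
    Δ = subtractions (points d code) (points d code)
    E = 0ℤ ∷ + suc n ∷ ⟦ code ⟧ₗ ρ
    facts : ⟦ differences-are d code es ⟧ ρ
    facts = linear (φ ⇒′ differences-are d code es) ok′ ρ h
    E≡ : ⟦ points d code ⟧ₗ ρ ≡ E
    E≡ = cong (λ w → 0ℤ ∷ w ∷ ⟦ code ⟧ₗ ρ) d≡
    gap-of : ∀ {z} → (∃ λ e → e ∈ es × z ≡ value e) → Gap E z
    gap-of (e , e∈ , refl) with every-∈ (λ e → con 0ℤ <′ e ∧′ e ≡any Δ) {es} {e} ρ (proj₁ (proj₂ facts)) e∈
    ... | 0e , p with ∈P.∈-map⁻ value (any⇒∈ e Δ ρ p)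
    ...   | δ , δ∈ , eq with ∈-subtractions⁻ (points d code) (points d code) δ∈
    ...     | a , b , a∈ , b∈ , refl = 0e , value a , value b ,
      subst (value a ∈_) E≡ (∈P.∈-map⁺ value a∈) , subst (value b ∈_) E≡ (∈P.∈-map⁺ value b∈) , eq
    cover : ∀ {z} → Gap E z → z ∈ map value es
    cover (0z , a , b , a∈ , b∈ , refl) with ∈P.∈-map⁻ value (subst (a ∈_) (sym E≡) a∈) | ∈P.∈-map⁻ value (subst (b ∈_) (sym E≡) b∈)
    ... | a′ , a′∈ , refl | b′ , b′∈ , refl = any⇒∈ (a′ ⊖ b′) es ρ
      (every-∈ (λ δ → con 0ℤ <′ δ ⇒′ δ ≡any es) {Δ} {a′ ⊖ b′} ρ (proj₂ (proj₂ facts)) (∈-subtractions⁺ a′∈ b′∈) 0z)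

  -- Families are counted by their exceptions; `bad` may well contain more than the actual ones.
  length-filter-≥ : ∀ {A : Set} {P : Pred A 0ℓ} (P? : Decidable P) {xs} bad → Unique xs →
    (∀ {x} → x ∈ xs → ¬ P x → x ∈ bad) → length xs ℕ.≤ length (filter P? xs) ℕ.+ length bad
  length-filter-≥ P? {xs} bad u only = subst (length xs ℕ.≤_) (ListP.length-++ (filter P? xs)) (length-⊆ u place)
    where
    place : ∀ {x} → x ∈ xs → x ∈ filter P? xs ++ bad
    place {x} x∈ with P? x
    ... | yes p = ∈P.∈-++⁺ˡ (∈P.∈-filter⁺ P? x∈ p)
    ... | no ¬p = ∈P.∈-++⁺ʳ (filter P? xs) (only x∈ ¬p)

  -- The nonnegative solution x of k x = z if there is one, otherwise a harmless extra entry in a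
  -- list of exceptions.
  part : ∀ k .{{_ : ℕ.NonZero k}} → ℤ → ℤ
  part k (+ n) = + (n ℕ./ k)
  part k -[1+ _ ] = 0ℤ

  part-unique : ∀ k .{{_ : ℕ.NonZero k}} {x z} → 0ℤ ≤ x → times k x ≡ z → x ≡ part k z
  part-unique k {+ i} _ refl rewrite Orbits.times-+ k i = cong +_ (sym (DivMod.m*n/n≡m i k))

  ints-unique : ∀ k → Unique (ints k)
  ints-unique k = UniqueP.map⁺ (λ { refl → refl }) (UniqueP.upTo⁺ k)

  length-ints : ∀ k → length (ints k) ≡ k
  length-ints k = trans (ListP.length-map (λ i → + suc i) (upTo k)) (ListP.length-upTo k)

  ∈-ints⁻ : ∀ {k x} → x ∈ ints k → 0ℤ ≺ x × x ≤ + k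
  ∈-ints⁻ x∈ with ∈P.∈-map⁻ (λ i → + suc i) x∈
  ... | i , i∈ , refl = ℤ.+≤+ (s≤s z≤n) , ℤ.+≤+ (∈P.∈-upTo⁻ i∈)

  ∈-halves⁻ : ∀ {n x} → x ∈ ints (n ℕ./ 2) → 0ℤ ≺ x × times 2 x ≤ + n
  ∈-halves⁻ {n} x∈ with ∈P.∈-map⁻ (λ i → + suc i) x∈
  ... | i , i∈ , refl = ℤ.+≤+ (s≤s z≤n) , ℤ.+≤+ (ℕP.≤-trans (ℕP.≤-reflexive (ℕP.*-comm 2 (suc i)))
    (ℕP.≤-trans (ℕP.*-monoˡ-≤ 2 (∈P.∈-upTo⁻ i∈)) (DivMod.m/n*n≤m n 2)))

  spanning-1 : ∀ n → 1 ℕ.≤ spanning n 1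
  spanning-1 n = ≤-spanning n 1 (0ℤ ∷ []) (λ _ → []) ([] ∷ []) (λ _ ())
    (λ _ → spread-code {n = n} (con 0ℤ <′ x₀) x₀ [] (x₀ ∷ []) refl refl (+ suc n ∷ []) refl (ℤ.+≤+ (s≤s z≤n)))
    λ { (here refl) (here refl) _ → refl }

  module _ (n : ℕ) where

    private
      d : ℤ
      d = + suc n

      n≺d : + n ≺ d
      n≺d = ℤ.+≤+ ℕP.≤-refl

    φ₃ : Formula 2
    φ₃ = Orbits.interior x₁ x₀

    family₃ : List ℤ
    family₃ = filter (λ x → decide φ₃ (x ∷ d ∷ [])) (ints n)

    family₃-good : ∀ {x} → x ∈ family₃ → ⟦ φ₃ ⟧ (x ∷ d ∷ [])
    family₃-good x∈ = proj₂ (∈P.∈-filter⁻ (λ x → decide φ₃ (x ∷ d ∷ [])) {xs = ints n} x∈)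

    family₃-≤ : length family₃ ℕ.≤ spanning n 3
    family₃-≤ = ≤-spanning n 3 family₃ (λ x → x ∷ []) (UniqueP.filter⁺ (λ x → decide φ₃ (x ∷ d ∷ [])) (ints-unique n))
      (λ {x} x∈ → code-inside φ₃ x₁ (x₀ ∷ []) refl (x ∷ d ∷ []) (family₃-good x∈))
      (λ {x} x∈ → spread-code {n = n} φ₃ x₁ (x₀ ∷ []) (x₁ ∷ x₀ ∷ x₁ ⊖ x₀ ∷ []) refl refl (x ∷ d ∷ []) refl (family₃-good x∈))
      λ {x} {y} _ _ sub → same (sub (here refl))
      where
      same : ∀ {x y : ℤ} → x ∈ y ∷ [] → x ≡ y
      same (here e) = e

    length-family₃ : n ℕ.≤ length family₃ ℕ.+ 1
    length-family₃ = subst (ℕ._≤ length family₃ ℕ.+ 1) (length-ints n)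
      (length-filter-≥ (λ x → decide φ₃ (x ∷ d ∷ [])) (part 2 d ∷ []) (ints-unique n) bad)
      where
      bad : ∀ {x} → x ∈ ints n → ¬ ⟦ φ₃ ⟧ (x ∷ d ∷ []) → x ∈ part 2 d ∷ []
      bad {x} x∈ h with ∈-ints⁻ x∈
      ... | 0x , xn = here (part-unique 2 (linear (con 0ℤ <′ x₀ ⇒′ con 0ℤ ≤′ x₀) refl (x ∷ []) 0x)
        (linear (con 0ℤ <′ x₀ ⇒′ x₀ ≤′ x₂ ⇒′ x₂ <′ x₁ ⇒′ ¬′ φ₃′ ⇒′ 2 ×′ x₀ ≡′ x₁) refl (x ∷ d ∷ + n ∷ []) 0x xn n≺d h))
        where
        φ₃′ : Formula 3
        φ₃′ = Orbits.interior x₁ x₀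

    -- The set {0, x, 2x, d} has the differences d, x, 2x, d - x, d - 2x; for 0 < 2x < d they
    -- coincide only if 3x = d or 4x = d.
    φ₅ : ∀ {k} → Expr k → Expr k → Formula k
    φ₅ d x = con 0ℤ <′ x ∧′ 2 ×′ x <′ d ∧′ ¬′ (3 ×′ x ≡′ d) ∧′ ¬′ (4 ×′ x ≡′ d)

    multipliers : List ℤ
    multipliers = filter (λ x → decide (φ₅ x₁ x₀) (x ∷ d ∷ [])) (ints (n ℕ./ 2))

    family₅ : List (ℤ ⊎ ℤ)
    family₅ = map inj₁ multipliers ++ map inj₂ multipliers

    code₅ : ℤ ⊎ ℤ → List ℤ
    code₅ (inj₁ x) = x ∷ x + x ∷ []
    code₅ (inj₂ x) = d - x ∷ d - (x + x) ∷ []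

    Good₅ : ℤ ⊎ ℤ → Set
    Good₅ (inj₁ x) = ⟦ φ₅ x₁ x₀ ⟧ (x ∷ d ∷ [])
    Good₅ (inj₂ x) = ⟦ φ₅ x₁ x₀ ⟧ (x ∷ d ∷ [])

    multipliers-good : ∀ {x} → x ∈ multipliers → ⟦ φ₅ x₁ x₀ ⟧ (x ∷ d ∷ [])
    multipliers-good x∈ = proj₂ (∈P.∈-filter⁻ (λ x → decide (φ₅ x₁ x₀) (x ∷ d ∷ [])) {xs = ints (n ℕ./ 2)} x∈)

    family₅-good : ∀ {p} → p ∈ family₅ → Good₅ p
    family₅-good p∈ with ∈P.∈-++⁻ (map inj₁ multipliers) p∈
    ... | inj₁ q with ∈P.∈-map⁻ inj₁ q
    ...   | x , x∈ , refl = multipliers-good x∈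
    family₅-good p∈ | inj₂ q with ∈P.∈-map⁻ inj₂ q
    ...   | x , x∈ , refl = multipliers-good x∈

    family₅-≤ : length family₅ ℕ.≤ spanning n 5
    family₅-≤ = ≤-spanning n 5 family₅ code₅
      (UniqueP.++⁺ (UniqueP.map⁺ SumP.inj₁-injective unique) (UniqueP.map⁺ SumP.inj₂-injective unique) sides-differ)
      (λ {p} p∈ → within p (family₅-good p∈)) (λ {p} p∈ → five p (family₅-good p∈))
      λ {p} {q} p∈ q∈ sub → injective p q (family₅-good p∈) (family₅-good q∈) sub
      where
      unique : Unique multipliers
      unique = UniqueP.filter⁺ (λ x → decide (φ₅ x₁ x₀) (x ∷ d ∷ [])) (ints-unique (n ℕ./ 2))
      sides-differ : ∀ {p} → p ∈ map inj₁ multipliers × p ∈ map inj₂ multipliers → ⊥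
      sides-differ (p , q) with ∈P.∈-map⁻ inj₁ p | ∈P.∈-map⁻ inj₂ q
      ... | _ , _ , refl | _ , _ , ()
      left right es : ∀ {k} → Expr k → Expr k → List (Expr k)
      left d x = x ∷ x ⊕ x ∷ []
      right d x = d ⊖ x ∷ d ⊖ (x ⊕ x) ∷ []
      es d x = d ∷ x ∷ x ⊕ x ∷ d ⊖ x ∷ d ⊖ (x ⊕ x) ∷ []
      within : ∀ p → Good₅ p → ∀ {z} → z ∈ code₅ p → 0ℤ ≺ z × z ≺ d
      within (inj₁ x) h = code-inside (φ₅ x₁ x₀) x₁ (left x₁ x₀) refl (x ∷ d ∷ []) h
      within (inj₂ x) h = code-inside (φ₅ x₁ x₀) x₁ (right x₁ x₀) refl (x ∷ d ∷ []) h
      five : ∀ p → Good₅ p → spread (span (ofCode n 1 (code₅ p))) ≡ 5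
      five (inj₁ x) h = spread-code {n = n} (φ₅ x₁ x₀) x₁ (left x₁ x₀) (es x₁ x₀) refl refl (x ∷ d ∷ []) refl h
      five (inj₂ x) h = spread-code {n = n} (φ₅ x₁ x₀) x₁ (right x₁ x₀) (es x₁ x₀) refl refl (x ∷ d ∷ []) refl h
      injective : ∀ p q → Good₅ p → Good₅ q → (∀ {z} → z ∈ code₅ p → z ∈ code₅ q) → p ≡ q
      injective (inj₁ x) (inj₁ y) h h′ sub = cong inj₁ (linear
        (φ₅ x₂ x₀ ⇒′ φ₅ x₂ x₁ ⇒′ x₀ ≡any left x₂ x₁ ⇒′ x₀ ⊕ x₀ ≡any left x₂ x₁ ⇒′ x₀ ≡′ x₁) refl (x ∷ y ∷ d ∷ []) h h′
        (∈⇒any x₀ (left x₂ x₁) (x ∷ y ∷ d ∷ []) (sub (here refl))) (∈⇒any (x₀ ⊕ x₀) (left x₂ x₁) (x ∷ y ∷ d ∷ []) (sub (there (here refl)))))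
      -- From {x, 2x} = {d - y, d - 2y} it follows that 2x = d - y and x = d - 2y, hence 3y = d.
      injective (inj₁ x) (inj₂ y) h h′ sub = ⊥-elim (linear
        (φ₅ x₂ x₀ ⇒′ φ₅ x₂ x₁ ⇒′ x₀ ≡any right x₂ x₁ ⇒′ x₀ ⊕ x₀ ≡any right x₂ x₁ ⇒′ ⊥′) refl (x ∷ y ∷ d ∷ []) h h′
        (∈⇒any x₀ (right x₂ x₁) (x ∷ y ∷ d ∷ []) (sub (here refl))) (∈⇒any (x₀ ⊕ x₀) (right x₂ x₁) (x ∷ y ∷ d ∷ []) (sub (there (here refl)))))
      injective (inj₂ x) (inj₁ y) h h′ sub = ⊥-elim (linear
        (φ₅ x₂ x₀ ⇒′ φ₅ x₂ x₁ ⇒′ x₂ ⊖ x₀ ≡any left x₂ x₁ ⇒′ x₂ ⊖ (x₀ ⊕ x₀) ≡any left x₂ x₁ ⇒′ ⊥′) refl (x ∷ y ∷ d ∷ []) h h′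
        (∈⇒any (x₂ ⊖ x₀) (left x₂ x₁) (x ∷ y ∷ d ∷ []) (sub (here refl))) (∈⇒any (x₂ ⊖ (x₀ ⊕ x₀)) (left x₂ x₁) (x ∷ y ∷ d ∷ []) (sub (there (here refl)))))
      injective (inj₂ x) (inj₂ y) h h′ sub = cong inj₂ (linear
        (φ₅ x₂ x₀ ⇒′ φ₅ x₂ x₁ ⇒′ x₂ ⊖ x₀ ≡any right x₂ x₁ ⇒′ x₂ ⊖ (x₀ ⊕ x₀) ≡any right x₂ x₁ ⇒′ x₀ ≡′ x₁) refl (x ∷ y ∷ d ∷ []) h h′
        (∈⇒any (x₂ ⊖ x₀) (right x₂ x₁) (x ∷ y ∷ d ∷ []) (sub (here refl))) (∈⇒any (x₂ ⊖ (x₀ ⊕ x₀)) (right x₂ x₁) (x ∷ y ∷ d ∷ []) (sub (there (here refl)))))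

    length-multipliers : n ℕ./ 2 ℕ.≤ length multipliers ℕ.+ 2
    length-multipliers = subst (ℕ._≤ length multipliers ℕ.+ 2) (length-ints (n ℕ./ 2))
      (length-filter-≥ (λ x → decide (φ₅ x₁ x₀) (x ∷ d ∷ [])) (part 3 d ∷ part 4 d ∷ []) (ints-unique (n ℕ./ 2)) bad)
      where
      bad : ∀ {x} → x ∈ ints (n ℕ./ 2) → ¬ ⟦ φ₅ x₁ x₀ ⟧ (x ∷ d ∷ []) → x ∈ part 3 d ∷ part 4 d ∷ []
      bad {x} x∈ h with ∈-halves⁻ {n} x∈
      ... | 0x , 2x with linear (con 0ℤ <′ x₀ ⇒′ 2 ×′ x₀ ≤′ x₂ ⇒′ x₂ <′ x₁ ⇒′ ¬′ φ₅ x₁ x₀ ⇒′ con 0ℤ ≤′ x₀ ∧′ (3 ×′ x₀ ≡′ x₁ ∨′ 4 ×′ x₀ ≡′ x₁)) refl (x ∷ d ∷ + n ∷ []) 0x 2x n≺d h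
      ...   | 0≤x , inj₁ e = here (part-unique 3 0≤x e)
      ...   | 0≤x , inj₂ e = there (here (part-unique 4 0≤x e))

  triangle : ℕ → List (ℤ × ℤ)
  triangle zero = []
  triangle (suc k) = map (λ a → a , + suc k) (ints k) ++ triangle k

  ∈-triangle⁻ : ∀ k {a b} → (a , b) ∈ triangle k → (0ℤ ≺ a × a ≺ b) × b ≤ + k
  ∈-triangle⁻ (suc k) p with ∈P.∈-++⁻ (map (λ a → a , + suc k) (ints k)) p
  ... | inj₁ q with ∈P.∈-map⁻ (λ a → a , + suc k) q
  ...   | a , a∈ , refl with ∈-ints⁻ a∈
  ...     | 0a , ak = (0a , ℤP.+-monoʳ-≤ 1ℤ ak) , ℤP.≤-refl
  ∈-triangle⁻ (suc k) p | inj₂ q with ∈-triangle⁻ k q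
  ... | h , bk = h , ℤP.≤-trans bk (ℤ.+≤+ (ℕP.n≤1+n k))

  triangle-unique : ∀ k → Unique (triangle k)
  triangle-unique zero = []
  triangle-unique (suc k) = UniqueP.++⁺ (UniqueP.map⁺ (λ { refl → refl }) (ints-unique k)) (triangle-unique k) rows-differ
    where
    rows-differ : ∀ {p} → p ∈ map (λ a → a , + suc k) (ints k) × p ∈ triangle k → ⊥
    rows-differ (p , q) with ∈P.∈-map⁻ (λ a → a , + suc k) p
    ... | a , a∈ , refl = ℕP.<-irrefl refl (ℤP.drop‿+≤+ (proj₂ (∈-triangle⁻ k q)))

  -- Row b = k + 1 of the triangle has k entries, of which at most four are lost unless 2b = d.
  row-sum : ℕ → ℕ
  row-sum zero = 0
  row-sum (suc k) = (k ℕ.∸ 4) ℕ.+ row-sum k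

  module _ (n : ℕ) where

    private
      d : ℤ
      d = + suc n

      n≺d : + n ≺ d
      n≺d = ℤ.+≤+ ℕP.≤-refl

    -- The excluded equations are the coincidences among d, a, b, d - a, d - b, b - a.
    φ₆ : ∀ {k} → Expr k → Expr k → Expr k → Formula k
    φ₆ d a b = con 0ℤ <′ a ∧′ a <′ b ∧′ b <′ d ∧′ ¬′ (a ⊕ a ≡′ b) ∧′ ¬′ (a ⊕ b ≡′ d) ∧′ ¬′ (b ⊕ b ≡′ a ⊕ d) ∧′ ¬′ (a ⊕ a ≡′ d) ∧′ ¬′ (b ⊕ b ≡′ d)

    good₆? : Decidable (λ (p : ℤ × ℤ) → ⟦ φ₆ x₂ x₀ x₁ ⟧ (proj₁ p ∷ proj₂ p ∷ d ∷ []))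
    good₆? (a , b) = decide (φ₆ x₂ x₀ x₁) (a ∷ b ∷ d ∷ [])

    family₆ : List (ℤ × ℤ)
    family₆ = filter good₆? (triangle n)

    family₆-≤ : length family₆ ℕ.≤ spanning n 6
    family₆-≤ = ≤-spanning n 6 family₆ code (UniqueP.filter⁺ good₆? (triangle-unique n))
      (λ {p} p∈ → code-inside (φ₆ x₂ x₀ x₁) x₂ (x₀ ∷ x₁ ∷ []) refl (proj₁ p ∷ proj₂ p ∷ d ∷ []) (good p∈))
      (λ {p} p∈ → spread-code {n = n} (φ₆ x₂ x₀ x₁) x₂ (x₀ ∷ x₁ ∷ []) (x₂ ∷ x₀ ∷ x₁ ∷ x₂ ⊖ x₀ ∷ x₂ ⊖ x₁ ∷ x₁ ⊖ x₀ ∷ []) refl refl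
        (proj₁ p ∷ proj₂ p ∷ d ∷ []) refl (good p∈))
      λ {p} {q} p∈ q∈ sub → injective p q (good p∈) (good q∈) sub
      where
      code : ℤ × ℤ → List ℤ
      code (a , b) = a ∷ b ∷ []
      good : ∀ {p} → p ∈ family₆ → ⟦ φ₆ x₂ x₀ x₁ ⟧ (proj₁ p ∷ proj₂ p ∷ d ∷ [])
      good p∈ = proj₂ (∈P.∈-filter⁻ good₆? {xs = triangle n} p∈)
      injective : ∀ p q → ⟦ φ₆ x₂ x₀ x₁ ⟧ (proj₁ p ∷ proj₂ p ∷ d ∷ []) → ⟦ φ₆ x₂ x₀ x₁ ⟧ (proj₁ q ∷ proj₂ q ∷ d ∷ []) →
        (∀ {z} → z ∈ code p → z ∈ code q) → p ≡ q
      injective (a , b) (a′ , b′) h h′ sub with linear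
        (φ₆ x₄ x₀ x₁ ⇒′ φ₆ x₄ x₂ x₃ ⇒′ x₀ ≡any (x₂ ∷ x₃ ∷ []) ⇒′ x₁ ≡any (x₂ ∷ x₃ ∷ []) ⇒′ x₀ ≡′ x₂ ∧′ x₁ ≡′ x₃) refl (a ∷ b ∷ a′ ∷ b′ ∷ d ∷ [])
        h h′ (∈⇒any x₀ (x₂ ∷ x₃ ∷ []) (a ∷ b ∷ a′ ∷ b′ ∷ d ∷ []) (sub (here refl)))
        (∈⇒any x₁ (x₂ ∷ x₃ ∷ []) (a ∷ b ∷ a′ ∷ b′ ∷ d ∷ []) (sub (there (here refl))))
      ... | refl , refl = refl

    length-filter-triangle : ∀ k → length (filter good₆? (triangle (suc k))) ≡
      length (filter (λ a → good₆? (a , + suc k)) (ints k)) ℕ.+ length (filter good₆? (triangle k))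
    length-filter-triangle k = trans (cong length (ListP.filter-++ good₆? (map (λ a → a , + suc k) (ints k)) (triangle k)))
      (trans (ListP.length-++ (filter good₆? (map (λ a → a , + suc k) (ints k))))
        (cong (ℕ._+ length (filter good₆? (triangle k))) (length-filter-map (λ a → a , + suc k) good₆? (ints k))))

    -- For fixed b the losses are a = b/2, d - b, 2b - d and d/2. The condition 2b ≠ d concerns the
    -- row as a whole.
    row-bound : ∀ k → k ℕ.< n → times 2 (+ suc k) ≢ d → k ℕ.∸ 4 ℕ.≤ length (filter (λ a → good₆? (a , + suc k)) (ints k))
    row-bound k k<n 2b = ℕP.m≤n+o⇒m∸n≤o k 4 (ℕP.≤-trans
      (subst (ℕ._≤ length (filter (λ a → good₆? (a , b)) (ints k)) ℕ.+ 4) (length-ints k)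
        (length-filter-≥ (λ a → good₆? (a , b)) (part 2 b ∷ d - b ∷ b + b - d ∷ part 2 d ∷ []) (ints-unique k) bad))
      (ℕP.≤-reflexive (ℕP.+-comm (length (filter (λ a → good₆? (a , b)) (ints k))) 4)))
      where
      b : ℤ
      b = + suc k
      bad : ∀ {a} → a ∈ ints k → ¬ ⟦ φ₆ x₂ x₀ x₁ ⟧ (a ∷ b ∷ d ∷ []) → a ∈ part 2 b ∷ d - b ∷ b + b - d ∷ part 2 d ∷ []
      bad {a} a∈ h with ∈-ints⁻ a∈
      ... | 0a , ak with linear
        (con 0ℤ <′ x₀ ⇒′ x₀ <′ x₁ ⇒′ x₁ <′ x₂ ⇒′ ¬′ (2 ×′ x₁ ≡′ x₂) ⇒′ ¬′ φ₆ x₂ x₀ x₁ ⇒′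
          con 0ℤ ≤′ x₀ ∧′ (2 ×′ x₀ ≡′ x₁ ∨′ x₀ ≡′ x₂ ⊖ x₁ ∨′ x₀ ≡′ x₁ ⊕ x₁ ⊖ x₂ ∨′ 2 ×′ x₀ ≡′ x₂))
        refl (a ∷ b ∷ d ∷ []) 0a (ℤP.+-monoʳ-≤ 1ℤ ak) (ℤ.+≤+ (s≤s k<n)) 2b h
      ...   | 0≤a , inj₁ e = here (part-unique 2 0≤a e)
      ...   | 0≤a , inj₂ (inj₁ e) = there (here e)
      ...   | 0≤a , inj₂ (inj₂ (inj₁ e)) = there (there (here e))
      ...   | 0≤a , inj₂ (inj₂ (inj₂ e)) = there (there (there (here (part-unique 2 0≤a e))))

    -- No row with 2b < d is lost as a whole. In `up-to`, the allowance n is therefore still unspent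
    -- when the row 2b = d is reached.
    below-middle : ∀ k → k ℕ.≤ n → times 2 (+ k) ≺ d → row-sum k ℕ.≤ length (filter good₆? (triangle k))
    below-middle zero _ _ = z≤n
    below-middle (suc k) k<n 2k = subst (row-sum (suc k) ℕ.≤_) (sym (length-filter-triangle k))
      (ℕP.+-mono-≤ (row-bound k k<n (linear (2 ×′ x₀ <′ x₁ ⇒′ ¬′ (2 ×′ x₀ ≡′ x₁)) refl (+ suc k ∷ d ∷ []) 2k))
        (below-middle k (ℕP.<⇒≤ k<n) (linear (x₀ ≡′ con 1ℤ ⊕ x₁ ⇒′ 2 ×′ x₀ <′ x₂ ⇒′ 2 ×′ x₁ <′ x₂) refl (+ suc k ∷ + k ∷ d ∷ []) refl 2k)))

    -- At most one row, namely 2b = d, is lost altogether.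
    up-to : ∀ k → k ℕ.≤ n → row-sum k ℕ.≤ length (filter good₆? (triangle k)) ℕ.+ n
    up-to zero _ = z≤n
    up-to (suc k) k<n with times 2 (+ suc k) ℤP.≟ d
    ... | no 2b = subst (row-sum (suc k) ℕ.≤_)
      (trans (sym (ℕP.+-assoc (length (filter (λ a → good₆? (a , + suc k)) (ints k))) _ n)) (cong (ℕ._+ n) (sym (length-filter-triangle k))))
      (ℕP.+-mono-≤ (row-bound k k<n 2b) (up-to k (ℕP.<⇒≤ k<n)))
    ... | yes 2b = ℕP.≤-trans
      (ℕP.+-mono-≤ (ℕP.≤-trans (ℕP.m∸n≤m k 4) (ℕP.<⇒≤ k<n))
        (ℕP.≤-trans (below-middle k (ℕP.<⇒≤ k<n) (linear (x₀ ≡′ con 1ℤ ⊕ x₁ ⇒′ 2 ×′ x₀ ≡′ x₂ ⇒′ 2 ×′ x₁ <′ x₂) refl (+ suc k ∷ + k ∷ d ∷ []) refl 2b))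
          (ℕP.≤-trans (ℕP.m≤n+m _ (length (filter (λ a → good₆? (a , + suc k)) (ints k)))) (ℕP.≤-reflexive (sym (length-filter-triangle k))))))
      (ℕP.≤-reflexive (ℕP.+-comm n _))

    length-family₆ : row-sum n ℕ.≤ length family₆ ℕ.+ n
    length-family₆ = up-to n ℕP.≤-refl

    -- The eight differences of {0, x, d - x, y, d} are d, x, d - x, y, d - y, d - 2x and the
    -- distances from y to x and to d - x. Apart from the relations of `lateral`, y has to avoid x,
    -- d - x and d/2.
    φ₈ : ∀ {k} → Expr k → Expr k → Expr k → Formula k
    φ₈ d x y = (con 0ℤ <′ x ∧′ 2 ×′ x <′ d ∧′ ¬′ (3 ×′ x ≡′ d)) ∧′ (con 0ℤ <′ y ∧′ y <′ d) ∧′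
      ¬′ (y ≡′ x) ∧′ ¬′ (y ⊕ x ≡′ d) ∧′ ¬′ (y ⊕ d ≡′ 3 ×′ x) ∧′ ¬′ (y ⊕ 3 ×′ x ≡′ 2 ×′ d) ∧′ ¬′ (y ≡′ 2 ×′ x) ∧′ ¬′ (y ⊕ 2 ×′ x ≡′ d) ∧′
      ¬′ (2 ×′ y ≡′ d) ∧′ ¬′ (2 ×′ y ≡′ x) ∧′ ¬′ (2 ×′ y ⊕ x ≡′ 2 ×′ d) ∧′ ¬′ (2 ×′ y ≡′ d ⊕ x) ∧′ ¬′ (2 ×′ y ⊕ x ≡′ d)

    good₈? : Decidable (λ (p : ℤ × ℤ) → ⟦ φ₈ x₂ x₀ x₁ ⟧ (proj₁ p ∷ proj₂ p ∷ d ∷ []))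
    good₈? (x , y) = decide (φ₈ x₂ x₀ x₁) (x ∷ y ∷ d ∷ [])

    bases : List ℤ
    bases = filter (λ x → decide (¬′ (3 ×′ x₀ ≡′ x₁)) (x ∷ d ∷ [])) (ints (n ℕ./ 2))

    bases-unique : Unique bases
    bases-unique = UniqueP.filter⁺ (λ x → decide (¬′ (3 ×′ x₀ ≡′ x₁)) (x ∷ d ∷ [])) (ints-unique (n ℕ./ 2))

    family₈ : List (ℤ × ℤ)
    family₈ = filter good₈? (cartesianProduct bases (ints n))

    family₈-≤ : length family₈ ℕ.≤ spanning n 8
    family₈-≤ = ≤-spanning n 8 family₈ code (UniqueP.filter⁺ good₈? (UniqueP.cartesianProduct⁺ bases-unique (ints-unique n)))
      (λ {p} p∈ → code-inside (φ₈ x₂ x₀ x₁) x₂ points₈ refl (proj₁ p ∷ proj₂ p ∷ d ∷ []) (good p∈))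
      (λ {p} p∈ → eight p (good p∈))
      λ {p} {q} p∈ q∈ sub → injective p q (good p∈) (good q∈) sub
      where
      points₈ : List (Expr 3)
      points₈ = x₀ ∷ x₂ ⊖ x₀ ∷ x₁ ∷ []
      code : ℤ × ℤ → List ℤ
      code (x , y) = x ∷ d - x ∷ y ∷ []
      good : ∀ {p} → p ∈ family₈ → ⟦ φ₈ x₂ x₀ x₁ ⟧ (proj₁ p ∷ proj₂ p ∷ d ∷ [])
      good p∈ = proj₂ (∈P.∈-filter⁻ good₈? {xs = cartesianProduct bases (ints n)} p∈)
      eight : ∀ p → ⟦ φ₈ x₂ x₀ x₁ ⟧ (proj₁ p ∷ proj₂ p ∷ d ∷ []) → spread (span (ofCode n 1 (code p))) ≡ 8
      -- The position of y relative to x and d - x fixes the signs of the last two differences.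
      eight (x , y) h with linear
        (φ₈ x₂ x₀ x₁ ⇒′ x₁ <′ x₀ ∨′ (x₀ <′ x₁ ∧′ x₁ ⊕ x₀ <′ x₂) ∨′ x₂ <′ x₁ ⊕ x₀) refl (x ∷ y ∷ d ∷ []) h
      ... | inj₁ l = spread-code {n = n} (φ₈ x₂ x₀ x₁ ∧′ x₁ <′ x₀) x₂ points₈
        (x₂ ∷ x₀ ∷ x₂ ⊖ x₀ ∷ x₁ ∷ x₂ ⊖ x₁ ∷ x₂ ⊖ x₀ ⊖ x₀ ∷ x₀ ⊖ x₁ ∷ x₂ ⊖ x₀ ⊖ x₁ ∷ []) refl refl (x ∷ y ∷ d ∷ []) refl (h , l)
      ... | inj₂ (inj₁ l) = spread-code {n = n} (φ₈ x₂ x₀ x₁ ∧′ x₀ <′ x₁ ∧′ x₁ ⊕ x₀ <′ x₂) x₂ points₈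
        (x₂ ∷ x₀ ∷ x₂ ⊖ x₀ ∷ x₁ ∷ x₂ ⊖ x₁ ∷ x₂ ⊖ x₀ ⊖ x₀ ∷ x₁ ⊖ x₀ ∷ x₂ ⊖ x₀ ⊖ x₁ ∷ []) refl refl (x ∷ y ∷ d ∷ []) refl (h , l)
      ... | inj₂ (inj₂ l) = spread-code {n = n} (φ₈ x₂ x₀ x₁ ∧′ x₂ <′ x₁ ⊕ x₀) x₂ points₈
        (x₂ ∷ x₀ ∷ x₂ ⊖ x₀ ∷ x₁ ∷ x₂ ⊖ x₁ ∷ x₂ ⊖ x₀ ⊖ x₀ ∷ x₁ ⊖ x₀ ∷ x₁ ⊖ (x₂ ⊖ x₀) ∷ []) refl refl (x ∷ y ∷ d ∷ []) refl (h , l)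
      injective : ∀ p q → ⟦ φ₈ x₂ x₀ x₁ ⟧ (proj₁ p ∷ proj₂ p ∷ d ∷ []) → ⟦ φ₈ x₂ x₀ x₁ ⟧ (proj₁ q ∷ proj₂ q ∷ d ∷ []) →
        (∀ {z} → z ∈ code p → z ∈ code q) → p ≡ q
      injective (x , y) (x′ , y′) h h′ sub with linear
        (φ₈ x₄ x₀ x₁ ⇒′ φ₈ x₄ x₂ x₃ ⇒′ x₀ ≡any others ⇒′ x₄ ⊖ x₀ ≡any others ⇒′ x₁ ≡any others ⇒′ x₀ ≡′ x₂ ∧′ x₁ ≡′ x₃) refl ρ
        h h′ (∈⇒any x₀ others ρ (sub (here refl))) (∈⇒any (x₄ ⊖ x₀) others ρ (sub (there (here refl)))) (∈⇒any x₁ others ρ (sub (there (there (here refl)))))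
        where
        ρ = x ∷ y ∷ x′ ∷ y′ ∷ d ∷ []
        others : List (Expr 5)
        others = x₂ ∷ x₄ ⊖ x₂ ∷ x₃ ∷ []
      ... | refl , refl = refl

    length-bases : n ℕ./ 2 ℕ.≤ length bases ℕ.+ 1
    length-bases = subst (ℕ._≤ length bases ℕ.+ 1) (length-ints (n ℕ./ 2))
      (length-filter-≥ (λ x → decide (¬′ (3 ×′ x₀ ≡′ x₁)) (x ∷ d ∷ [])) (part 3 d ∷ []) (ints-unique (n ℕ./ 2)) bad)
      where
      bad : ∀ {x} → x ∈ ints (n ℕ./ 2) → ¬ ⟦ ¬′ (3 ×′ x₀ ≡′ x₁) ⟧ (x ∷ d ∷ []) → x ∈ part 3 d ∷ []
      bad {x} x∈ h with ∈-halves⁻ {n} x∈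
      ... | 0x , _ = here (part-unique 3 (linear (con 0ℤ <′ x₀ ⇒′ con 0ℤ ≤′ x₀) refl (x ∷ []) 0x)
        (linear (¬′ ¬′ (3 ×′ x₀ ≡′ x₁) ⇒′ 3 ×′ x₀ ≡′ x₁) refl (x ∷ d ∷ []) h))

    -- For fixed x eleven equations exclude one y each: six with coefficient 1 and five with
    -- coefficient 2.
    column-bound : ∀ {x} → x ∈ bases → n ℕ.∸ 11 ℕ.≤ length (filter (λ y → good₈? (x , y)) (ints n))
    column-bound {x} x∈ = ℕP.m≤n+o⇒m∸n≤o n 11 (ℕP.≤-trans
      (subst (ℕ._≤ length (filter (λ y → good₈? (x , y)) (ints n)) ℕ.+ 11) (length-ints n)
        (length-filter-≥ (λ y → good₈? (x , y)) bads (ints-unique n) bad))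
      (ℕP.≤-reflexive (ℕP.+-comm (length (filter (λ y → good₈? (x , y)) (ints n))) 11)))
      where
      whole : List (Expr 3)
      whole = x₀ ∷ x₂ ⊖ x₀ ∷ 3 ×′ x₀ ⊖ x₂ ∷ 2 ×′ x₂ ⊖ 3 ×′ x₀ ∷ 2 ×′ x₀ ∷ x₂ ⊖ 2 ×′ x₀ ∷ []
      bads : List ℤ
      -- The expressions in `whole` do not mention y, whose place in the environment is filled by 0.
      bads = ⟦ whole ⟧ₗ (x ∷ 0ℤ ∷ d ∷ []) ++ part 2 d ∷ part 2 x ∷ part 2 (d + (d - x)) ∷ part 2 (d + x) ∷ part 2 (d - x) ∷ []
      bad : ∀ {y} → y ∈ ints n → ¬ ⟦ φ₈ x₂ x₀ x₁ ⟧ (x ∷ y ∷ d ∷ []) → y ∈ bads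
      bad {y} y∈ h with ∈-ints⁻ y∈ | ∈P.∈-filter⁻ (λ x → decide (¬′ (3 ×′ x₀ ≡′ x₁)) (x ∷ d ∷ [])) {xs = ints (n ℕ./ 2)} x∈
      ... | 0y , yn | x∈′ , 3x with ∈-halves⁻ {n} x∈′
      ...   | 0x , 2x with linear
        (con 0ℤ <′ x₀ ⇒′ 2 ×′ x₀ ≤′ x₃ ⇒′ x₃ <′ x₂ ⇒′ ¬′ (3 ×′ x₀ ≡′ x₂) ⇒′ con 0ℤ <′ x₁ ⇒′ x₁ ≤′ x₃ ⇒′ ¬′ φ₈ x₂ x₀ x₁ ⇒′
          con 0ℤ ≤′ x₁ ∧′ (x₁ ≡any (x₀ ∷ x₂ ⊖ x₀ ∷ 3 ×′ x₀ ⊖ x₂ ∷ 2 ×′ x₂ ⊖ 3 ×′ x₀ ∷ 2 ×′ x₀ ∷ x₂ ⊖ 2 ×′ x₀ ∷ []) ∨′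
            2 ×′ x₁ ≡any (x₂ ∷ x₀ ∷ x₂ ⊕ (x₂ ⊖ x₀) ∷ x₂ ⊕ x₀ ∷ x₂ ⊖ x₀ ∷ [])))
        refl (x ∷ y ∷ d ∷ + n ∷ []) 0x 2x n≺d 3x 0y yn h
      ...     | 0≤y , inj₁ e = ∈P.∈-++⁺ˡ (any⇒∈ x₁ whole (x ∷ y ∷ d ∷ []) e)
      ...     | 0≤y , inj₂ e = ∈P.∈-++⁺ʳ (⟦ whole ⟧ₗ (x ∷ 0ℤ ∷ d ∷ [])) (halves e)
        where
        halves : ⟦ 2 ×′ x₁ ≡any (x₂ ∷ x₀ ∷ x₂ ⊕ (x₂ ⊖ x₀) ∷ x₂ ⊕ x₀ ∷ x₂ ⊖ x₀ ∷ []) ⟧ (x ∷ y ∷ d ∷ []) →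
          y ∈ part 2 d ∷ part 2 x ∷ part 2 (d + (d - x)) ∷ part 2 (d + x) ∷ part 2 (d - x) ∷ []
        halves (inj₁ e) = here (part-unique 2 0≤y e)
        halves (inj₂ (inj₁ e)) = there (here (part-unique 2 0≤y e))
        halves (inj₂ (inj₂ (inj₁ e))) = there (there (here (part-unique 2 0≤y e)))
        halves (inj₂ (inj₂ (inj₂ (inj₁ e)))) = there (there (there (here (part-unique 2 0≤y e))))
        halves (inj₂ (inj₂ (inj₂ (inj₂ (inj₁ e))))) = there (there (there (there (here (part-unique 2 0≤y e)))))

    length-family₈ : length bases ℕ.* (n ℕ.∸ 11) ℕ.≤ length family₈
    length-family₈ = columns bases (λ x∈ → x∈)
      where
      columns : ∀ xs → (∀ {x} → x ∈ xs → x ∈ bases) → length xs ℕ.* (n ℕ.∸ 11) ℕ.≤ length (filter good₈? (cartesianProduct xs (ints n)))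
      columns [] sub = z≤n
      columns (x ∷ xs) sub = subst (suc (length xs) ℕ.* (n ℕ.∸ 11) ℕ.≤_)
        (sym (trans (cong length (ListP.filter-++ good₈? (map (x ,_) (ints n)) (cartesianProduct xs (ints n))))
          (trans (ListP.length-++ (filter good₈? (map (x ,_) (ints n))))
            (cong (ℕ._+ length (filter good₈? (cartesianProduct xs (ints n)))) (length-filter-map (x ,_) good₈? (ints n))))))
        (ℕP.+-mono-≤ (column-bound (sub (here refl))) (columns xs (sub ∘ there)))

-- Numerical comparison and induction on n

module Comparison where

  open Configurations
  open Orbits
  open Progressions
  open TwoOrbits
  open Classification
  open Counting
  open PositiveDifferences
  open Realisation
  open Families
  open import Data.Integer as ℤ using (ℤ; +_)
  open import Data.Nat as ℕ using (ℕ; zero; suc; _+_; _*_; _∸_; _^_; _/_; _%_; _≤_; _<_; _≤ᵇ_; _<ᵇ_; _≟_; z≤n; s≤s; NonZero)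
  open import Data.Nat.Tactic.RingSolver using (solve-∀)
  import Data.Rational.Unnormalised as ℚ

  length-concatMap-≤ : ∀ {A B : Set} (f : A → List B) k → (∀ x → length (f x) ≤ k) → ∀ xs → length (concatMap f xs) ≤ length xs * k
  length-concatMap-≤ f k h [] = z≤n
  length-concatMap-≤ f k h (x ∷ xs) = ℕP.≤-trans (ℕP.≤-reflexive (ListP.length-++ (f x))) (ℕP.+-mono-≤ (h x) (length-concatMap-≤ f k h xs))

  length-quotients-≤ : ∀ k .{{_ : NonZero k}} N → length (quotients k N) ≤ 1
  length-quotients-≤ k N with does (N / k * k ≟ N)
  ... | true = ℕP.≤-refl
  ... | false = z≤n

  length-concatMap-quotients : ∀ {B : Set} k .{{_ : NonZero k}} N (f : ℤ → List B) c → (∀ x → length (f x) ≤ c) → length (concatMap f (quotients k N)) ≤ c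
  length-concatMap-quotients k N f c h = ℕP.≤-trans (length-concatMap-≤ f c h (quotients k N))
    (ℕP.≤-trans (ℕP.*-monoˡ-≤ c (length-quotients-≤ k N)) (ℕP.≤-reflexive (ℕP.*-identityˡ c)))

  length-concatMap-ints : ∀ {B : Set} k (f : ℤ → List B) c → (∀ x → length (f x) ≤ c) → length (concatMap f (ints k)) ≤ k * c
  length-concatMap-ints k f c h = subst (λ j → length (concatMap f (ints k)) ≤ j * c) (length-ints k) (length-concatMap-≤ f c h (ints k))

  length-++-≤ : ∀ {A : Set} (xs : List A) {ys a b} → length xs ≤ a → length ys ≤ b → length (xs ++ ys) ≤ a + b
  length-++-≤ xs p q = ℕP.≤-trans (ℕP.≤-reflexive (ListP.length-++ xs)) (ℕP.+-mono-≤ p q)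

  length-isolated : ∀ N → length (isolated N) ≤ 2
  length-isolated N = s≤s (ℕP.≤-trans (ℕP.≤-reflexive (ListP.length-map _ (quotients 2 N))) (length-quotients-≤ 2 N))

  length-progressions : ∀ N → length (progressions N) ≤ N / 2 * 4
  length-progressions N = length-concatMap-ints (N / 2) (progression (+ N)) 4 (λ p → ℕP.≤-refl)

  length-chains : ∀ N → length (chains N) ≤ (N / 2 * 4 + N / 2 * 4) + 64
  length-chains N = length-++-≤ (progressions N ++ mirrored (+ N) (progressions N))
    (length-++-≤ (progressions N) (length-progressions N) (ℕP.≤-trans (ℕP.≤-reflexive (ListP.length-map _ (progressions N))) (length-progressions N)))
    (length-concatMap-quotients 7 N (λ e → extensions [] (multiples e)) 64 (λ e → ℕP.≤-refl))

  length-centrals : ∀ N → length (centrals N) ≤ N / 4 * 16 + 32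
  length-centrals N = length-++-≤ (concatMap (λ h → concatMap (around (+ N) h) (ints (N / 4))) (quotients 2 N))
    (length-concatMap-quotients 2 N (λ h → concatMap (around (+ N) h) (ints (N / 4))) (N / 4 * 16)
      (λ h → length-concatMap-ints (N / 4) (around (+ N) h) 16 (λ x → ℕP.≤-refl)))
    (length-concatMap-quotients 8 N eighths 32 (λ e → ℕP.≤-refl))

  length-laterals : ∀ N → length (laterals N) ≤ N / 2 * 11
  length-laterals N = length-concatMap-ints (N / 2) (laterals₁ N) 11 λ t →
    -- The first three families have 3 + 2 + 3 members for each t; the one with 3x = d adds at most
    -- 3.
    ℕP.+-monoʳ-≤ 8 (length-concatMap-quotients 3 N (λ x → twoSided (+ N) x t) 3 (λ x → ℕP.≤-refl))

  -- The slope 4/2 + 4/2 + 16/4 + 11/2 = 13.5 is rounded up to 14. The constant collects 2 from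
  -- `isolated`, 64 = 2^6 from the multiples of d/7 and 32 = 2 · 2^4 from those of d/8.
  length-candidates₇ : ∀ N → length (candidates₇ N) ≤ 14 * N + 98
  length-candidates₇ N = begin
    length (candidates₇ N)
      ≤⟨ length-++-≤ (isolated N) (length-isolated N) (length-++-≤ (chains N) (length-chains N) (length-++-≤ (centrals N) (length-centrals N) (length-laterals N))) ⟩
    2 + ((N / 2 * 4 + N / 2 * 4 + 64) + (N / 4 * 16 + 32 + N / 2 * 11))
      ≡⟨ collect (N / 2) (N / 4) ⟩
    (N / 2 * 2) * 9 + N / 2 + N / 4 * 4 * 4 + 98
      ≤⟨ ℕP.+-monoˡ-≤ 98 (ℕP.+-mono-≤ (ℕP.+-mono-≤ (ℕP.*-monoˡ-≤ 9 (DivMod.m/n*n≤m N 2)) (DivMod.m/n≤m N 2)) (ℕP.*-monoˡ-≤ 4 (DivMod.m/n*n≤m N 4))) ⟩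
    N * 9 + N + N * 4 + 98
      ≡⟨ total-of N ⟩
    14 * N + 98 ∎
    where
    open ℕP.≤-Reasoning
    collect : ∀ a b → 2 + ((a * 4 + a * 4 + 64) + (b * 16 + 32 + a * 11)) ≡ (a * 2) * 9 + a + b * 4 * 4 + 98
    collect = solve-∀
    total-of : ∀ a → a * 9 + a + a * 4 + 98 ≡ 14 * a + 98
    total-of = solve-∀

  length-candidates₄ : ∀ N → length (candidates₄ N) ≤ N / 2 + 10
  length-candidates₄ N = begin
    length (candidates₄ N)
      ≤⟨ length-++-≤ (isolated N) (length-isolated N) (length-++-≤ (map (λ t → t ∷ + N ℤ.- t ∷ []) (ints (N / 2)))
          (ℕP.≤-reflexive (trans (ListP.length-map _ (ints (N / 2))) (length-ints (N / 2))))
          (length-concatMap-quotients 4 N (λ e → extensions [] (e ∷ times 2 e ∷ times 3 e ∷ [])) 8 (λ e → ℕP.≤-refl))) ⟩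
    2 + (N / 2 + 8)
      ≡⟨ collect (N / 2) ⟩
    N / 2 + 10 ∎
    where
    open ℕP.≤-Reasoning
    collect : ∀ a → 2 + (a + 8) ≡ a + 10
    collect = solve-∀

  spanning-2≤1 : ∀ n → spanning n 2 ≤ 1
  spanning-2≤1 n = ℕP.≤-trans (spanning-≤′ n 2 (candidates₂ (suc n)) classify₂)
    (ℕP.≤-trans (ℕP.≤-reflexive (ListP.length-map _ (quotients 2 (suc n)))) (length-quotients-≤ 2 (suc n)))

  upper₄ upper₇ : ℕ → ℕ
  upper₄ n = length (realised n 4 (candidates₄ (suc n)))
  upper₇ n = length (realised n 7 (candidates₇ (suc n)))

  below-both : ℕ → ℕ → ℕ → Bool
  below-both u a b = (u ≤ᵇ a) ∧ (u ≤ᵇ b)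

  small₄ small₇ : ℕ → Bool
  small₄ n = below-both (upper₄ n) (length (family₃ n)) (length (family₅ n))
  small₇ n = below-both (upper₇ n) (length (family₆ n)) (length (family₈ n))

  holds-from : (ℕ → Bool) → ℕ → ℕ → Bool
  holds-from p zero i = true
  holds-from p (suc k) i = p i ∧ holds-from p k (suc i)

  holds-from-sound : ∀ p k i n → holds-from p k i ≡ true → i ≤ n → n < i + k → p n ≡ true
  holds-from-sound p zero i n h i≤n n<i = ⊥-elim (ℕP.<⇒≱ n<i (subst (_≤ n) (sym (ℕP.+-identityʳ i)) i≤n))
  holds-from-sound p (suc k) i n h i≤n n<i with p i in eq
  ... | true with ℕP.m≤n⇒m<n∨m≡n i≤n
  ...   | inj₁ i<n = holds-from-sound p k (suc i) n h i<n (subst (n <_) (ℕP.+-suc i k) n<i)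
  ...   | inj₂ refl = eq

  -- This covers n = 12, ..., 48, that is, d ≤ 49.
  small₄-computed : holds-from small₄ 37 12 ≡ true
  small₄-computed = refl

  -- This covers n = 14, ..., 48; for m = 7 the values 12 and 13 are left to full enumeration.
  small₇-computed : holds-from small₇ 35 14 ≡ true
  small₇-computed = refl

  below-both-sound : ∀ u a b → below-both u a b ≡ true → u ≤ a × u ≤ b
  below-both-sound u a b h with u ≤ᵇ a in p
  ... | true = ℕP.≤ᵇ⇒≤ u a (subst T (sym p) _) , ℕP.≤ᵇ⇒≤ u b (subst T (sym h) _)

  -- Here f m counts sets with m positive differences, that is, with |S − S| = 2 m + 1.
  record Wavy (_R_ : ℕ → ℕ → Set) (f : ℕ → ℕ) : Set where
    constructor wavy
    field
      at₂ : f 2 R f 1 × f 2 R f 3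
      at₄ : f 4 R f 3 × f 4 R f 5
      at₇ : f 7 R f 6 × f 7 R f 8

  module _ {R S U : ℕ → ℕ → Set} (h : ∀ {a b c d} → R a b → S c d → U (a + c) (b + d)) where

    wavy-+ : ∀ {f g k} → (∀ m → k m ≡ f m + g m) → Wavy R f → Wavy S g → Wavy U k
    wavy-+ {f} {g} {k} eq (wavy (a , b) (c , d) (e , i)) (wavy (a′ , b′) (c′ , d′) (e′ , i′)) =
      wavy (add a a′ , add b b′) (add c c′ , add d d′) (add e e′ , add i i′)
      where
      add : ∀ {p q} → R (f p) (f q) → S (g p) (g q) → U (k p) (k q)
      add {p} {q} x y = subst₂ U (sym (eq p)) (sym (eq q)) (h x y)

  ∧-true : ∀ a {b} → a ∧ b ≡ true → a ≡ true × b ≡ true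
  ∧-true true h = refl , h

  wavyᵇ : (ℕ → ℕ → Bool) → (ℕ → ℕ) → Bool
  wavyᵇ r f = (r (f 2) (f 1) ∧ r (f 2) (f 3)) ∧ (r (f 4) (f 3) ∧ r (f 4) (f 5)) ∧ (r (f 7) (f 6) ∧ r (f 7) (f 8))

  wavyᵇ-sound : ∀ {R} r → (∀ a b → r a b ≡ true → R a b) → ∀ f → wavyᵇ r f ≡ true → Wavy R f
  wavyᵇ-sound r ok f h with ∧-true (r (f 2) (f 1) ∧ r (f 2) (f 3)) h
  ... | h₁ , h′ with ∧-true (r (f 4) (f 3) ∧ r (f 4) (f 5)) h′
  ...   | h₂ , h₃ = wavy (both h₁) (both h₂) (both h₃)
    where
    both : ∀ {a b c d} → r a b ∧ r c d ≡ true → _ × _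
    both {a} {b} {c} {d} h = ok a b (proj₁ (∧-true (r a b) h)) , ok c d (proj₂ (∧-true (r a b) h))

  -- Every count is read off one list of spreads, so that a single enumeration of the subsets can
  -- serve all values of m.
  occurrences : List ℕ → ℕ → ℕ
  occurrences xs m = length (filter (_≟ m) xs)

  wavy-list : (ℕ → ℕ → Bool) → List ℕ → Bool
  wavy-list r xs = wavyᵇ r (occurrences xs)

  wavy-cong : ∀ {R f g} → (∀ m → f m ≡ g m) → Wavy R f → Wavy R g
  wavy-cong {R} {f} {g} eq (wavy (a , b) (c , d) (e , i)) = wavy (move a , move b) (move c , move d) (move e , move i)
    where
    move : ∀ {p q} → R (f p) (f q) → R (g p) (g q)
    move {p} {q} = subst₂ R (eq p) (eq q)

  count-occurrences : ∀ n (f : Subset n → ℕ) m → occurrences (map f (allSubsets n)) m ≡ count (λ S → f S ≟ m)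
  count-occurrences n f m = length-filter-map f (_≟ m) (allSubsets n)

  <ᵇ-sound : ∀ a b → (a <ᵇ b) ≡ true → a < b
  <ᵇ-sound a b h = ℕP.<ᵇ⇒< a b (subst T (sym h) _)

  ≤ᵇ-sound : ∀ a b → (a ≤ᵇ b) ≡ true → a ≤ b
  ≤ᵇ-sound a b h = ℕP.≤ᵇ⇒≤ a b (subst T (sym h) _)

  counted-wavy : ∀ R r → (∀ a b → r a b ≡ true → R a b) → ∀ n (f : Subset n → ℕ) →
    wavy-list r (map f (allSubsets n)) ≡ true → Wavy R (λ m → count (λ S → f S ≟ m))
  counted-wavy R r ok n f h = wavy-cong {R} (count-occurrences n f) (wavyᵇ-sound {R} r ok (occurrences (map f (allSubsets n))) h)

  total-check : ∀ n → wavy-list _<ᵇ_ (map spread (allSubsets n)) ≡ true → Wavy _<_ (total n)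
  total-check n = counted-wavy _<_ _<ᵇ_ <ᵇ-sound n spread

  leading-check : ∀ n → wavy-list _≤ᵇ_ (map (λ S → spread (true ∷ S)) (allSubsets n)) ≡ true → Wavy _≤_ (leading n)
  leading-check n = counted-wavy _≤_ _≤ᵇ_ ≤ᵇ-sound n (λ S → spread (true ∷ S))

  spanning-check : ∀ n → wavy-list _≤ᵇ_ (map (λ S → spread (span S)) (allSubsets n)) ≡ true → Wavy _≤_ (spanning n)
  spanning-check n = counted-wavy _≤_ _≤ᵇ_ ≤ᵇ-sound n (λ S → spread (span S))

  total-12 : Wavy _<_ (total 12)
  total-12 = total-check 12 refl

  leading-12 : Wavy _≤_ (leading 12)
  leading-12 = leading-check 12 refl

  spanning-12 : Wavy _≤_ (spanning 12)
  spanning-12 = spanning-check 12 refl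

  spanning-13 : Wavy _≤_ (spanning 13)
  spanning-13 = spanning-check 13 refl

  spanning₁₂₃ : ∀ n → 2 ≤ n → spanning n 2 ≤ spanning n 1 × spanning n 2 ≤ spanning n 3
  spanning₁₂₃ n 2≤n = ℕP.≤-trans (spanning-2≤1 n) (spanning-1 n) ,
    ℕP.≤-trans (spanning-2≤1 n) (ℕP.≤-trans (ℕP.+-cancelʳ-≤ 1 1 (length (family₃ n)) (ℕP.≤-trans 2≤n (length-family₃ n))) (family₃-≤ n))

  length-family₅ : ∀ n → length (family₅ n) ≡ length (multipliers n) + length (multipliers n)
  length-family₅ n = trans (ListP.length-++ (map inj₁ (multipliers n))) (cong₂ _+_ (ListP.length-map _ (multipliers n)) (ListP.length-map _ (multipliers n)))

  half-suc : ∀ n → suc n / 2 ≤ suc (n / 2)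
  half-suc n = ℕP.*-cancelʳ-≤ (suc n / 2) (suc (n / 2)) 2 (begin
    suc n / 2 * 2            ≤⟨ DivMod.m/n*n≤m (suc n) 2 ⟩
    suc n                    ≡⟨ cong suc (DivMod.m≡m%n+[m/n]*n n 2) ⟩
    suc (n % 2) + n / 2 * 2  ≤⟨ ℕP.+-monoˡ-≤ (n / 2 * 2) (DivMod.m%n<n n 2) ⟩
    suc (n / 2) * 2          ∎)
    where open ℕP.≤-Reasoning

  -- About n / 2 candidates stand against about n members of either family, and n / 2 ≥ 24 absorbs
  -- the constants.
  large₄ : ∀ n → 49 ≤ n → length (candidates₄ (suc n)) ≤ length (family₃ n) × length (candidates₄ (suc n)) ≤ length (family₅ n)
  large₄ n 49≤n = three , five
    where
    open ℕP.≤-Reasoning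
    b = n / 2
    24≤b : 24 ≤ b
    24≤b = DivMod./-monoˡ-≤ 2 49≤n
    bound : length (candidates₄ (suc n)) ≤ b + 11
    bound = begin
      length (candidates₄ (suc n)) ≤⟨ length-candidates₄ (suc n) ⟩
      suc n / 2 + 10               ≤⟨ ℕP.+-monoˡ-≤ 10 (half-suc n) ⟩
      suc b + 10                   ≡⟨ sym (ℕP.+-suc b 10) ⟩
      b + 11                       ∎
    three : length (candidates₄ (suc n)) ≤ length (family₃ n)
    three = ℕP.+-cancelʳ-≤ 1 _ _ (begin
      length (candidates₄ (suc n)) + 1 ≤⟨ ℕP.+-monoˡ-≤ 1 bound ⟩
      b + 11 + 1                       ≡⟨ ℕP.+-assoc b 11 1 ⟩
      b + 12                           ≤⟨ ℕP.+-monoʳ-≤ b (ℕP.≤-trans (ℕP.m≤m+n 12 12) 24≤b) ⟩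
      b + b                            ≡⟨ double b ⟩
      b * 2                            ≤⟨ DivMod.m/n*n≤m n 2 ⟩
      n                                ≤⟨ length-family₃ n ⟩
      length (family₃ n) + 1           ∎)
      where
      double : ∀ a → a + a ≡ a * 2
      double = solve-∀
    five : length (candidates₄ (suc n)) ≤ length (family₅ n)
    five = ℕP.+-cancelʳ-≤ 4 _ _ (begin
      length (candidates₄ (suc n)) + 4                       ≤⟨ ℕP.+-monoˡ-≤ 4 bound ⟩
      b + 11 + 4                                             ≡⟨ ℕP.+-assoc b 11 4 ⟩
      b + 15                                                 ≤⟨ ℕP.+-monoʳ-≤ b (ℕP.≤-trans (ℕP.m≤m+n 15 9) 24≤b) ⟩
      b + b                                                  ≤⟨ ℕP.+-mono-≤ (length-multipliers n) (length-multipliers n) ⟩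
      (length (multipliers n) + 2) + (length (multipliers n) + 2) ≡⟨ collect (length (multipliers n)) ⟩
      length (multipliers n) + length (multipliers n) + 4     ≡⟨ cong (_+ 4) (sym (length-family₅ n)) ⟩
      length (family₅ n) + 4                                  ∎)
      where
      collect : ∀ a → (a + 2) + (a + 2) ≡ a + a + 4
      collect = solve-∀

  squeeze : ∀ {s u a b x y} → s ≤ u → u ≤ a × u ≤ b → a ≤ x → b ≤ y → s ≤ x × s ≤ y
  squeeze p (q , q′) r r′ = ℕP.≤-trans p (ℕP.≤-trans q r) , ℕP.≤-trans p (ℕP.≤-trans q′ r′)

  spanning₃₄₅ : ∀ n → 12 ≤ n → spanning n 4 ≤ spanning n 3 × spanning n 4 ≤ spanning n 5
  spanning₃₄₅ n 12≤n = between (family₃-≤ n) (family₅-≤ n) (ℕP.≤-<-connex 49 n)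
    where
    between : ∀ {x y} → length (family₃ n) ≤ x → length (family₅ n) ≤ y → 49 ≤ n ⊎ n < 49 → spanning n 4 ≤ x × spanning n 4 ≤ y
    between p q (inj₁ 49≤n) = squeeze (spanning-≤′ n 4 (candidates₄ (suc n)) classify₄) (large₄ n 49≤n) p q
    between p q (inj₂ n<49) = squeeze (spanning-≤ n 4 (candidates₄ (suc n)) classify₄)
      (below-both-sound (upper₄ n) (length (family₃ n)) (length (family₅ n)) (holds-from-sound small₄ 37 12 n small₄-computed 12≤n n<49)) p q

  -- The left side is the bound 14 (n + 1) + 98 plus n for the lost row. At n = 49 the row sum is
  -- 990 = 847 + 143, and each further row adds at least 45.
  row-sum-≥ : ∀ k → 15 * (49 + k) + 112 ≤ row-sum (49 + k)
  row-sum-≥ zero = ℕP.m≤m+n 847 143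
  row-sum-≥ (suc k) = begin
    15 * (49 + suc k) + 112     ≡⟨ step k ⟩
    15 + (15 * (49 + k) + 112)  ≤⟨ ℕP.+-mono-≤ (ℕP.m≤m+n 15 (30 + k)) (row-sum-≥ k) ⟩
    row-sum (suc (49 + k))      ≡⟨ cong row-sum (sym (ℕP.+-suc 49 k)) ⟩
    row-sum (49 + suc k)        ∎
    where
    open ℕP.≤-Reasoning
    step : ∀ k → 15 * (49 + suc k) + 112 ≡ 15 + (15 * (49 + k) + 112)
    step = solve-∀

  from-49 : (p : ℕ → Set) → (∀ k → p (49 + k)) → ∀ n → 49 ≤ n → p n
  from-49 p h n 49≤n = subst p (ℕP.m+[n∸m]≡n 49≤n) (h (n ∸ 49))

  -- The factor 23 bounds the number of bases from below: n / 2 ≥ 24, and one value of x is lost to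
  -- 3x = d. At n = 49 the right side is 23 · 38 = 874 = 798 + 76.
  columns-≥ : ∀ k → 14 * suc (49 + k) + 98 ≤ 23 * (49 + k ∸ 11)
  columns-≥ k = begin
    14 * suc (49 + k) + 98  ≡⟨ expand k ⟩
    798 + 14 * k            ≤⟨ ℕP.+-mono-≤ (ℕP.m≤m+n 798 76) (ℕP.*-monoˡ-≤ k (ℕP.m≤m+n 14 9)) ⟩
    874 + 23 * k            ≡⟨ factor k ⟩
    23 * (38 + k)           ∎
    where
    open ℕP.≤-Reasoning
    expand : ∀ k → 14 * suc (49 + k) + 98 ≡ 798 + 14 * k
    expand = solve-∀
    factor : ∀ k → 874 + 23 * k ≡ 23 * (38 + k)
    factor = solve-∀

  large₇ : ∀ n → 49 ≤ n → length (candidates₇ (suc n)) ≤ length (family₆ n) × length (candidates₇ (suc n)) ≤ length (family₈ n)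
  large₇ n 49≤n = six , eight
    where
    open ℕP.≤-Reasoning
    six : length (candidates₇ (suc n)) ≤ length (family₆ n)
    six = ℕP.+-cancelʳ-≤ n _ _ (begin
      length (candidates₇ (suc n)) + n ≤⟨ ℕP.+-monoˡ-≤ n (length-candidates₇ (suc n)) ⟩
      14 * suc n + 98 + n              ≡⟨ collect n ⟩
      15 * n + 112                     ≤⟨ from-49 (λ n → 15 * n + 112 ≤ row-sum n) row-sum-≥ n 49≤n ⟩
      row-sum n                        ≤⟨ length-family₆ n ⟩
      length (family₆ n) + n           ∎)
      where
      collect : ∀ a → 14 * suc a + 98 + a ≡ 15 * a + 112
      collect = solve-∀
    23≤bases : 23 ≤ length (bases n)
    23≤bases = ℕP.+-cancelʳ-≤ 1 23 (length (bases n)) (ℕP.≤-trans (DivMod./-monoˡ-≤ 2 49≤n) (length-bases n))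
    eight : length (candidates₇ (suc n)) ≤ length (family₈ n)
    eight = begin
      length (candidates₇ (suc n))  ≤⟨ length-candidates₇ (suc n) ⟩
      14 * suc n + 98               ≤⟨ from-49 (λ n → 14 * suc n + 98 ≤ 23 * (n ∸ 11)) columns-≥ n 49≤n ⟩
      23 * (n ∸ 11)                 ≤⟨ ℕP.*-monoˡ-≤ (n ∸ 11) 23≤bases ⟩
      length (bases n) * (n ∸ 11)   ≤⟨ length-family₈ n ⟩
      length (family₈ n)            ∎

  spanning₆₇₈ : ∀ n → 14 ≤ n → spanning n 7 ≤ spanning n 6 × spanning n 7 ≤ spanning n 8
  spanning₆₇₈ n 14≤n = between (family₆-≤ n) (family₈-≤ n) (ℕP.≤-<-connex 49 n)
    where
    between : ∀ {x y} → length (family₆ n) ≤ x → length (family₈ n) ≤ y → 49 ≤ n ⊎ n < 49 → spanning n 7 ≤ x × spanning n 7 ≤ y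
    between p q (inj₁ 49≤n) = squeeze (spanning-≤′ n 7 (candidates₇ (suc n)) classify₇) (large₇ n 49≤n) p q
    between p q (inj₂ n<49) = squeeze (spanning-≤ n 7 (candidates₇ (suc n)) classify₇)
      (below-both-sound (upper₇ n) (length (family₆ n)) (length (family₈ n)) (holds-from-sound small₇ 35 14 n small₇-computed 14≤n n<49)) p q

  spanning-wavy : ∀ {n} → 12 ℕ.≤′ n → Wavy _≤_ (spanning n)
  spanning-wavy ℕ.≤′-refl = spanning-12
  spanning-wavy (ℕ.≤′-step ℕ.≤′-refl) = spanning-13
  spanning-wavy {suc (suc n)} (ℕ.≤′-step (ℕ.≤′-step p)) =
    wavy (spanning₁₂₃ (2 + n) (s≤s (s≤s z≤n))) (spanning₃₄₅ (2 + n) (ℕP.m≤n⇒m≤1+n (ℕP.m≤n⇒m≤1+n 12≤n))) (spanning₆₇₈ (2 + n) (s≤s (s≤s 12≤n)))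
    where
    12≤n : 12 ≤ n
    12≤n = ℕP.≤′⇒≤ p

  leading-wavy : ∀ {n} → 12 ℕ.≤′ n → Wavy _≤_ (leading n)
  leading-wavy ℕ.≤′-refl = leading-12
  leading-wavy {suc n} (ℕ.≤′-step p) = wavy-+ ℕP.+-mono-≤ (leading-suc n) (spanning-wavy p) (leading-wavy p)

  -- Strictness stems from n = 12 alone; each later step adds a weak inequality for `leading` to a
  -- strict one.
  total-wavy : ∀ {n} → 12 ℕ.≤′ n → Wavy _<_ (total n)
  total-wavy ℕ.≤′-refl = total-12
  total-wavy {suc n} (ℕ.≤′-step p) = wavy-+ ℕP.+-mono-≤-< (total-suc n) (leading-wavy p) (total-wavy p)

  P-< : ∀ n {j k} → countDiff n j < countDiff n k → P n j ℚ.< P n k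
  P-< n h = ℚ.*<* (ℤP.*-monoʳ-<-pos (+ suc (2 ^ n ∸ 1)) (ℤ.+<+ h))

  total⇒P : ∀ n i j → total n (suc i) < total n (suc j) → P n (suc (suc i + suc i)) ℚ.< P n (suc (suc j + suc j))
  total⇒P n i j h = P-< n (subst₂ _<_ (sym (countDiff-total n i)) (sym (countDiff-total n j)) h)

open Comparison
open import Data.Nat using (ℕ; _≥_)
open import Data.Rational.Unnormalised using (_<_; _>_)

theorem1p1 : (n : ℕ) → n ≥ 12 →
    (P n 3 > P n 5 × P n 5 < P n 7) ×
    (P n 7 > P n 9 × P n 9 < P n 11) ×
    (P n 13 > P n 15 × P n 15 < P n 17)
theorem1p1 n 12≤n =
  -- The arguments i and j of `total⇒P` stand for the sizes 2 (i + 1) + 1 and 2 (j + 1) + 1.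
  (total⇒P n 1 0 (proj₁ at₂) , total⇒P n 1 2 (proj₂ at₂)) ,
  (total⇒P n 3 2 (proj₁ at₄) , total⇒P n 3 4 (proj₂ at₄)) ,
  (total⇒P n 6 5 (proj₁ at₇) , total⇒P n 6 7 (proj₂ at₇))
  where
  open Wavy (total-wavy (ℕP.≤⇒≤′ 12≤n))
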